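{- There exist integers $q_k$, one for each positive integer $k$, such that for every $k$ and every prime power $q \ge q_k$, $$\mathcal{F}(\mathcal{I}_{1,q}) > \mathcal{F}(\mathcal{I}_{2,q}) > \cdots > \mathcal{F}(\mathcal{I}_{k,q}),$$ and such that $q_k = O(k^2 4^k)$ as $k \to \infty$. In particular, $q_k < 4.03\,(k-1)^2\, 4^k\, \zeta(k)^2$ for all $k \ge 2$.
   Context: For a prime power $q$ and $k \ge 1$, $\mathcal{I}_{k,q}$ is the set of monic polynomials in $\mathbb{F}_q[x]$ with exactly $k$ monic irreducible factors counted with multiplicity. For a set $A$ of nonconstant monic polynomials in $\mathbb{F}_q[x]$, $\mathcal{F}(A) = \sum_{a \in A} \frac{1}{q^{\deg a} \deg a}$. $\zeta$ is the Riemann zeta function. -}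

module Defs where

open import Algebra.Bundles using (CommutativeRing; RawSemiring)
import Algebra.Definitions.RawSemiring as RawSemiringDefs
open import Data.Fin.Base using (Fin)
open import Data.Fin.Properties using (nonZeroIndex)
open import Data.Integer.Base as ℤ using (ℤ; +_; +[1+_]; -[1+_])
import Data.Integer.Properties as ℤₚ
open import Data.List.Base as List using (List; []; _∷_; _∷ʳ_)
open import Data.List.Relation.Unary.All using (All)
import Data.List.Relation.Unary.Unique.Setoid as UniqueSetoid
open import Data.Nat.Base as ℕ using (ℕ; zero; suc; NonZero; s≤s)
open import Data.Nat.Primality using (Prime)
import Data.Nat.Properties as ℕₚ
open import Data.Product.Base using (∃; _×_; _,_; proj₁; proj₂)
open import Data.Rational.Base as ℚ
  using (ℚ; mkℚ; 0ℚ; 1ℚ; _/_; 1/_; *<*; *≤*)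
import Data.Rational.Properties as ℚₚ
open import Data.Rational.Solver using (module +-*-Solver)
import Data.Rational.Unnormalised.Base as ℚᵘ
import Data.Rational.Unnormalised.Properties as ℚᵘₚ
open import Data.Sum.Base using (inj₁; inj₂)
open import Data.Vec.Base as Vec using (Vec)
open import Function.Bundles using (Inverse)
open import Level using (0ℓ)
open import Relation.Binary.Bundles using (Setoid)
open import Relation.Binary.PropositionalEquality as ≡ using (_≡_)
open import Relation.Nullary.Negation using (¬_)
open import Relation.Unary using (Pred)

IsCauchy : (ℕ → ℚ) → Set
IsCauchy s = ∀ ε → 0ℚ ℚ.< ε →
  ∃ λ N → ∀ m n → N ℕ.≤ m → N ℕ.≤ n → ℚ.∣ s m ℚ.- s n ∣ ℚ.≤ ε

record ℝ : Set where
  constructor mkℝ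
  field
    seq    : ℕ → ℚ
    cauchy : IsCauchy seq

open ℝ public

infix 4 _<ℝ_ _>ℝ_ _≤ℝ_

_<ℝ_ : ℝ → ℝ → Set
x <ℝ y = ∃ λ ε → 0ℚ ℚ.< ε ×
  ∃ λ N → ∀ n → N ℕ.≤ n → seq x n ℚ.+ ε ℚ.≤ seq y n

_>ℝ_ : ℝ → ℝ → Set
x >ℝ y = y <ℝ x

_≤ℝ_ : ℝ → ℝ → Set
x ≤ℝ y = ∀ ε → 0ℚ ℚ.< ε →
  ∃ λ N → ∀ n → N ℕ.≤ n → seq x n ℚ.≤ seq y n ℚ.+ ε

fromℚ : ℚ → ℝ
fromℚ p = mkℝ (λ _ → p) λ ε 0<ε → 0 , λ _ _ _ _ →
  ℚₚ.≤-trans (ℚₚ.≤-reflexive (≡.cong ℚ.∣_∣ (ℚₚ.+-inverseʳ p))) (ℚₚ.<⇒≤ 0<ε)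

fromℤ : ℤ → ℝ
fromℤ i = fromℚ (i / 1)

private
  module _ (s : ℕ → ℚ) (s-cauchy : IsCauchy s) where

    0<1 : 0ℚ ℚ.< 1ℚ
    0<1 = ℚₚ.positive⁻¹ 1ℚ

    N₁ : ℕ
    N₁ = proj₁ (s-cauchy 1ℚ 0<1)

    bound : ℚ
    bound = ℚ.∣ s N₁ ∣ ℚ.+ 1ℚ

    bound-positive : ℚ.Positive bound
    bound-positive =
      ℚₚ.nonNeg+pos⇒pos ℚ.∣ s N₁ ∣ {{ℚₚ.∣-∣-nonNeg (s N₁)}} 1ℚ

    bounded : ∀ n → N₁ ℕ.≤ n → ℚ.∣ s n ∣ ℚ.≤ bound
    bounded n N₁≤n = begin
      ℚ.∣ s n ∣
        ≡⟨ ≡.cong ℚ.∣_∣ (solve 2 (λ a b → a := b :+ (a :- b)) ≡.refl (s n) (s N₁)) ⟩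
      ℚ.∣ s N₁ ℚ.+ (s n ℚ.- s N₁) ∣
        ≤⟨ ℚₚ.∣p+q∣≤∣p∣+∣q∣ (s N₁) (s n ℚ.- s N₁) ⟩
      ℚ.∣ s N₁ ∣ ℚ.+ ℚ.∣ s n ℚ.- s N₁ ∣
        ≤⟨ ℚₚ.+-monoʳ-≤ ℚ.∣ s N₁ ∣ (proj₂ (s-cauchy 1ℚ 0<1) n N₁ N₁≤n ℕₚ.≤-refl) ⟩
      bound ∎
      where
      open ℚₚ.≤-Reasoning
      open +-*-Solver

  *-mono-≤-nonNeg : ∀ {p q r t} → 0ℚ ℚ.≤ r → 0ℚ ℚ.≤ q →
    p ℚ.≤ q → r ℚ.≤ t → p ℚ.* r ℚ.≤ q ℚ.* t
  *-mono-≤-nonNeg {q = q} {r} 0≤r 0≤q p≤q r≤t = ℚₚ.≤-trans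
    (ℚₚ.*-monoʳ-≤-nonNeg r {{ℚ.nonNegative 0≤r}} p≤q)
    (ℚₚ.*-monoˡ-≤-nonNeg q {{ℚ.nonNegative 0≤q}} r≤t)

  *-cauchy : ∀ s t → IsCauchy s → IsCauchy t → IsCauchy (λ n → s n ℚ.* t n)
  *-cauchy s t s-cauchy t-cauchy ε 0<ε = N , proof
    where
    open ℚₚ.≤-Reasoning
    open +-*-Solver

    B C D δ : ℚ
    B = bound s s-cauchy
    C = bound t t-cauchy
    D = B ℚ.+ C

    instance
      B-positive : ℚ.Positive B
      B-positive = bound-positive s s-cauchy
      C-positive : ℚ.Positive C
      C-positive = bound-positive t t-cauchy
      D-positive : ℚ.Positive D
      D-positive = ℚₚ.pos+pos⇒pos B C
      D-nonZero : ℚ.NonZero D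
      D-nonZero = ℚₚ.pos⇒nonZero D
      1/D-positive : ℚ.Positive (1/ D)
      1/D-positive = ℚₚ.1/pos⇒pos D
      ε-positive : ℚ.Positive ε
      ε-positive = ℚ.positive 0<ε

    δ = ε ℚ.* (1/ D)

    0<δ : 0ℚ ℚ.< δ
    0<δ = ℚₚ.positive⁻¹ δ {{ℚₚ.pos*pos⇒pos ε (1/ D)}}

    Ns Nt N : ℕ
    Ns = proj₁ (s-cauchy δ 0<δ)
    Nt = proj₁ (t-cauchy δ 0<δ)
    N = (N₁ s s-cauchy ℕ.⊔ N₁ t t-cauchy) ℕ.⊔ (Ns ℕ.⊔ Nt)

    proof : ∀ m n → N ℕ.≤ m → N ℕ.≤ n → ℚ.∣ s m ℚ.* t m ℚ.- s n ℚ.* t n ∣ ℚ.≤ ε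
    proof m n N≤m N≤n = begin
      ℚ.∣ s m ℚ.* t m ℚ.- s n ℚ.* t n ∣
        ≡⟨ ≡.cong ℚ.∣_∣ (solve 4 (λ a b c d → a :* c :- b :* d
             := a :* (c :- d) :+ (a :- b) :* d) ≡.refl (s m) (s n) (t m) (t n)) ⟩
      ℚ.∣ s m ℚ.* (t m ℚ.- t n) ℚ.+ (s m ℚ.- s n) ℚ.* t n ∣
        ≤⟨ ℚₚ.∣p+q∣≤∣p∣+∣q∣ (s m ℚ.* (t m ℚ.- t n)) ((s m ℚ.- s n) ℚ.* t n) ⟩
      ℚ.∣ s m ℚ.* (t m ℚ.- t n) ∣ ℚ.+ ℚ.∣ (s m ℚ.- s n) ℚ.* t n ∣
        ≡⟨ ≡.cong₂ ℚ._+_ (ℚₚ.∣p*q∣≡∣p∣*∣q∣ (s m) (t m ℚ.- t n))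
                         (ℚₚ.∣p*q∣≡∣p∣*∣q∣ (s m ℚ.- s n) (t n)) ⟩
      ℚ.∣ s m ∣ ℚ.* ℚ.∣ t m ℚ.- t n ∣ ℚ.+ ℚ.∣ s m ℚ.- s n ∣ ℚ.* ℚ.∣ t n ∣
        ≤⟨ ℚₚ.+-mono-≤
             (*-mono-≤-nonNeg (ℚₚ.0≤∣p∣ (t m ℚ.- t n)) (ℚₚ.<⇒≤ (ℚₚ.positive⁻¹ B))
               (bounded s s-cauchy m (≤N₁s N≤m))
               (proj₂ (t-cauchy δ 0<δ) m n (≤Nt N≤m) (≤Nt N≤n)))
             (*-mono-≤-nonNeg (ℚₚ.0≤∣p∣ (t n)) (ℚₚ.<⇒≤ 0<δ)
               (proj₂ (s-cauchy δ 0<δ) m n (≤Ns N≤m) (≤Ns N≤n))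
               (bounded t t-cauchy n (≤N₁t N≤n))) ⟩
      B ℚ.* δ ℚ.+ δ ℚ.* C
        ≡⟨ solve 4 (λ b c e i → b :* (e :* i) :+ (e :* i) :* c := e :* (i :* (b :+ c)))
             ≡.refl B C ε (1/ D) ⟩
      ε ℚ.* (1/ D ℚ.* D)
        ≡⟨ ≡.cong (ε ℚ.*_) (ℚₚ.*-inverseˡ D) ⟩
      ε ℚ.* 1ℚ
        ≡⟨ ℚₚ.*-identityʳ ε ⟩
      ε ∎
      where
      ≤N₁s : ∀ {i} → N ℕ.≤ i → N₁ s s-cauchy ℕ.≤ i
      ≤N₁s le = ℕₚ.m⊔n≤o⇒m≤o _ (N₁ t t-cauchy) (ℕₚ.m⊔n≤o⇒m≤o _ (Ns ℕ.⊔ Nt) le)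
      ≤N₁t : ∀ {i} → N ℕ.≤ i → N₁ t t-cauchy ℕ.≤ i
      ≤N₁t le = ℕₚ.m⊔n≤o⇒n≤o (N₁ s s-cauchy) _ (ℕₚ.m⊔n≤o⇒m≤o _ (Ns ℕ.⊔ Nt) le)
      ≤Ns : ∀ {i} → N ℕ.≤ i → Ns ℕ.≤ i
      ≤Ns le = ℕₚ.m⊔n≤o⇒m≤o _ Nt (ℕₚ.m⊔n≤o⇒n≤o (N₁ s s-cauchy ℕ.⊔ N₁ t t-cauchy) _ le)
      ≤Nt : ∀ {i} → N ℕ.≤ i → Nt ℕ.≤ i
      ≤Nt le = ℕₚ.m⊔n≤o⇒n≤o Ns _ (ℕₚ.m⊔n≤o⇒n≤o (N₁ s s-cauchy ℕ.⊔ N₁ t t-cauchy) _ le)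

infixl 7 _*ℝ_

_*ℝ_ : ℝ → ℝ → ℝ
x *ℝ y = mkℝ (λ n → seq x n ℚ.* seq y n) (*-cauchy (seq x) (seq y) (cauchy x) (cauchy y))

ζ-partial : ℕ → ℕ → ℚ
ζ-partial s zero    = 0ℚ
ζ-partial s (suc n) = ζ-partial s n ℚ.+ (+ 1 / (suc n ℕ.^ s)) {{ℕₚ.m^n≢0 (suc n) s}}

private
  unit : ℕ → ℚ
  unit n = + 1 / suc n

  1/-antimono : ∀ m n .{{_ : NonZero m}} .{{_ : NonZero n}} →
    m ℕ.≤ n → + 1 / n ℚ.≤ + 1 / m
  1/-antimono m@(suc _) n@(suc _) m≤n = ℚₚ.toℚᵘ-cancel-≤ (ℚᵘₚ.≤-respˡ-≃
    (ℚᵘₚ.≃-sym (ℚₚ.toℚᵘ-fromℚᵘ (+ 1 ℚᵘ./ n)))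
    (ℚᵘₚ.≤-respʳ-≃ (ℚᵘₚ.≃-sym (ℚₚ.toℚᵘ-fromℚᵘ (+ 1 ℚᵘ./ m)))
      (ℚᵘ.*≤* (ℤₚ.*-monoˡ-≤-nonNeg (+ 1) (ℤ.+≤+ m≤n)))))

  1/-nonNeg : ∀ n .{{_ : NonZero n}} → 0ℚ ℚ.≤ + 1 / n
  1/-nonNeg n = ℚₚ.nonNegative⁻¹ (+ 1 / n) {{ℚₚ.normalize-nonNeg 1 n}}

  telescope : ∀ n → (+ 1 / (suc n ℕ.* suc (suc n))) ℚ.+ unit (suc n) ≡ unit n
  telescope n = ℚₚ.toℚᵘ-injective (begin
    ℚ.toℚᵘ ((+ 1 / (a ℕ.* b)) ℚ.+ (+ 1 / b))
      ≈⟨ ℚₚ.toℚᵘ-homo-+ (+ 1 / (a ℕ.* b)) (+ 1 / b) ⟩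
    ℚ.toℚᵘ (+ 1 / (a ℕ.* b)) ℚᵘ.+ ℚ.toℚᵘ (+ 1 / b)
      ≈⟨ ℚᵘₚ.+-cong (ℚₚ.toℚᵘ-fromℚᵘ (+ 1 ℚᵘ./ (a ℕ.* b))) (ℚₚ.toℚᵘ-fromℚᵘ (+ 1 ℚᵘ./ b)) ⟩
    (+ 1 ℚᵘ./ (a ℕ.* b)) ℚᵘ.+ (+ 1 ℚᵘ./ b)
      ≈⟨ ℚᵘ.*≡* (≡.cong +_ (lemma n)) ⟩
    (+ 1 ℚᵘ./ a)
      ≈⟨ ℚₚ.toℚᵘ-fromℚᵘ (+ 1 ℚᵘ./ a) ⟨
    ℚ.toℚᵘ (+ 1 / a) ∎)
    where
    open ℚᵘₚ.≃-Reasoning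
    open import Data.Nat.Tactic.RingSolver using (solve-∀)
    a = suc n
    b = suc (suc n)
    lemma : ∀ n → (1 ℕ.* suc (suc n) ℕ.+ 1 ℕ.* (suc n ℕ.* suc (suc n))) ℕ.* suc n
          ≡ 1 ℕ.* ((suc n ℕ.* suc (suc n)) ℕ.* suc (suc n))
    lemma = solve-∀

  module _ (s : ℕ) (2≤s : 2 ℕ.≤ s) where

    step : ∀ n → ζ-partial s (suc (suc n)) ℚ.+ unit (suc n)
               ℚ.≤ ζ-partial s (suc n) ℚ.+ unit n
    step n = begin
      (ζ-partial s (suc n) ℚ.+ term) ℚ.+ unit (suc n)
        ≡⟨ ℚₚ.+-assoc (ζ-partial s (suc n)) term (unit (suc n)) ⟩
      ζ-partial s (suc n) ℚ.+ (term ℚ.+ unit (suc n))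
        ≤⟨ ℚₚ.+-monoʳ-≤ (ζ-partial s (suc n)) (ℚₚ.+-monoˡ-≤ (unit (suc n))
             (1/-antimono (suc n ℕ.* b) (b ℕ.^ s) {{_}} {{ℕₚ.m^n≢0 b s}} le)) ⟩
      ζ-partial s (suc n) ℚ.+ ((+ 1 / (suc n ℕ.* b)) ℚ.+ unit (suc n))
        ≡⟨ ≡.cong (ζ-partial s (suc n) ℚ.+_) (telescope n) ⟩
      ζ-partial s (suc n) ℚ.+ unit n ∎
      where
      open ℚₚ.≤-Reasoning
      b = suc (suc n)
      term = (+ 1 / (b ℕ.^ s)) {{ℕₚ.m^n≢0 b s}}
      le : suc n ℕ.* b ℕ.≤ b ℕ.^ s
      le = ℕₚ.≤-trans (ℕₚ.*-monoˡ-≤ b (ℕₚ.n≤1+n (suc n)))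
        (ℕₚ.≤-trans (ℕₚ.≤-reflexive (≡.cong (b ℕ.*_) (≡.sym (ℕₚ.*-identityʳ b))))
          (ℕₚ.^-monoʳ-≤ b 2≤s))

    increasing : ∀ {m n} → m ℕ.≤′ n → ζ-partial s m ℚ.≤ ζ-partial s n
    increasing (ℕ.≤′-reflexive ≡.refl) = ℚₚ.≤-refl
    increasing {m} {suc n} (ℕ.≤′-step m≤n) = ℚₚ.≤-trans (increasing m≤n)
      (ℚₚ.≤-trans (ℚₚ.≤-reflexive (≡.sym (ℚₚ.+-identityʳ (ζ-partial s n))))
        (ℚₚ.+-monoʳ-≤ (ζ-partial s n) (1/-nonNeg (suc n ℕ.^ s) {{ℕₚ.m^n≢0 (suc n) s}})))

    decreasing : ∀ {m n} → m ℕ.≤′ n →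
      ζ-partial s (suc n) ℚ.+ unit n ℚ.≤ ζ-partial s (suc m) ℚ.+ unit m
    decreasing (ℕ.≤′-reflexive ≡.refl) = ℚₚ.≤-refl
    decreasing {m} {suc n} (ℕ.≤′-step m≤n) = ℚₚ.≤-trans (step n) (decreasing m≤n)

    tail≤ : ∀ {m n} → m ℕ.≤ n →
      ζ-partial s (suc n) ℚ.≤ ζ-partial s (suc m) ℚ.+ unit m
    tail≤ {m} {n} m≤n = ℚₚ.≤-trans
      (ℚₚ.≤-trans (ℚₚ.≤-reflexive (≡.sym (ℚₚ.+-identityʳ (ζ-partial s (suc n)))))
        (ℚₚ.+-monoʳ-≤ (ζ-partial s (suc n)) (1/-nonNeg (suc n))))
      (decreasing (ℕₚ.≤⇒≤′ m≤n))

    ordered : ∀ {M m n} → suc M ℕ.≤ m → m ℕ.≤ n →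
      ζ-partial s n ℚ.- ζ-partial s m ℚ.≤ unit M
    ordered {M} {m} {suc n} M<m m≤n = begin
      ζ-partial s (suc n) ℚ.- ζ-partial s m
        ≤⟨ ℚₚ.+-mono-≤ (tail≤ (ℕₚ.≤-pred (ℕₚ.≤-trans M<m m≤n)))
             (ℚₚ.neg-antimono-≤ (increasing (ℕₚ.≤⇒≤′ M<m))) ⟩
      (ζ-partial s (suc M) ℚ.+ unit M) ℚ.- ζ-partial s (suc M)
        ≡⟨ solve 2 (λ a b → (a :+ b) :- a := b) ≡.refl (ζ-partial s (suc M)) (unit M) ⟩
      unit M ∎
      where
      open ℚₚ.≤-Reasoning
      open +-*-Solver
    ordered {m = zero} {zero} () _
    ordered {m = suc _} {zero} _ ()

    distance : ∀ {M m n} → suc M ℕ.≤ m → m ℕ.≤ n →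
      ℚ.∣ ζ-partial s n ℚ.- ζ-partial s m ∣ ℚ.≤ unit M
    distance {M} {m} {n} M<m m≤n = ℚₚ.≤-trans
      (ℚₚ.≤-reflexive (ℚₚ.0≤p⇒∣p∣≡p
        (ℚₚ.≤-trans (ℚₚ.≤-reflexive (≡.sym (ℚₚ.+-inverseʳ (ζ-partial s m))))
          (ℚₚ.+-monoˡ-≤ (ℚ.- ζ-partial s m) (increasing (ℕₚ.≤⇒≤′ m≤n))))))
      (ordered M<m m≤n)

    distance′ : ∀ M m n → suc M ℕ.≤ m → suc M ℕ.≤ n →
      ℚ.∣ ζ-partial s m ℚ.- ζ-partial s n ∣ ℚ.≤ unit M
    distance′ M m n M<m M<n with ℕₚ.≤-total n m
    ... | inj₁ n≤m = distance M<n n≤m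
    ... | inj₂ m≤n = ℚₚ.≤-trans
      (ℚₚ.≤-reflexive (≡.trans
        (≡.sym (ℚₚ.∣-p∣≡∣p∣ (ζ-partial s m ℚ.- ζ-partial s n)))
        (≡.cong ℚ.∣_∣ (solve 2 (λ a b → :- (a :- b) := b :- a) ≡.refl
          (ζ-partial s m) (ζ-partial s n)))))
      (distance M<m m≤n)
      where open +-*-Solver

    unit-denominator : ∀ ε → 0ℚ ℚ.< ε → unit (ℚ.denominator-1 ε) ℚ.≤ ε
    unit-denominator (mkℚ +[1+ a ] d c) _ =
      ℚₚ.toℚᵘ-cancel-≤ (ℚᵘₚ.≤-respˡ-≃
        (ℚᵘₚ.≃-sym (ℚₚ.toℚᵘ-fromℚᵘ (+ 1 ℚᵘ./ suc d)))
        (ℚᵘ.*≤* (ℤₚ.*-monoʳ-≤-nonNeg (+ suc d) (ℤ.+≤+ (s≤s {n = a} ℕ.z≤n)))))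
    unit-denominator (mkℚ (+ 0) d c) (*<* (ℤ.+<+ ()))
    unit-denominator (mkℚ -[1+ a ] d c) (*<* ())

    ζ-cauchy : IsCauchy (ζ-partial s)
    ζ-cauchy ε 0<ε = suc (ℚ.denominator-1 ε) , λ m n N≤m N≤n →
      ℚₚ.≤-trans (distance′ (ℚ.denominator-1 ε) m n N≤m N≤n) (unit-denominator ε 0<ε)

ζ : (s : ℕ) → 2 ℕ.≤ s → ℝ
ζ s 2≤s = mkℝ (ζ-partial s) (ζ-cauchy s 2≤s)

IsPrimePower : ℕ → Set
IsPrimePower q = ∃ λ p → ∃ λ e → Prime p × 1 ℕ.≤ e × q ≡ p ℕ.^ e

record FiniteField (q : ℕ) : Set₁ where
  field
    commutativeRing : CommutativeRing 0ℓ 0ℓ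
  open CommutativeRing commutativeRing public
  field
    1≉0         : ¬ (1# ≈ 0#)
    inverse     : ∀ x → ¬ (x ≈ 0#) → ∃ λ y → x * y ≈ 1#
    enumeration : Inverse setoid (≡.setoid (Fin q))

  q-nonZero : NonZero q
  q-nonZero = nonZeroIndex (Inverse.to enumeration 0#)

-- Polynomials are lists of coefficients, constant coefficient first.  Trailing
-- zeros are allowed, so equality compares all coefficients.
module Polynomial (R : CommutativeRing 0ℓ 0ℓ) where
  open CommutativeRing R

  Poly : Set
  Poly = List Carrier

  coeff : Poly → ℕ → Carrier
  coeff []      _       = 0#
  coeff (a ∷ p) zero    = a
  coeff (a ∷ p) (suc i) = coeff p i

  infix  4 _≈ₚ_
  infixl 6 _+ₚ_
  infixl 7 _*ₚ_

  _≈ₚ_ : Poly → Poly → Set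
  p ≈ₚ r = ∀ i → coeff p i ≈ coeff r i

  _+ₚ_ : Poly → Poly → Poly
  []      +ₚ r       = r
  (a ∷ p) +ₚ []      = a ∷ p
  (a ∷ p) +ₚ (b ∷ r) = (a + b) ∷ (p +ₚ r)

  _*ₚ_ : Poly → Poly → Poly
  []      *ₚ r = []
  (a ∷ p) *ₚ r = List.map (a *_) r +ₚ (0# ∷ (p *ₚ r))

  poly-rawSemiring : RawSemiring 0ℓ 0ℓ
  poly-rawSemiring = record
    { Carrier = Poly
    ; _≈_     = _≈ₚ_
    ; _+_     = _+ₚ_
    ; _*_     = _*ₚ_
    ; 0#      = []
    ; 1#      = 1# ∷ []
    }

  open RawSemiringDefs poly-rawSemiring public using (Irreducible; product)

  -- The leading coefficient 1# is not stored: lower lists the coefficients of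
  -- x ^ 0, …, x ^ (degree ∸ 1).
  record NonconstantMonic : Set where
    constructor monic
    field
      degree             : ℕ
      {{degree-nonZero}} : NonZero degree
      lower              : Vec Carrier degree

    poly : Poly
    poly = Vec.toList lower ∷ʳ 1#

  open NonconstantMonic public using (degree; poly)

  monic-setoid : Setoid 0ℓ 0ℓ
  monic-setoid = record
    { Carrier       = NonconstantMonic
    ; _≈_           = λ f g → poly f ≈ₚ poly g
    ; isEquivalence = record
      { refl  = λ i → refl
      ; sym   = λ f≈g i → sym (f≈g i)
      ; trans = λ f≈g g≈h i → trans (f≈g i) (g≈h i)
      }
    }

  open UniqueSetoid monic-setoid public using (Unique)

module _ {q : ℕ} (F : FiniteField q) where
  open Polynomial (FiniteField.commutativeRing F)

  -- All elements of 𝓘 k are nonconstant when k ≥ 1, so nothing is lost by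
  -- taking only nonconstant monic polynomials as the ambient type.
  -- By unique factorisation, having exactly k monic irreducible factors counted
  -- with multiplicity means being a product of k monic irreducibles.
  𝓘 : ℕ → Pred NonconstantMonic 0ℓ
  𝓘 k f = ∃ λ (g : Fin k → NonconstantMonic) →
    (∀ i → Irreducible (poly (g i))) × (poly f ≈ₚ product (λ i → poly (g i)))

  weight : NonconstantMonic → ℚ
  weight f = (+ 1 / (q ℕ.^ degree f ℕ.* degree f)) {{nonZero}}
    where
    nonZero : NonZero (q ℕ.^ degree f ℕ.* degree f)
    nonZero = ℕₚ.m*n≢0 (q ℕ.^ degree f) (degree f)
      {{ℕₚ.m^n≢0 q (degree f) {{FiniteField.q-nonZero F}}}}
      {{NonconstantMonic.degree-nonZero f}}

  finiteSum : List NonconstantMonic → ℚ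
  finiteSum []      = 0ℚ
  finiteSum (f ∷ T) = weight f ℚ.+ finiteSum T

  -- Duplicate-free lists, up to equality of polynomials, of members of A.
  FiniteSubset : Pred NonconstantMonic 0ℓ → Pred (List NonconstantMonic) 0ℓ
  FiniteSubset A T = Unique T × All A T

  -- Is𝓕 A x: the series of nonnegative terms 1 / (q ^ deg f * deg f), f ∈ A, converges
  -- and has sum x, i.e. x is the supremum of the sums over finite subsets of A.
  record Is𝓕 (A : Pred NonconstantMonic 0ℓ) (x : ℝ) : Set where
    field
      upper : ∀ T → FiniteSubset A T → fromℚ (finiteSum T) ≤ℝ x
      least : ∀ y → y <ℝ x → ∃ λ T → FiniteSubset A T × y <ℝ fromℚ (finiteSum T)

{-# OPTIONS --safe #-}
module Submission where

-- Let a j n be the number of monic polynomials of degree n with exactly j irreducible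
-- factors, so that 𝓕 (𝓘 j) = Σₙ a j n / (qⁿ n).  For f = P₁ ⋯ Pⱼ₊₁ of degree n write
-- n = Σᵢ deg Pᵢ and charge the term of Pᵢ to the pair (Pᵢ , f / Pᵢ).  A pair (P , h) is charged
-- once, or at most j + 1 times if P divides h, which happens for at most j primes P; hence
-- n · a (j+1) n ≤ Σ_d d (π d + j²) a j (n ∸ d), where π d counts the primes of degree d.  As the
-- distinct prime divisors of f have total degree at most deg f, d π d / q^d is at most 1 on
-- average, and Abel summation yields
--   𝓕 (𝓘 (j+1)) ≤ Σₘ a j m / qᵐ · (Σ_{n>m} 1/n² + (4 j² / q) / (m+1)²).
-- Here Σ_{n>m} 1/n² ≤ (1/m + 1/(m+1)) / 2, so the bracket is smaller than 1/m as soon as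
-- q ≥ 16 j², and the sum is smaller than 𝓕 (𝓘 j), term by term.  The same inequality with
-- 1/(n+c)² in place of 1/n² shows by induction on j that the series converges.

open import Defs
open import Algebra.Bundles using (CommutativeMonoid; CommutativeRing; CommutativeSemiring)
import Algebra.Definitions.RawSemiring as RawSemiringDefinitions
import Algebra.Properties.CommutativeMonoid.Sum as MonoidSum
import Algebra.Properties.CommutativeSemigroup as CSemigroup
import Algebra.Properties.CommutativeSemigroup.Divisibility as SemigroupDivisibility
import Algebra.Properties.Group as GroupProperties
import Algebra.Properties.Monoid.Divisibility as MonoidDivisibility
import Algebra.Properties.Ring as RingProperties
open import Data.Fin.Base as Fin using (Fin; toℕ; punchOut)
import Data.Fin.Properties as Finₚ
open import Data.Integer.Base as ℤ using (-[1+_]; +[1+_])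
import Data.Integer.Properties as ℤₚ
open import Data.List.Base as List using (List; []; _∷_; _∷ʳ_; _++_; length; cartesianProductWith; filter; allFin)
open import Data.List.Membership.Propositional using (find)
import Data.List.Membership.Setoid as SetoidMembership
import Data.List.Membership.Setoid.Properties as Membershipₚ
import Data.List.Properties as Listₚ
open import Data.List.Relation.Unary.All as All using (All; []; _∷_)
import Data.List.Relation.Unary.All.Properties as Allₚ
open import Data.List.Relation.Unary.AllPairs as AllPairs using (AllPairs; []; _∷_)
import Data.List.Relation.Unary.AllPairs.Properties as AllPairsₚ
open import Data.List.Relation.Unary.Any as Any using (Any; here; there; any?)
import Data.List.Relation.Unary.Any.Properties as Anyₚ
import Data.List.Relation.Unary.Unique.Setoid as UniqueSetoid
import Data.List.Relation.Unary.Unique.Setoid.Properties as UniqueSetoidₚ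
open import Data.Nat.Base as ℕ using (ℕ; zero; suc; NonZero; z≤n; s≤s)
open import Data.Nat.Induction using (Acc; acc; <-wellFounded)
open import Data.Nat.Primality using (prime⇒nonTrivial; prime⇒nonZero)
import Data.Nat.Properties as ℕₚ
open import Data.Nat.Tactic.RingSolver using (solve-∀)
open import Data.Product.Base using (∃; ∃₂; _×_; _,_; proj₁; proj₂)
open import Data.Rational.Base as ℚ using (ℚ; mkℚ; 0ℚ; 1ℚ; ½; *<*)
import Data.Rational.Properties as ℚₚ
open import Data.Rational.Solver using (module +-*-Solver)
import Data.Rational.Unnormalised.Base as ℚᵘ
import Data.Rational.Unnormalised.Properties as ℚᵘₚ
open import Data.Sum.Base as Sum using (_⊎_; inj₁; inj₂)
open import Data.Vec.Base as Vec using (Vec)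
open import Data.Vec.Functional using (removeAt)
open import Function.Base using (_∘_; id)
open import Function.Bundles using (Inverse)
open import Level using (0ℓ)
open import Relation.Binary.Bundles using (Setoid)
open import Relation.Binary.Core using (Rel)
open import Relation.Binary.Definitions using (tri<; tri≈; tri>)
open import Relation.Binary.PropositionalEquality as ≡ using (_≡_)
import Relation.Binary.Reasoning.Setoid as SetoidReasoning
open import Relation.Nullary using (Dec; yes; no; ¬_; contradiction)
open import Relation.Nullary.Decidable using (map′; _×-dec_)

-- The number of primes of one given degree is usually bounded through unique factorisation and
-- Gauss's formula. The average bound on d π d / q^d needs only Euclid's lemma, and it is enough
-- because it is only ever summed against decreasing weights. Simple telescoping bounds Σ_{n>m} 1/n²
-- by 1/m and so uses up all of the available 1/m. The trapezoidal value is smaller by 1/(2m(m+1)),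
-- which is at least ½/(m+1)². One half of this pays for repeated primes, whence q ≥ 16 j²; the
-- other half remains. Strict inequality of reals asks for one positive margin valid for all late
-- partial sums, and the remaining half supplies it at the single degree m = j, where x^j is
-- counted. Partial sums that increase and stay bounded need not be Cauchy constructively, so each
-- series needs an explicit modulus. For n ≥ c the weight n/(n+c)² is at least a quarter of 1/n,
-- while the sum with these weights is controlled by Σₘ a j m / (qᵐ (m+c)), which becomes small as c
-- grows.

module Counting where

  open import Data.Nat.Base using (_≤_; _+_; _*_)
  open import Relation.Binary.PropositionalEquality using (refl; sym; trans; cong; cong₂)

  -- Finite sums and indicators over lists.

  ∑ : ∀ {a} {A : Set a} → List A → (A → ℕ) → ℕ
  ∑ []       f = 0
  ∑ (x ∷ xs) f = f x + ∑ xs f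

  𝟙 : ∀ {p} {P : Set p} → Dec P → ℕ
  𝟙 (yes _) = 1
  𝟙 (no  _) = 0

  𝟙≤1 : ∀ {p} {P : Set p} (P? : Dec P) → 𝟙 P? ≤ 1
  𝟙≤1 (yes _) = ℕₚ.≤-refl
  𝟙≤1 (no  _) = z≤n

  𝟙-yes : ∀ {p} {P : Set p} (P? : Dec P) → P → 1 ≤ 𝟙 P?
  𝟙-yes (yes _) _ = ℕₚ.≤-refl
  𝟙-yes (no ¬p) p = contradiction p ¬p

  𝟙-no : ∀ {p} {P : Set p} (P? : Dec P) → ¬ P → 𝟙 P? ≡ 0
  𝟙-no (yes p) ¬p = contradiction p ¬p
  𝟙-no (no  _) _  = refl

  𝟙-mono : ∀ {p r} {P : Set p} {R : Set r} (P? : Dec P) (R? : Dec R) → (P → R) → 𝟙 P? ≤ 𝟙 R?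
  𝟙-mono (yes p) R? f = 𝟙-yes R? (f p)
  𝟙-mono (no _)  R? f = z≤n

  module _ {a} {A : Set a} where

    ∑-mono-All : ∀ {xs : List A} {f g : A → ℕ} → All (λ x → f x ≤ g x) xs → ∑ xs f ≤ ∑ xs g
    ∑-mono-All []       = z≤n
    ∑-mono-All (p ∷ ps) = ℕₚ.+-mono-≤ p (∑-mono-All ps)

    ∑-mono : ∀ (xs : List A) {f g : A → ℕ} → (∀ x → f x ≤ g x) → ∑ xs f ≤ ∑ xs g
    ∑-mono xs f≤g = ∑-mono-All (All.universal f≤g xs)

    ∑-const : ∀ (xs : List A) c → ∑ xs (λ _ → c) ≡ length xs * c
    ∑-const []       c = refl
    ∑-const (x ∷ xs) c = cong (c +_) (∑-const xs c)

    ∑-cong : ∀ (xs : List A) {f g : A → ℕ} → (∀ x → f x ≡ g x) → ∑ xs f ≡ ∑ xs g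
    ∑-cong []       e = refl
    ∑-cong (x ∷ xs) e = cong₂ _+_ (e x) (∑-cong xs e)

    ∑-+ : ∀ (xs : List A) f g → ∑ xs (λ x → f x + g x) ≡ ∑ xs f + ∑ xs g
    ∑-+ []       f g = refl
    ∑-+ (x ∷ xs) f g = trans (cong (f x + g x +_) (∑-+ xs f g))
      (CSemigroup.interchange ℕₚ.+-commutativeSemigroup (f x) (g x) (∑ xs f) (∑ xs g))

    ∑-* : ∀ (xs : List A) c f → ∑ xs (λ x → c * f x) ≡ c * ∑ xs f
    ∑-* []       c f = sym (ℕₚ.*-zeroʳ c)
    ∑-* (x ∷ xs) c f = trans (cong (c * f x +_) (∑-* xs c f)) (sym (ℕₚ.*-distribˡ-+ c (f x) (∑ xs f)))

    ∑-++ : ∀ (xs ys : List A) f → ∑ (xs ++ ys) f ≡ ∑ xs f + ∑ ys f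
    ∑-++ []       ys f = refl
    ∑-++ (x ∷ xs) ys f = trans (cong (f x +_) (∑-++ xs ys f)) (sym (ℕₚ.+-assoc (f x) _ _))

    ∑-Any : ∀ {xs : List A} {f c} → Any (λ x → c ≤ f x) xs → c ≤ ∑ xs f
    ∑-Any {x ∷ xs} {f} (here c≤)  = ℕₚ.≤-trans c≤ (ℕₚ.m≤m+n (f x) _)
    ∑-Any {x ∷ xs} {f} (there p) = ℕₚ.≤-trans (∑-Any p) (ℕₚ.m≤n+m _ (f x))

    -- This is how injectivity enters every double count. The relation is already an inequality, as
    -- in a duplicate-free list, so the same lemma serves polynomials up to `_≋_` and indices up to
    -- `_≡_`.
    ∑-𝟙≤1 : ∀ {ℓ p} {_≉_ : Rel A ℓ} {P : A → Set p} {xs} (P? : ∀ x → Dec (P x)) →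
      (∀ {x y} → P x → P y → ¬ x ≉ y) → AllPairs _≉_ xs → ∑ xs (λ x → 𝟙 (P? x)) ≤ 1
    ∑-𝟙≤1 P? inj [] = z≤n
    ∑-𝟙≤1 {xs = x ∷ xs} P? inj (x≉xs ∷ u) with P? x
    ... | no  _  = ∑-𝟙≤1 P? inj u
    ... | yes px = s≤s (ℕₚ.≤-trans
      (∑-mono-All (All.map (λ {y} x≉y → ℕₚ.≤-reflexive (𝟙-no (P? y) (λ py → inj px py x≉y))) x≉xs))
      (ℕₚ.≤-reflexive (trans (∑-const xs 0) (ℕₚ.*-zeroʳ (length xs)))))

  ∑-swap : ∀ {a b} {A : Set a} {B : Set b} (xs : List A) (ys : List B) (f : A → B → ℕ) →
    ∑ xs (λ x → ∑ ys (f x)) ≡ ∑ ys (λ y → ∑ xs (λ x → f x y))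
  ∑-swap []       ys f = sym (trans (∑-const ys 0) (ℕₚ.*-zeroʳ (length ys)))
  ∑-swap (x ∷ xs) ys f = trans (cong (∑ ys (f x) +_) (∑-swap xs ys f))
    (sym (∑-+ ys (f x) (λ y → ∑ xs (λ x′ → f x′ y))))

  ∑-map : ∀ {a b} {A : Set a} {B : Set b} (h : A → B) xs f → ∑ (List.map h xs) f ≡ ∑ xs (λ x → f (h x))
  ∑-map h []       f = refl
  ∑-map h (x ∷ xs) f = cong (f (h x) +_) (∑-map h xs f)

  ∑[1‥_] : ℕ → (ℕ → ℕ) → ℕ
  ∑[1‥ zero ]  f = 0
  ∑[1‥ suc n ] f = f (suc n) + ∑[1‥ n ] f

  ∑[1‥]-mono : ∀ n {f g} → (∀ d → 1 ≤ d → d ≤ n → f d ≤ g d) → ∑[1‥ n ] f ≤ ∑[1‥ n ] g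
  ∑[1‥]-mono zero    f≤g = z≤n
  ∑[1‥]-mono (suc n) f≤g = ℕₚ.+-mono-≤ (f≤g (suc n) (s≤s z≤n) ℕₚ.≤-refl)
    (∑[1‥]-mono n (λ d 1≤d d≤n → f≤g d 1≤d (ℕₚ.m≤n⇒m≤1+n d≤n)))

-- The commutative ring of polynomials.

module PolynomialRing (R : CommutativeRing 0ℓ 0ℓ) where
  open CommutativeRing R
  open Polynomial R
  open RingProperties ring using (-0#≈0#)

  -- Unlike _≈ₚ_, which unfolds to a function type, this lets Agda infer both sides.
  infix 4 _≋_
  record _≋_ (p r : Poly) : Set where
    constructor ⟪_⟫
    field at : p ≈ₚ r
  open _≋_ public

  ≋-refl : ∀ {p} → p ≋ p
  ≋-refl = ⟪ (λ _ → refl) ⟫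

  ≋-sym : ∀ {p r} → p ≋ r → r ≋ p
  ≋-sym e = ⟪ (λ i → sym (at e i)) ⟫

  ≋-trans : ∀ {p r s} → p ≋ r → r ≋ s → p ≋ s
  ≋-trans e f = ⟪ (λ i → trans (at e i) (at f i)) ⟫

  ≋-setoid : Setoid 0ℓ 0ℓ
  ≋-setoid = record
    { Carrier = Poly ; _≈_ = _≋_
    ; isEquivalence = record { refl = ≋-refl ; sym = ≋-sym ; trans = ≋-trans } }

  ∷-cong : ∀ {a b p r} → a ≈ b → p ≋ r → a ∷ p ≋ b ∷ r
  ∷-cong a≈b p≋r = ⟪ (λ { zero → a≈b ; (suc i) → at p≋r i }) ⟫

  ∷-injectiveˡ : ∀ {a b p r} → a ∷ p ≋ b ∷ r → a ≈ b
  ∷-injectiveˡ e = at e 0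

  ∷-injectiveʳ : ∀ {a b p r} → a ∷ p ≋ b ∷ r → p ≋ r
  ∷-injectiveʳ e = ⟪ (λ i → at e (suc i)) ⟫

  0∷[]≋[] : ∀ {a p} → a ≈ 0# → p ≋ [] → a ∷ p ≋ []
  0∷[]≋[] a≈0 p≋[] = ⟪ (λ { zero → a≈0 ; (suc i) → at p≋[] i }) ⟫

  ∷≋[]ˡ : ∀ {a p} → a ∷ p ≋ [] → a ≈ 0#
  ∷≋[]ˡ e = at e 0

  ∷≋[]ʳ : ∀ {a p} → a ∷ p ≋ [] → p ≋ []
  ∷≋[]ʳ e = ⟪ (λ i → at e (suc i)) ⟫

  scale : Carrier → Poly → Poly
  scale a = List.map (a *_)

  negate : Poly → Poly
  negate = List.map (λ a → - a)

  coeff-+ : ∀ p r i → coeff (p +ₚ r) i ≈ coeff p i + coeff r i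
  coeff-+ []      r       i       = sym (+-identityˡ _)
  coeff-+ (a ∷ p) []      i       = sym (+-identityʳ _)
  coeff-+ (a ∷ p) (b ∷ r) zero    = refl
  coeff-+ (a ∷ p) (b ∷ r) (suc i) = coeff-+ p r i

  coeff-scale : ∀ a p i → coeff (scale a p) i ≈ a * coeff p i
  coeff-scale a []      i       = sym (zeroʳ a)
  coeff-scale a (b ∷ p) zero    = refl
  coeff-scale a (b ∷ p) (suc i) = coeff-scale a p i

  coeff-negate : ∀ p i → coeff (negate p) i ≈ - coeff p i
  coeff-negate []      i       = sym -0#≈0#
  coeff-negate (b ∷ p) zero    = refl
  coeff-negate (b ∷ p) (suc i) = coeff-negate p i

  +ₚ-cong : ∀ {p p′ r r′} → p ≋ p′ → r ≋ r′ → p +ₚ r ≋ p′ +ₚ r′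
  +ₚ-cong {p} {p′} {r} {r′} e f = ⟪ (λ i → trans (coeff-+ p r i)
    (trans (+-cong (at e i) (at f i)) (sym (coeff-+ p′ r′ i)))) ⟫

  +ₚ-assoc : ∀ p r s → (p +ₚ r) +ₚ s ≋ p +ₚ (r +ₚ s)
  +ₚ-assoc p r s = ⟪ (λ i → begin
    coeff ((p +ₚ r) +ₚ s) i               ≈⟨ coeff-+ (p +ₚ r) s i ⟩
    coeff (p +ₚ r) i + coeff s i          ≈⟨ +-congʳ (coeff-+ p r i) ⟩
    coeff p i + coeff r i + coeff s i     ≈⟨ +-assoc _ _ _ ⟩
    coeff p i + (coeff r i + coeff s i)   ≈⟨ +-congˡ (coeff-+ r s i) ⟨
    coeff p i + coeff (r +ₚ s) i          ≈⟨ coeff-+ p (r +ₚ s) i ⟨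
    coeff (p +ₚ (r +ₚ s)) i               ∎) ⟫
    where open SetoidReasoning setoid

  +ₚ-comm : ∀ p r → p +ₚ r ≋ r +ₚ p
  +ₚ-comm p r = ⟪ (λ i → trans (coeff-+ p r i)
    (trans (+-comm _ _) (sym (coeff-+ r p i)))) ⟫

  +ₚ-identityʳ : ∀ p → p +ₚ [] ≋ p
  +ₚ-identityʳ p = ⟪ (λ i → trans (coeff-+ p [] i) (+-identityʳ _)) ⟫

  +ₚ-inverseʳ : ∀ p → p +ₚ negate p ≋ []
  +ₚ-inverseʳ p = ⟪ (λ i → trans (coeff-+ p (negate p) i)
    (trans (+-congˡ (coeff-negate p i)) (-‿inverseʳ _))) ⟫

  negate-cong : ∀ {p r} → p ≋ r → negate p ≋ negate r
  negate-cong {p} {r} e = ⟪ (λ i → trans (coeff-negate p i)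
    (trans (-‿cong (at e i)) (sym (coeff-negate r i)))) ⟫

  +ₚ-commutativeMonoid : CommutativeMonoid 0ℓ 0ℓ
  +ₚ-commutativeMonoid = record
    { isCommutativeMonoid = record
      { isMonoid = record
        { isSemigroup = record
          { isMagma = record { isEquivalence = Setoid.isEquivalence ≋-setoid ; ∙-cong = +ₚ-cong }
          ; assoc = +ₚ-assoc }
        ; identity = (λ _ → ≋-refl) , +ₚ-identityʳ }
      ; comm = +ₚ-comm } }

  open CSemigroup (CommutativeMonoid.commutativeSemigroup +ₚ-commutativeMonoid)
    using (interchange; x∙yz≈y∙xz)

  scale-cong : ∀ {a b p r} → a ≈ b → p ≋ r → scale a p ≋ scale b r
  scale-cong {a} {b} {p} {r} e f = ⟪ (λ i → trans (coeff-scale a p i)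
    (trans (*-cong e (at f i)) (sym (coeff-scale b r i)))) ⟫

  scale-0 : ∀ {a} p → a ≈ 0# → scale a p ≋ []
  scale-0 {a} p e = ⟪ (λ i → trans (coeff-scale a p i) (trans (*-congʳ e) (zeroˡ _))) ⟫

  scale-1 : ∀ p → scale 1# p ≋ p
  scale-1 p = ⟪ (λ i → trans (coeff-scale 1# p i) (*-identityˡ _)) ⟫

  scale-distribˡ : ∀ a p r → scale a (p +ₚ r) ≋ scale a p +ₚ scale a r
  scale-distribˡ a p r = ⟪ (λ i → begin
    coeff (scale a (p +ₚ r)) i                 ≈⟨ coeff-scale a (p +ₚ r) i ⟩
    a * coeff (p +ₚ r) i                       ≈⟨ *-congˡ (coeff-+ p r i) ⟩
    a * (coeff p i + coeff r i)                ≈⟨ distribˡ _ _ _ ⟩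
    a * coeff p i + a * coeff r i              ≈⟨ +-cong (coeff-scale a p i) (coeff-scale a r i) ⟨
    coeff (scale a p) i + coeff (scale a r) i  ≈⟨ coeff-+ (scale a p) (scale a r) i ⟨
    coeff (scale a p +ₚ scale a r) i           ∎) ⟫
    where open SetoidReasoning setoid

  scale-distribʳ : ∀ a b p → scale (a + b) p ≋ scale a p +ₚ scale b p
  scale-distribʳ a b p = ⟪ (λ i → begin
    coeff (scale (a + b) p) i                  ≈⟨ coeff-scale (a + b) p i ⟩
    (a + b) * coeff p i                        ≈⟨ distribʳ _ _ _ ⟩
    a * coeff p i + b * coeff p i              ≈⟨ +-cong (coeff-scale a p i) (coeff-scale b p i) ⟨
    coeff (scale a p) i + coeff (scale b p) i  ≈⟨ coeff-+ (scale a p) (scale b p) i ⟨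
    coeff (scale a p +ₚ scale b p) i           ∎) ⟫
    where open SetoidReasoning setoid

  scale-scale : ∀ a b p → scale (a * b) p ≋ scale a (scale b p)
  scale-scale a b p = ⟪ (λ i → begin
    coeff (scale (a * b) p) i    ≈⟨ coeff-scale (a * b) p i ⟩
    (a * b) * coeff p i          ≈⟨ *-assoc _ _ _ ⟩
    a * (b * coeff p i)          ≈⟨ *-congˡ (coeff-scale b p i) ⟨
    a * coeff (scale b p) i      ≈⟨ coeff-scale a (scale b p) i ⟨
    coeff (scale a (scale b p)) i ∎) ⟫
    where open SetoidReasoning setoid

  shift-+ : ∀ p r → 0# ∷ (p +ₚ r) ≋ (0# ∷ p) +ₚ (0# ∷ r)
  shift-+ p r = ∷-cong (sym (+-identityˡ 0#)) ≋-refl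

  private module ≋-Reasoning = SetoidReasoning ≋-setoid

  *ₚ-congˡ : ∀ p {r r′} → r ≋ r′ → p *ₚ r ≋ p *ₚ r′
  *ₚ-congˡ []      e = ≋-refl
  *ₚ-congˡ (a ∷ p) e = +ₚ-cong (scale-cong refl e) (∷-cong refl (*ₚ-congˡ p e))

  -- A list of zeros equals `[]` without being `[]`. This settles the case of congruence in the left
  -- factor where the two lists differ in length.
  *ₚ-zeroˡ : ∀ {p} r → p ≋ [] → p *ₚ r ≋ []
  *ₚ-zeroˡ {[]}    r e = ≋-refl
  *ₚ-zeroˡ {a ∷ p} r e = +ₚ-cong {scale a r} {[]} {0# ∷ p *ₚ r} {[]}
    (scale-0 r (∷≋[]ˡ e)) (0∷[]≋[] refl (*ₚ-zeroˡ r (∷≋[]ʳ e)))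

  *ₚ-congʳ : ∀ {p p′} r → p ≋ p′ → p *ₚ r ≋ p′ *ₚ r
  *ₚ-congʳ {[]}    {p′}     r e = ≋-sym (*ₚ-zeroˡ r (≋-sym e))
  *ₚ-congʳ {a ∷ p} {[]}     r e = *ₚ-zeroˡ r e
  *ₚ-congʳ {a ∷ p} {b ∷ p′} r e = +ₚ-cong
    (scale-cong {p = r} (∷-injectiveˡ e) ≋-refl) (∷-cong refl (*ₚ-congʳ r (∷-injectiveʳ e)))

  *ₚ-zeroʳ : ∀ p → p *ₚ [] ≋ []
  *ₚ-zeroʳ []      = ≋-refl
  *ₚ-zeroʳ (a ∷ p) = 0∷[]≋[] refl (*ₚ-zeroʳ p)

  -- The mirror image of the defining clause of `_*ₚ_`, which recurses on the left factor only;
  -- commutativity then follows by induction.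
  *ₚ-∷ : ∀ p b r → p *ₚ (b ∷ r) ≋ scale b p +ₚ (0# ∷ p *ₚ r)
  *ₚ-∷ []      b r = ≋-sym (0∷[]≋[] refl ≋-refl)
  *ₚ-∷ (a ∷ p) b r = ∷-cong (+-congʳ (*-comm a b)) (begin
    scale a r +ₚ p *ₚ (b ∷ r)                   ≈⟨ +ₚ-cong {scale a r} ≋-refl (*ₚ-∷ p b r) ⟩
    scale a r +ₚ (scale b p +ₚ (0# ∷ p *ₚ r))   ≈⟨ x∙yz≈y∙xz (scale a r) (scale b p) (0# ∷ p *ₚ r) ⟩
    scale b p +ₚ (scale a r +ₚ (0# ∷ p *ₚ r))   ∎)
    where open ≋-Reasoning

  *ₚ-comm : ∀ p r → p *ₚ r ≋ r *ₚ p
  *ₚ-comm []      r = ≋-sym (*ₚ-zeroʳ r)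
  *ₚ-comm (a ∷ p) r = ≋-trans
    (+ₚ-cong {scale a r} ≋-refl (∷-cong refl (*ₚ-comm p r))) (≋-sym (*ₚ-∷ r a p))

  *ₚ-distribʳ : ∀ s p r → (p +ₚ r) *ₚ s ≋ p *ₚ s +ₚ r *ₚ s
  *ₚ-distribʳ s []      r       = ≋-refl
  *ₚ-distribʳ s (a ∷ p) []      = ≋-sym (+ₚ-identityʳ _)
  *ₚ-distribʳ s (a ∷ p) (b ∷ r) = begin
    scale (a + b) s +ₚ (0# ∷ (p +ₚ r) *ₚ s)
      ≈⟨ +ₚ-cong (scale-distribʳ a b s)
           (≋-trans (∷-cong refl (*ₚ-distribʳ s p r)) (shift-+ (p *ₚ s) (r *ₚ s))) ⟩
    (scale a s +ₚ scale b s) +ₚ ((0# ∷ p *ₚ s) +ₚ (0# ∷ r *ₚ s))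
      ≈⟨ interchange (scale a s) (scale b s) (0# ∷ p *ₚ s) (0# ∷ r *ₚ s) ⟩
    (scale a s +ₚ (0# ∷ p *ₚ s)) +ₚ (scale b s +ₚ (0# ∷ r *ₚ s)) ∎
    where open ≋-Reasoning

  scale-* : ∀ a p r → scale a p *ₚ r ≋ scale a (p *ₚ r)
  scale-* a []      r = ≋-refl
  scale-* a (b ∷ p) r = begin
    scale (a * b) r +ₚ (0# ∷ scale a p *ₚ r)
      ≈⟨ +ₚ-cong (scale-scale a b r) (∷-cong (sym (zeroʳ a)) (scale-* a p r)) ⟩
    scale a (scale b r) +ₚ scale a (0# ∷ p *ₚ r)
      ≈⟨ scale-distribˡ a (scale b r) (0# ∷ p *ₚ r) ⟨
    scale a (scale b r +ₚ (0# ∷ p *ₚ r)) ∎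
    where open ≋-Reasoning

  shift-* : ∀ p r → (0# ∷ p) *ₚ r ≋ 0# ∷ p *ₚ r
  shift-* p r = +ₚ-cong {scale 0# r} {[]} (scale-0 r refl) ≋-refl

  *ₚ-assoc : ∀ p r s → (p *ₚ r) *ₚ s ≋ p *ₚ (r *ₚ s)
  *ₚ-assoc []      r s = ≋-refl
  *ₚ-assoc (a ∷ p) r s = begin
    (scale a r +ₚ (0# ∷ p *ₚ r)) *ₚ s
      ≈⟨ *ₚ-distribʳ s (scale a r) (0# ∷ p *ₚ r) ⟩
    scale a r *ₚ s +ₚ (0# ∷ p *ₚ r) *ₚ s
      ≈⟨ +ₚ-cong (scale-* a r s)
           (≋-trans (shift-* (p *ₚ r) s) (∷-cong refl (*ₚ-assoc p r s))) ⟩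
    scale a (r *ₚ s) +ₚ (0# ∷ p *ₚ (r *ₚ s)) ∎
    where open ≋-Reasoning

  *ₚ-identityˡ : ∀ p → (1# ∷ []) *ₚ p ≋ p
  *ₚ-identityˡ p = ≋-trans (+ₚ-cong (scale-1 p) (0∷[]≋[] refl ≋-refl)) (+ₚ-identityʳ p)

  polyRing : CommutativeRing 0ℓ 0ℓ
  polyRing = record
    { Carrier = Poly ; _≈_ = _≋_ ; _+_ = _+ₚ_ ; _*_ = _*ₚ_ ; -_ = negate ; 0# = [] ; 1# = 1# ∷ []
    ; isCommutativeRing = record
      { isRing = record
        { +-isAbelianGroup = record
          { isGroup = record
            { isMonoid = CommutativeMonoid.isMonoid +ₚ-commutativeMonoid
            ; inverse = (λ p → ≋-trans (+ₚ-comm (negate p) p) (+ₚ-inverseʳ p)) , +ₚ-inverseʳ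
            ; ⁻¹-cong = negate-cong }
          ; comm = +ₚ-comm }
        ; *-cong = λ {p} {p′} {r} {r′} e f → ≋-trans (*ₚ-congʳ r e) (*ₚ-congˡ p′ f)
        ; *-assoc = *ₚ-assoc
        ; *-identity = *ₚ-identityˡ , λ p → ≋-trans (*ₚ-comm p (1# ∷ [])) (*ₚ-identityˡ p)
        ; distrib = (λ p r s → ≋-trans (*ₚ-comm p (r +ₚ s)) (≋-trans (*ₚ-distribʳ p r s)
                      (+ₚ-cong (*ₚ-comm r p) (*ₚ-comm s p)))) , *ₚ-distribʳ }
      ; *-comm = *ₚ-comm } }

-- Degree, division with remainder and Euclid's lemma.

module PolynomialsOverField {q : ℕ} (F : FiniteField q) where

  open import Data.Nat.Base using (_≤_; _<_)
  open FiniteField F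
  open Polynomial commutativeRing using (Poly; coeff; _+ₚ_; _*ₚ_)
  open PolynomialRing commutativeRing public
  open CommutativeMonoid +ₚ-commutativeMonoid using () renaming (commutativeSemigroup to +ₚ-commutativeSemigroup)
  open CSemigroup +ₚ-commutativeSemigroup using (interchange)

  1ₚ : Poly
  1ₚ = 1# ∷ []

  private
    module 𝓟 = CommutativeRing polyRing
    module ≋-Reasoning = SetoidReasoning ≋-setoid

  open RawSemiringDefinitions (CommutativeSemiring.rawSemiring 𝓟.commutativeSemiring) public using (Irreducible; mkIrred; _∣_; product)
  open MonoidDivisibility 𝓟.*-monoid public using (_,_) renaming
    (∣ʳ-trans to ∣-trans; ∣ʳ-respʳ-≈ to ∣-respʳ; ∣ʳ-respˡ-≈ to ∣-respˡ; x∣ʳyx to x∣yx)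
  open SemigroupDivisibility 𝓟.*-commutativeSemigroup public using (x∣xy)

  infix 4 _≟_ _≋?_ _∣?_

  _≟_ : ∀ x y → Dec (x ≈ y)
  x ≟ y = map′
    (λ e → trans (sym (Inverse.strictlyInverseʳ enumeration x))
      (trans (Inverse.from-cong enumeration e) (Inverse.strictlyInverseʳ enumeration y)))
    (Inverse.to-cong enumeration)
    (Inverse.to enumeration x Finₚ.≟ Inverse.to enumeration y)

  *-nonZero : ∀ {x y} → ¬ x ≈ 0# → ¬ y ≈ 0# → ¬ x * y ≈ 0#
  *-nonZero {x} {y} x≉0 y≉0 xy≈0 with x′ , xx′≈1 ← inverse x x≉0 = y≉0 (begin
    y             ≈⟨ *-identityˡ y ⟨
    1# * y        ≈⟨ *-congʳ (trans (*-comm x′ x) xx′≈1) ⟨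
    (x′ * x) * y  ≈⟨ *-assoc x′ x y ⟩
    x′ * (x * y)  ≈⟨ *-congˡ xy≈0 ⟩
    x′ * 0#       ≈⟨ zeroʳ x′ ⟩
    0#            ∎)
    where open SetoidReasoning setoid

  ≋[]? : ∀ p → Dec (p ≋ [])
  ≋[]? []      = yes ≋-refl
  ≋[]? (a ∷ p) = map′ (λ (e , f) → 0∷[]≋[] e f) (λ e → ∷≋[]ˡ e , ∷≋[]ʳ e) ((a ≟ 0#) ×-dec ≋[]? p)

  _≋?_ : ∀ p r → Dec (p ≋ r)
  []      ≋? r       = map′ ≋-sym ≋-sym (≋[]? r)
  (a ∷ p) ≋? []      = ≋[]? (a ∷ p)
  (a ∷ p) ≋? (b ∷ r) = map′ (λ (e , f) → ∷-cong e f)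
    (λ e → ∷-injectiveˡ e , ∷-injectiveʳ e) ((a ≟ b) ×-dec (p ≋? r))

  Small : Poly → ℕ → Set
  Small p n = ∀ i → n ≤ i → coeff p i ≈ 0#

  -- The coefficient `c` may be zero, so only an upper bound on the degree is asserted. Hence
  -- leading terms multiply without any appeal to the absence of zero divisors, and `¬ c ≈ 0#` is
  -- demanded only where degrees are compared.
  record Lead (p : Poly) (n : ℕ) (c : Carrier) : Set where
    constructor lead
    field
      leading : coeff p n ≈ c
      small   : Small p (suc n)
  open Lead public

  Small-0 : ∀ {p} → Small p 0 → p ≋ []
  Small-0 s = ⟪ (λ i → s i z≤n) ⟫

  Small-resp : ∀ {p r n} → p ≋ r → Small p n → Small r n
  Small-resp e s i n≤i = trans (sym (at e i)) (s i n≤i)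

  Lead-resp : ∀ {p r n c} → p ≋ r → Lead p n c → Lead r n c
  Lead-resp e (lead l s) = lead (trans (sym (at e _)) l) (Small-resp e s)

  Lead-cong : ∀ {p n c d} → c ≈ d → Lead p n c → Lead p n d
  Lead-cong e (lead l s) = lead (trans l e) s

  Lead-∷ : ∀ {a p n c} → Lead p n c → Lead (a ∷ p) (suc n) c
  Lead-∷ (lead l s) = lead l λ { (suc i) (s≤s n<i) → s i n<i }

  Lead-tail : ∀ {a p n c} → Lead (a ∷ p) (suc n) c → Lead p n c
  Lead-tail (lead l s) = lead l λ i n<i → s (suc i) (s≤s n<i)

  Lead-const : ∀ {p c} → Lead p 0 c → p ≋ c ∷ []
  Lead-const {[]} (lead l s)    = ≋-sym (0∷[]≋[] (sym l) ≋-refl)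
  Lead-const {a ∷ p} (lead l s) = ∷-cong l (Small-0 (λ i _ → s (suc i) (s≤s z≤n)))

  Lead-scale : ∀ {a p n c} → Lead p n c → Lead (scale a p) n (a * c)
  Lead-scale {a} {p} (lead l s) = lead (trans (coeff-scale a p _) (*-congˡ l))
    λ i n<i → trans (coeff-scale a p i) (trans (*-congˡ (s i n<i)) (zeroʳ a))

  -- Induction on the coefficients of the left factor: the constant coefficient `a` contributes
  -- `scale a r`, which vanishes above degree `m`, so the high coefficients are those of the shifted
  -- product of the tail with `r`.
  Lead-* : ∀ {p r n m c d} → Lead p n c → Lead r m d → Lead (p *ₚ r) (n ℕ.+ m) (c * d)
  Lead-* {[]} {d = d} (lead l s) _ = lead (sym (trans (*-congʳ (sym l)) (zeroˡ d))) λ _ _ → refl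
  Lead-* {a ∷ p} {r} {zero} {d = d} (lead l s) lr = Lead-resp
    (≋-sym (≋-trans (+ₚ-cong {scale a r} ≋-refl (0∷[]≋[] refl (*ₚ-zeroˡ {p} r
      (Small-0 λ i _ → s (suc i) (s≤s z≤n))))) (+ₚ-identityʳ _)))
    (Lead-cong (*-congʳ l) (Lead-scale lr))
  Lead-* {a ∷ p} {r} {suc n} {m} {c} {d} lp lr@(lead _ s) with Lead-* (Lead-tail lp) lr
  ... | lead l s′ = lead
    (trans (value (n ℕ.+ m) (ℕₚ.m≤n+m m n)) l)
    λ { (suc i) (s≤s n+m<i) → trans (value i (ℕₚ.m+n≤o⇒n≤o n (ℕₚ.<⇒≤ n+m<i))) (s′ i n+m<i) }
    where
    value : ∀ i → m ≤ i → coeff ((a ∷ p) *ₚ r) (suc i) ≈ coeff (p *ₚ r) i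
    value i m≤i = trans (coeff-+ (scale a r) _ (suc i))
      (trans (+-congʳ (trans (coeff-scale a r (suc i)) (trans (*-congˡ (s (suc i) (s≤s m≤i))) (zeroʳ a))))
        (+-identityˡ _))

  Lead-unique : ∀ {p n m c d} → ¬ c ≈ 0# → ¬ d ≈ 0# → Lead p n c → Lead p m d → n ≡ m
  Lead-unique {n = n} {m} c≉0 d≉0 (lead l s) (lead l′ s′) with ℕₚ.<-cmp n m
  ... | tri< n<m _ _ = contradiction (trans (sym l′) (s m n<m)) d≉0
  ... | tri≈ _ e _   = e
  ... | tri> _ _ m<n = contradiction (trans (sym l) (s′ n m<n)) c≉0

  Small-Lead : ∀ {p n m c} → ¬ c ≈ 0# → Lead p m c → Small p n → m < n
  Small-Lead {n = n} {m} c≉0 (lead l _) s with m ℕₚ.<? n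
  ... | yes m<n = m<n
  ... | no  m≮n = contradiction (trans (sym l) (s m (ℕₚ.≮⇒≥ m≮n))) c≉0

  -- With trailing zeros allowed, the length of the list is not the degree. Decidable equality in
  -- the finite field finds the last nonzero coefficient.
  zero-or-Lead : ∀ p → p ≋ [] ⊎ ∃₂ λ n c → ¬ c ≈ 0# × Lead p n c
  zero-or-Lead [] = inj₁ ≋-refl
  zero-or-Lead (a ∷ p) with zero-or-Lead p
  ... | inj₂ (n , c , c≉0 , l) = inj₂ (suc n , c , c≉0 , Lead-∷ l)
  ... | inj₁ p≋[] with a ≟ 0#
  ...   | yes a≈0 = inj₁ (0∷[]≋[] a≈0 p≋[])
  ...   | no  a≉0 = inj₂ (0 , a , a≉0 , lead refl λ { (suc i) _ → at p≋[] i })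

  Monic : Poly → ℕ → Set
  Monic p n = Lead p n 1#

  Monic-unique : ∀ {p n m} → Monic p n → Monic p m → n ≡ m
  Monic-unique = Lead-unique 1≉0 1≉0

  Monic-* : ∀ {p r n m} → Monic p n → Monic r m → Monic (p *ₚ r) (n ℕ.+ m)
  Monic-* lp lr = Lead-cong (*-identityˡ 1#) (Lead-* lp lr)

  Monic-1 : Monic 1ₚ 0
  Monic-1 = lead refl λ { (suc i) _ → refl }

  -- Division is carried out by monic divisors only. Mutual divisibility lets a nonzero polynomial
  -- be exchanged for a monic associate in every divisibility question.
  monicize : ∀ {p n c} → ¬ c ≈ 0# → Lead p n c →
    ∃ λ p′ → Monic p′ n × p ∣ p′ × p′ ∣ p
  monicize {p} {n} {c} c≉0 l with c′ , cc′≈1 ← inverse c c≉0 =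
    scale c′ p , Lead-cong c′c≈1 (Lead-scale l) , ((c′ ∷ []) , []-* c′ p) ,
    ((c ∷ []) , ≋-trans ([]-* c (scale c′ p)) (≋-trans (≋-sym (scale-scale c c′ p))
      (≋-trans (scale-cong {p = p} cc′≈1 ≋-refl) (scale-1 p))))
    where
    c′c≈1 = trans (*-comm c′ c) cc′≈1
    []-* : ∀ a r → (a ∷ []) *ₚ r ≋ scale a r
    []-* a r = ≋-trans (+ₚ-cong {scale a r} ≋-refl (0∷[]≋[] refl ≋-refl)) (+ₚ-identityʳ _)

  -- Horner-style division. If `f ≋ Q *ₚ D +ₚ r`, then `a ∷ f` has quotient `0# ∷ Q` and provisional
  -- remainder `a ∷ r`, which may reach degree `n`; subtracting `c` times `D`, where `c` is its
  -- coefficient there, brings it back below `n`.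
  divMod : ∀ {D n} → Monic D n → ∀ f → ∃₂ λ Q r → f ≋ Q *ₚ D +ₚ r × Small r n
  divMod lD [] = [] , [] , ≋-refl , λ _ _ → refl
  divMod {D} {n} lD (a ∷ f) with Q , r , e , s ← divMod lD f =
    c ∷ Q , scale (- c) D +ₚ (a ∷ r) , ≋-sym (begin
      (scale c D +ₚ (0# ∷ Q *ₚ D)) +ₚ (scale (- c) D +ₚ (a ∷ r))
        ≈⟨ interchange (scale c D) (0# ∷ Q *ₚ D) (scale (- c) D) (a ∷ r) ⟩
      (scale c D +ₚ scale (- c) D) +ₚ ((0# ∷ Q *ₚ D) +ₚ (a ∷ r))
        ≈⟨ +ₚ-cong (≋-trans (≋-sym (scale-distribʳ c (- c) D)) (scale-0 D (-‿inverseʳ c)))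
             (∷-cong (+-identityˡ a) (≋-sym e)) ⟩
      a ∷ f ∎) , remainder-small
    where
    open ≋-Reasoning
    c = coeff (a ∷ r) n

    coeff≈ : ∀ i → coeff (scale (- c) D +ₚ (a ∷ r)) i ≈ - c * coeff D i + coeff (a ∷ r) i
    coeff≈ i = trans (coeff-+ (scale (- c) D) (a ∷ r) i) (+-congʳ (coeff-scale (- c) D i))

    high : ∀ i → n < i → coeff (a ∷ r) i ≈ 0#
    high (suc i) (s≤s n≤i) = s i n≤i

    remainder-small : Small (scale (- c) D +ₚ (a ∷ r)) n
    remainder-small i n≤i with ℕₚ.m≤n⇒m<n∨m≡n n≤i
    ... | inj₁ n<i = trans (coeff≈ i) (trans
      (+-cong (trans (*-congˡ (small lD i n<i)) (zeroʳ (- c))) (high i n<i)) (+-identityʳ 0#))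
    ... | inj₂ ≡.refl = trans (coeff≈ i) (trans
      (+-congʳ (trans (*-congˡ (leading lD)) (*-identityʳ (- c)))) (-‿inverseˡ c))

  ∣[] : ∀ p → p ∣ []
  ∣[] p = [] , ≋-refl

  ∣-cancel-+ : ∀ {p x y} → p ∣ x +ₚ y → p ∣ x → p ∣ y
  ∣-cancel-+ {p} {x} {y} (u , up≋x+y) (v , vp≋x) = u +ₚ negate v , (begin
    (u +ₚ negate v) *ₚ p       ≈⟨ *ₚ-distribʳ p u (negate v) ⟩
    u *ₚ p +ₚ negate v *ₚ p    ≈⟨ +ₚ-cong up≋x+y (≋-sym (-‿distribˡ-* v p)) ⟩
    (x +ₚ y) +ₚ negate (v *ₚ p) ≈⟨ +ₚ-cong (+ₚ-comm x y) (negate-cong vp≋x) ⟩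
    (y +ₚ x) +ₚ negate x       ≈⟨ +ₚ-assoc y x (negate x) ⟩
    y +ₚ (x +ₚ negate x)       ≈⟨ +ₚ-cong {y} ≋-refl (+ₚ-inverseʳ x) ⟩
    y +ₚ []                    ≈⟨ +ₚ-identityʳ y ⟩
    y                          ∎)
    where
    open ≋-Reasoning
    open RingProperties 𝓟.ring using (-‿distribˡ-*)

  multiple-Small : ∀ {D n r} → Monic D n → Small r n → D ∣ r → r ≋ []
  multiple-Small {D} {n} {r} lD s (u , uD≋r) with zero-or-Lead u
  ... | inj₁ u≋[] = ≋-trans (≋-sym uD≋r) (*ₚ-zeroˡ D u≋[])
  ... | inj₂ (k , c , c≉0 , lu) = contradiction
    (Small-Lead c≉0 (Lead-resp uD≋r (Lead-cong (*-identityʳ c) (Lead-* lu lD))) s)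
    (ℕₚ.m+n≮n k n)

  Monic-∣? : ∀ {D n} → Monic D n → ∀ f → Dec (D ∣ f)
  Monic-∣? {D} lD f with Q , r , e , s ← divMod lD f with ≋[]? r
  ... | yes r≋[] = yes (Q , ≋-sym (≋-trans e (≋-trans (+ₚ-cong {Q *ₚ D} ≋-refl r≋[]) (+ₚ-identityʳ _))))
  ... | no  r≉[] = no λ D∣f → r≉[] (multiple-Small lD s
    (∣-cancel-+ {x = Q *ₚ D} (∣-respʳ e D∣f) (Q , ≋-refl)))

  _∣?_ : ∀ D f → Dec (D ∣ f)
  D ∣? f with zero-or-Lead D
  ... | inj₁ D≋[] = map′ (λ f≋[] → ∣-respʳ (≋-sym f≋[]) (∣[] D))
    (λ (u , uD≋f) → ≋-trans (≋-sym uD≋f) (≋-trans (*ₚ-congˡ u D≋[]) (*ₚ-zeroʳ u))) (≋[]? f)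
  ... | inj₂ (n , c , c≉0 , l) with D′ , l′ , D∣D′ , D′∣D ← monicize c≉0 l =
    map′ (∣-trans D∣D′) (∣-trans D′∣D) (Monic-∣? l′ f)

  unit-degree : ∀ {D n c} → ¬ c ≈ 0# → Lead D n c → D ∣ 1ₚ → n ≡ 0
  unit-degree {D} {n} {c} c≉0 l (u , uD≋1) with zero-or-Lead u
  ... | inj₁ u≋[] = contradiction (sym (at (≋-trans (≋-sym (*ₚ-zeroˡ D u≋[])) uD≋1) 0)) 1≉0
  ... | inj₂ (k , d , d≉0 , lu) = ℕₚ.m+n≡0⇒n≡0 k
    (Lead-unique (*-nonZero d≉0 c≉0) 1≉0 (Lead-resp uD≋1 (Lead-* lu l)) Monic-1)

  const-unit : ∀ {D c} → ¬ c ≈ 0# → Lead D 0 c → D ∣ 1ₚ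
  const-unit c≉0 l with D′ , l′ , D∣D′ , _ ← monicize c≉0 l = ∣-respʳ (Lead-const l′) D∣D′

  -- If P ∣ r b with deg r < deg P, write P = Q r + s: then P ∣ s b and deg s < deg r, and
  -- s = 0 is impossible unless r is a unit.
  euclid-descent : ∀ {P n b} → Monic P n → Irreducible P → ∀ {k r c} → Acc _<_ k →
    ¬ c ≈ 0# → Lead r k c → k < n → P ∣ r *ₚ b → P ∣ b
  euclid-descent {P} {n} {b} lP irr {k} {r} (acc rec) c≉0 l k<n P∣rb
    with r′ , l′ , r∣r′ , (w , wr′≋r) ← monicize c≉0 l
    with Q , s , e , s-small ← divMod l′ P
    with zero-or-Lead s
  ... | inj₂ (k′ , c′ , c′≉0 , ls) = euclid-descent lP irr (rec k′<k) c′≉0 ls (ℕₚ.<-trans k′<k k<n)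
    (∣-cancel-+ {x = Q *ₚ r′ *ₚ b}
      (∣-respʳ (≋-trans (*ₚ-congʳ b e) (*ₚ-distribʳ b (Q *ₚ r′) s)) (x∣xy P b))
      (∣-respʳ (≋-sym (*ₚ-assoc Q r′ b)) (∣-trans (P∣r′b r∣r′) (x∣yx (r′ *ₚ b) Q))))
    where
    k′<k = Small-Lead c′≉0 ls s-small
    P∣r′b : r ∣ r′ → P ∣ r′ *ₚ b
    P∣r′b (v , vr≋r′) = ∣-trans P∣rb (v , ≋-trans (≋-sym (*ₚ-assoc v r b)) (*ₚ-congʳ b vr≋r′))
  ... | inj₁ s≋[] with Irreducible.split-∣1 irr {Q} {r′}
                        (≋-trans e (≋-trans (+ₚ-cong {Q *ₚ r′} ≋-refl s≋[]) (+ₚ-identityʳ _)))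
  ...   | inj₂ (u , ur′≋1) with v , vr≋r′ ← r∣r′ = ∣-trans P∣rb (u *ₚ v , (begin
    (u *ₚ v) *ₚ (r *ₚ b)  ≈⟨ *ₚ-assoc (u *ₚ v) r b ⟨
    ((u *ₚ v) *ₚ r) *ₚ b  ≈⟨ *ₚ-congʳ b (*ₚ-assoc u v r) ⟩
    (u *ₚ (v *ₚ r)) *ₚ b  ≈⟨ *ₚ-congʳ b (*ₚ-congˡ u vr≋r′) ⟩
    (u *ₚ r′) *ₚ b        ≈⟨ *ₚ-congʳ b ur′≋1 ⟩
    1ₚ *ₚ b               ≈⟨ *ₚ-identityˡ b ⟩
    b                     ∎))
    where open ≋-Reasoning
  -- If `Q` is a unit, then `P` divides the monic `r′`, whose degree `k` is below that of `P`.
  ...   | inj₁ (u , uQ≋1) = contradiction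
    (multiple-Small lP (λ i n≤i → small l′ i (ℕₚ.<-≤-trans k<n n≤i)) (u , (begin
      u *ₚ P           ≈⟨ *ₚ-congˡ u (≋-trans e (≋-trans (+ₚ-cong {Q *ₚ r′} ≋-refl s≋[]) (+ₚ-identityʳ _))) ⟩
      u *ₚ (Q *ₚ r′)   ≈⟨ *ₚ-assoc u Q r′ ⟨
      (u *ₚ Q) *ₚ r′   ≈⟨ *ₚ-congʳ r′ uQ≋1 ⟩
      1ₚ *ₚ r′         ≈⟨ *ₚ-identityˡ r′ ⟩
      r′               ∎)))
    (λ r′≋[] → 1≉0 (trans (sym (leading l′)) (at r′≋[] k)))
    where open ≋-Reasoning

  -- The descent needs a factor of degree below that of `P`, so `x` is first replaced by its
  -- remainder modulo `P`.
  euclid : ∀ {P n x b} → Monic P n → Irreducible P → P ∣ x *ₚ b → P ∣ x ⊎ P ∣ b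
  euclid {P} {n} {x} {b} lP irr P∣xb with Q , r , e , s ← divMod lP x with zero-or-Lead r
  ... | inj₁ r≋[] = inj₁ (Q , ≋-sym (≋-trans e (≋-trans (+ₚ-cong {Q *ₚ P} ≋-refl r≋[]) (+ₚ-identityʳ _))))
  ... | inj₂ (k , c , c≉0 , l) = inj₂ (euclid-descent lP irr (<-wellFounded k) c≉0 l
    (Small-Lead c≉0 l s) (∣-cancel-+ {x = Q *ₚ P *ₚ b}
      (∣-respʳ (≋-trans (*ₚ-congʳ b e) (*ₚ-distribʳ b (Q *ₚ P) r)) P∣xb)
      (Q *ₚ b , (begin
        (Q *ₚ b) *ₚ P  ≈⟨ *ₚ-assoc Q b P ⟩
        Q *ₚ (b *ₚ P)  ≈⟨ *ₚ-congˡ Q (*ₚ-comm b P) ⟩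
        Q *ₚ (P *ₚ b)  ≈⟨ *ₚ-assoc Q P b ⟨
        (Q *ₚ P) *ₚ b  ∎))))
    where open ≋-Reasoning

-- Enumeration of monic and of irreducible polynomials.

length-cartesianProductWith : ∀ {a b c} {A : Set a} {B : Set b} {C : Set c} (f : A → B → C) xs ys →
  length (cartesianProductWith f xs ys) ≡ length xs ℕ.* length ys
length-cartesianProductWith f []       ys = ≡.refl
length-cartesianProductWith f (x ∷ xs) ys = ≡.trans (Listₚ.length-++ (List.map (f x) ys))
  (≡.cong₂ ℕ._+_ (Listₚ.length-map (f x) ys) (length-cartesianProductWith f xs ys))

module IrreducibleFactors {q : ℕ} (F : FiniteField q) where

  open import Data.Nat.Base using (_≤_; _<_; _^_)
  open FiniteField F
  open Polynomial commutativeRing using (Poly; coeff; _+ₚ_; _*ₚ_)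
  open PolynomialsOverField F
  open Counting
  open SetoidMembership ≋-setoid using (_∈_)
  open UniqueSetoid ≋-setoid using (Unique)

  private
    module 𝓟 = CommutativeRing polyRing

  elements : List Carrier
  elements = List.tabulate (Inverse.from enumeration)

  elements-complete : ∀ x → Any (x ≈_) elements
  elements-complete x = Anyₚ.tabulate⁺ (Inverse.to enumeration x)
    (sym (Inverse.strictlyInverseʳ enumeration x))

  elements-unique : UniqueSetoid.Unique setoid elements
  elements-unique = UniqueSetoidₚ.tabulate⁺ setoid λ {i} {j} e →
    ≡.trans (≡.sym (Inverse.strictlyInverseˡ enumeration i))
      (≡.trans (Inverse.to-cong enumeration e) (Inverse.strictlyInverseˡ enumeration j))

  -- Coefficient lists of exact length `n + 1`: no trailing zeros occur, so every monic polynomial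
  -- is listed once up to `_≋_`.
  monics : ℕ → List Poly
  monics zero    = 1ₚ ∷ []
  monics (suc n) = cartesianProductWith _∷_ elements (monics n)

  length-monics : ∀ n → length (monics n) ≡ q ^ n
  length-monics zero    = ≡.refl
  length-monics (suc n) = ≡.trans (length-cartesianProductWith _∷_ elements (monics n))
    (≡.cong₂ ℕ._*_ (Listₚ.length-tabulate (Inverse.from enumeration)) (length-monics n))

  monics-complete : ∀ {p} n → Monic p n → p ∈ monics n
  monics-complete zero l = here (Lead-const l)
  monics-complete {[]}    (suc n) (lead l _) = contradiction (sym l) 1≉0
  monics-complete {a ∷ p} (suc n) l = Anyₚ.cartesianProductWith⁺ _∷_ ∷-cong
    (elements-complete a) (monics-complete n (Lead-tail l))

  monics-Monic : ∀ n → All (λ p → Monic p n) (monics n)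
  monics-Monic zero    = Monic-1 ∷ []
  monics-Monic (suc n) = Allₚ.cartesianProductWith⁺ (≡.setoid Carrier) (≡.setoid Poly) _∷_ elements (monics n)
    λ {a} {p} _ p∈ → Lead-∷ {a} {p} (All.lookup (monics-Monic n) p∈)

  monics-unique : ∀ n → Unique (monics n)
  monics-unique zero    = [] ∷ []
  monics-unique (suc n) = UniqueSetoidₚ.cartesianProductWith⁺ setoid ≋-setoid ≋-setoid _∷_
    (λ e → ∷-injectiveˡ e , ∷-injectiveʳ e) elements-unique (monics-unique n)

  Irreducible-resp : ∀ {p r} → p ≋ r → Irreducible p → Irreducible r
  Irreducible-resp e (mkIrred p∤1 split) =
    mkIrred (λ r∣1 → p∤1 (∣-respˡ (≋-sym e) r∣1)) (λ r≋xy → split (≋-trans e r≋xy))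

  Monic-≉[] : ∀ {p n} → Monic p n → ¬ p ≋ []
  Monic-≉[] l p≋[] = 1≉0 (trans (sym (leading l)) (at p≋[] _))

  Monic-cofactor : ∀ {D d f n} u → Monic D d → Monic f n → u *ₚ D ≋ f → ∃ λ k → Monic u k × n ≡ k ℕ.+ d
  Monic-cofactor {D} {f = f} u lD lf uD≋f with zero-or-Lead u
  ... | inj₁ u≋[] = contradiction (≋-trans (≋-sym uD≋f) (*ₚ-zeroˡ D u≋[])) (Monic-≉[] lf)
  ... | inj₂ (k , c , c≉0 , lu) = k , Lead-cong c≈1 lu , n≡k+d
    where
    luD = Lead-resp uD≋f (Lead-cong (*-identityʳ c) (Lead-* lu lD))
    n≡k+d = Lead-unique 1≉0 c≉0 lf luD
    c≈1 = trans (sym (leading luD)) (≡.subst (λ i → coeff f i ≈ 1#) n≡k+d (leading lf))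

  -- Multiplying by a monic polynomial keeps the leading coefficient, so a nonzero difference of `x`
  -- and `y` would survive the multiplication by `D`.
  *ₚ-cancelʳ : ∀ {D d x y} → Monic D d → x *ₚ D ≋ y *ₚ D → x ≋ y
  *ₚ-cancelʳ {D} {d} {x} {y} lD e = x∙y⁻¹≈ε⇒x≈y x y (lemma (zero-or-Lead (x +ₚ negate y)))
    where
    open RingProperties 𝓟.ring using (-‿distribˡ-*)
    open GroupProperties 𝓟.+-group using (x∙y⁻¹≈ε⇒x≈y; x≈y⇒x∙y⁻¹≈ε)
    product≋[] : (x +ₚ negate y) *ₚ D ≋ []
    product≋[] = ≋-trans (*ₚ-distribʳ D x (negate y))
      (≋-trans (+ₚ-cong {x *ₚ D} ≋-refl (≋-sym (-‿distribˡ-* y D))) (x≈y⇒x∙y⁻¹≈ε e))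
    lemma : x +ₚ negate y ≋ [] ⊎ _ → x +ₚ negate y ≋ []
    lemma (inj₁ z) = z
    lemma (inj₂ (k , c , c≉0 , l)) = contradiction
      (trans (sym (leading (Lead-cong (*-identityʳ c) (Lead-* l lD)))) (at product≋[] _)) c≉0

  Irreducible-∣ : ∀ {P Q m n} → Monic P m → Monic Q n → Irreducible P → Irreducible Q → P ∣ Q → P ≋ Q
  Irreducible-∣ {P} {Q} lP lQ irrP irrQ (v , vP≋Q)
    with Irreducible.split-∣1 irrQ (≋-sym vP≋Q)
  ... | inj₂ P∣1 = contradiction P∣1 (Irreducible.p∤1 irrP)
  ... | inj₁ v∣1 with k , lv , _ ← Monic-cofactor v lP lQ vP≋Q with ≡.refl ← unit-degree 1≉0 lv v∣1 =
    ≋-trans (≋-sym (≋-trans (*ₚ-congʳ P (Lead-const lv)) (*ₚ-identityˡ P))) vP≋Q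

  -- Irreducibility quantifies over all factorisations. This is a search among finitely many monic
  -- candidates and makes it decidable.
  HasProperDivisor : Poly → ℕ → Set
  HasProperDivisor P n = ∃ λ d → d < n × (1 ≤ d × Any (_∣ P) (monics d))

  hasProperDivisor? : ∀ P n → Dec (HasProperDivisor P n)
  hasProperDivisor? P n = ℕₚ.anyUpTo? (λ d → (1 ℕₚ.≤? d) ×-dec any? (_∣? P) (monics d)) n

  properDivisor⇒reducible : ∀ {P n} → Monic P n → HasProperDivisor P n → ¬ Irreducible P
  properDivisor⇒reducible {P} {n} lP (d , d<n , 1≤d , D∣P) irr
    with (D , D∈ , u , uD≋P) ← find D∣P
    with lD ← All.lookup (monics-Monic d) D∈
    with Irreducible.split-∣1 irr (≋-sym uD≋P)
  ... | inj₂ D∣1 = contradiction (unit-degree 1≉0 lD D∣1) (ℕₚ.n>0⇒n≢0 1≤d)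
  ... | inj₁ u∣1 with k , lu , n≡k+d ← Monic-cofactor u lD lP uD≋P with ≡.refl ← unit-degree 1≉0 lu u∣1 =
    ℕₚ.<-irrefl (≡.sym n≡k+d) d<n

  -- In a factorisation a factor of degree 0 is a unit. If neither factor has degree 0, the monic
  -- associate of the first is a divisor found by the search.
  noProperDivisor⇒irreducible : ∀ {P n} → Monic P n → 1 ≤ n → ¬ HasProperDivisor P n → Irreducible P
  noProperDivisor⇒irreducible {P} {n} lP 1≤n ¬div = mkIrred
    (λ P∣1 → ℕₚ.n>0⇒n≢0 1≤n (unit-degree 1≉0 lP P∣1)) split
    where
    split : ∀ {x y} → P ≋ x *ₚ y → x ∣ 1ₚ ⊎ y ∣ 1ₚ
    split {x} {y} e with zero-or-Lead x | zero-or-Lead y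
    ... | inj₁ x≋[] | _ = contradiction (≋-trans e (*ₚ-zeroˡ y x≋[])) (Monic-≉[] lP)
    ... | inj₂ _ | inj₁ y≋[] = contradiction
      (≋-trans e (≋-trans (*ₚ-congˡ x y≋[]) (*ₚ-zeroʳ x))) (Monic-≉[] lP)
    ... | inj₂ (zero , c , c≉0 , lx) | inj₂ _ = inj₁ (const-unit c≉0 lx)
    ... | inj₂ (suc k , c , c≉0 , lx) | inj₂ (zero , c′ , c′≉0 , ly) = inj₂ (const-unit c′≉0 ly)
    ... | inj₂ (suc k , c , c≉0 , lx) | inj₂ (suc k′ , c′ , c′≉0 , ly)
      with x′ , lx′ , _ , x′∣x ← monicize c≉0 lx = contradiction
        (suc k , k<n , s≤s z≤n , Any.map (λ x′≋D → ∣-respˡ x′≋D x′∣P) (monics-complete (suc k) lx′)) ¬div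
      where
      n≡k+k′ : n ≡ suc k ℕ.+ suc k′
      n≡k+k′ = Lead-unique 1≉0 (*-nonZero c≉0 c′≉0) lP (Lead-resp (≋-sym e) (Lead-* lx ly))
      k<n : suc k < n
      k<n = ℕₚ.<-≤-trans (ℕₚ.m<m+n (suc k) (s≤s z≤n)) (ℕₚ.≤-reflexive (≡.sym n≡k+k′))
      x′∣P : x′ ∣ P
      x′∣P = ∣-trans x′∣x (∣-respʳ (≋-sym e) (x∣xy x y))

  Irreducible-degree : ∀ {P n} → Monic P n → Irreducible P → 1 ≤ n
  Irreducible-degree {n = zero}  l irr = contradiction (const-unit 1≉0 l) (Irreducible.p∤1 irr)
  Irreducible-degree {n = suc _} l irr = s≤s z≤n

  Prime : Poly → ℕ → Set
  Prime P d = Monic P d × Irreducible P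

  irreducible? : ∀ {P n} → Monic P n → Dec (Irreducible P)
  irreducible? {n = zero} l = no λ irr → ℕₚ.n≮0 (Irreducible-degree l irr)
  irreducible? {P} {suc n} l with hasProperDivisor? P (suc n)
  ... | yes div = no (properDivisor⇒reducible l div)
  ... | no ¬div = yes (noProperDivisor⇒irreducible l (s≤s z≤n) ¬div)

  monic? : ∀ p n → Dec (Monic p n)
  monic? p n with zero-or-Lead p
  ... | inj₁ p≋[] = no λ l → Monic-≉[] l p≋[]
  ... | inj₂ (m , c , c≉0 , l) = map′
    (λ (n≡m , c≈1) → ≡.subst (Monic p) (≡.sym n≡m) (Lead-cong c≈1 l))
    (λ l′ → Lead-unique 1≉0 c≉0 l′ l ,
      trans (sym (leading l)) (≡.subst (λ i → coeff p i ≈ 1#) (Lead-unique 1≉0 c≉0 l′ l) (leading l′)))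
    ((n ℕₚ.≟ m) ×-dec (c ≟ 1#))

  prime? : ∀ P d → Dec (Prime P d)
  prime? P d with monic? P d
  ... | no ¬l = no λ (l , _) → ¬l l
  ... | yes l = map′ (l ,_) proj₂ (irreducible? l)

  Prime-resp : ∀ {P Q d} → P ≋ Q → Prime P d → Prime Q d
  Prime-resp e (l , irr) = Lead-resp e l , Irreducible-resp e irr

  primes : ℕ → List Poly
  primes d = filter (λ P → prime? P d) (monics d)

  primes-Prime : ∀ d → All (λ P → Prime P d) (primes d)
  primes-Prime d = Allₚ.all-filter (λ P → prime? P d) (monics d)

  primes-complete : ∀ {P d} → Prime P d → P ∈ primes d
  primes-complete {d = d} pr@(l , _) =
    Membershipₚ.∈-filter⁺ ≋-setoid (λ P → prime? P d) Prime-resp (monics-complete d l) pr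

  primes-unique : ∀ d → Unique (primes d)
  primes-unique d = UniqueSetoidₚ.filter⁺ ≋-setoid (λ P → prime? P d) (monics-unique d)

  -- The degree travels with each prime, since all the sums over this list are weighted by it.
  primesUpTo : ℕ → List (ℕ × Poly)
  primesUpTo zero    = []
  primesUpTo (suc n) = List.map (suc n ,_) (primes (suc n)) ++ primesUpTo n

  ∑-primesUpTo : ∀ n f → ∑ (primesUpTo n) f ≡ ∑[1‥ n ] (λ d → ∑ (primes d) (λ P → f (d , P)))
  ∑-primesUpTo zero    f = ≡.refl
  ∑-primesUpTo (suc n) f = ≡.trans (∑-++ (List.map (suc n ,_) (primes (suc n))) (primesUpTo n) f)
    (≡.cong₂ ℕ._+_ (∑-map (suc n ,_) (primes (suc n)) f) (∑-primesUpTo n f))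

  primesUpTo-Prime : ∀ n → All (λ (d , P) → d ≤ n × Prime P d) (primesUpTo n)
  primesUpTo-Prime zero    = []
  primesUpTo-Prime (suc n) = Allₚ.++⁺
    (Allₚ.map⁺ (All.map (λ pr → ℕₚ.≤-refl , pr) (primes-Prime (suc n))))
    (All.map (λ (d≤n , pr) → ℕₚ.m≤n⇒m≤1+n d≤n , pr) (primesUpTo-Prime n))

  primesUpTo-complete : ∀ {P d} n → Prime P d → d ≤ n → Any (λ (e , Q) → d ≡ e × P ≋ Q) (primesUpTo n)
  primesUpTo-complete zero (l , irr) d≤0 = contradiction (ℕₚ.≤-trans (Irreducible-degree l irr) d≤0) (ℕₚ.n≮0)
  primesUpTo-complete {P} {d} (suc n) pr d≤1+n with ℕₚ.m≤n⇒m<n∨m≡n d≤1+n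
  ... | inj₁ (s≤s d≤n) = Anyₚ.++⁺ʳ (List.map (suc n ,_) (primes (suc n))) (primesUpTo-complete n pr d≤n)
  ... | inj₂ ≡.refl    = Anyₚ.++⁺ˡ (Anyₚ.map⁺ (Any.map (≡.refl ,_) (primes-complete pr)))

  Distinct : List (ℕ × Poly) → Set
  Distinct = AllPairs (λ x y → ¬ proj₂ x ≋ proj₂ y)

  primesUpTo-distinct : ∀ n → Distinct (primesUpTo n)
  primesUpTo-distinct zero    = []
  primesUpTo-distinct (suc n) = AllPairsₚ.++⁺
    (AllPairsₚ.map⁺ (primes-unique (suc n))) (primesUpTo-distinct n)
    (Allₚ.map⁺ (All.map
      (λ (lP , _) → All.map (λ (d≤n , lQ , _) P≋Q → ℕₚ.<-irrefl (Monic-unique lQ (Lead-resp P≋Q lP)) (s≤s d≤n))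
        (primesUpTo-Prime n))
      (primes-Prime (suc n))))

-- Counting products of primes; the recursion for their number.

module FactorCounting {q : ℕ} (F : FiniteField q) where

  open import Data.Fin.Base using (zero; suc)
  open import Data.Nat.Base using (_≤_; _<_; _∸_; _^_)
  open FiniteField F using (commutativeRing; 1≉0)
  open Polynomial commutativeRing using (Poly; _*ₚ_)
  open PolynomialsOverField F
  open IrreducibleFactors F
  open Counting
  open SetoidMembership ≋-setoid using (_∈_)
  open UniqueSetoid ≋-setoid using (Unique)

  private
    module 𝓟 = CommutativeRing polyRing

  open MonoidSum 𝓟.*-commutativeMonoid using () renaming (sum-remove to product-remove)

  ∑-allFin-suc : ∀ {j} f → ∑ (allFin (suc j)) f ≡ f zero ℕ.+ ∑ (allFin j) (f ∘ suc)
  ∑-allFin-suc {j} f = ≡.cong (f zero ℕ.+_)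
    (≡.trans (≡.cong (λ is → ∑ is f) (≡.sym (Listₚ.map-tabulate id suc))) (∑-map suc (allFin j) f))

  Monic-product : ∀ {j} {g : Fin j → Poly} {d} → (∀ i → Monic (g i) (d i)) → Monic (product g) (∑ (allFin j) d)
  Monic-product {zero}  l = Monic-1
  Monic-product {suc j} {g} {d} l = ≡.subst (Monic (product g)) (≡.sym (∑-allFin-suc d))
    (Monic-* (l zero) (Monic-product (l ∘ suc)))

  factor∣product : ∀ {j} (g : Fin j → Poly) i → g i ∣ product g
  factor∣product {suc j} g i = ∣-respʳ (≋-sym (product-remove {i = i} g)) (x∣xy (g i) (product (removeAt g i)))

  -- Unlike `𝓘`, this speaks of arbitrary coefficient lists and so covers the constant 1 at `j = 0`,
  -- which is the cofactor of a prime in the recursion. Stored degrees let the degree of a product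
  -- be read off as a sum.
  record Factorization (j : ℕ) (p : Poly) : Set where
    constructor factorization
    field
      factor  : Fin j → Poly
      degrees : Fin j → ℕ
      prime   : ∀ i → Prime (factor i) (degrees i)
      equals  : p ≋ product factor

    monic-degree : Monic p (∑ (allFin j) degrees)
    monic-degree = Lead-resp (≋-sym equals) (Monic-product (proj₁ ∘ prime))

  open Factorization

  Factorization-resp : ∀ {j p r} → p ≋ r → Factorization j p → Factorization j r
  Factorization-resp e (factorization g d pr p≋) = factorization g d pr (≋-trans (≋-sym e) p≋)

  factorization-∷ : ∀ {j P d h p} → Prime P d → Factorization j h → p ≋ P *ₚ h → Factorization (suc j) p
  factorization-∷ {P = P} {d} pr (factorization g ds prs e) p≋ = factorization
    (λ { zero → P ; (suc i) → g i }) (λ { zero → d ; (suc i) → ds i })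
    (λ { zero → pr ; (suc i) → prs i }) (≋-trans p≋ (*ₚ-congˡ P e))

  -- Exhaustive search: the first prime and the cofactor both have degree at most that of `p`, and
  -- the cofactor is treated recursively. Decidability is what allows the products to be listed by
  -- `filter` and counted.
  factorization? : ∀ j p → Dec (Factorization j p)
  factorization? zero p = map′ (λ e → factorization (λ ()) (λ ()) (λ ()) e) equals (p ≋? 1ₚ)
  factorization? (suc j) p with zero-or-Lead p
  ... | inj₁ p≋[] = no λ φ → Monic-≉[] (monic-degree φ) p≋[]
  ... | inj₂ (n , c , c≉0 , l) = map′ found search (ℕₚ.anyUpTo? (λ d → ℕₚ.anyUpTo? (λ m →
    any? (λ P → any? (λ h → (p ≋? P *ₚ h) ×-dec factorization? j h) (monics m)) (primes d)) (suc n)) (suc n))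
    where
    Found : Set
    Found = ∃ λ d → d < suc n × ∃ λ m → m < suc n ×
      Any (λ P → Any (λ h → p ≋ P *ₚ h × Factorization j h) (monics m)) (primes d)
    found : Found → Factorization (suc j) p
    found (d , _ , m , _ , any) with P , P∈ , any′ ← find any with h , _ , p≋Ph , φ ← find any′ =
      factorization-∷ (All.lookup (primes-Prime d) P∈) φ p≋Ph
    search : Factorization (suc j) p → Found
    search φ@(factorization g d pr e) =
      d zero , s≤s (ℕₚ.m+n≤o⇒m≤o (d zero) d₀+m≤n) , m , s≤s (ℕₚ.m+n≤o⇒n≤o (d zero) d₀+m≤n) ,
      Any.map (λ g₀≋P → Any.map (λ h≋h′ → ≋-trans e (𝓟.*-cong g₀≋P h≋h′) ,
          Factorization-resp h≋h′ (factorization (g ∘ suc) (d ∘ suc) (pr ∘ suc) ≋-refl))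
        (monics-complete m (Monic-product (proj₁ ∘ pr ∘ suc)))) (primes-complete (pr zero))
      where
      m = ∑ (allFin j) (d ∘ suc)
      d₀+m≤n : d zero ℕ.+ m ≤ n
      d₀+m≤n = ℕₚ.≤-reflexive (≡.trans (≡.sym (∑-allFin-suc d)) (Lead-unique 1≉0 c≉0 (monic-degree φ) l))

  products : ℕ → ℕ → List Poly
  products j n = filter (factorization? j) (monics n)

  products-Factorization : ∀ j n → All (Factorization j) (products j n)
  products-Factorization j n = Allₚ.all-filter (factorization? j) (monics n)

  products-Monic : ∀ j n → All (λ f → Monic f n) (products j n)
  products-Monic j n = Allₚ.filter⁺ (factorization? j) (monics-Monic n)

  products-unique : ∀ j n → Unique (products j n)
  products-unique j n = UniqueSetoidₚ.filter⁺ ≋-setoid (factorization? j) (monics-unique n)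

  products-complete : ∀ {j n f} → Monic f n → Factorization j f → f ∈ products j n
  products-complete {j} {n} l φ = Membershipₚ.∈-filter⁺ ≋-setoid (factorization? j) Factorization-resp
    (monics-complete n l) φ

  prime∣prime : ∀ {P Q m n} → Prime P m → Prime Q n → P ∣ Q → P ≋ Q
  prime∣prime (lP , irrP) (lQ , irrQ) = Irreducible-∣ lP lQ irrP irrQ

  prime∣product : ∀ {P m j} → Prime P m → (g : Fin j → Poly) → P ∣ product g → ∃ λ i → P ∣ g i
  prime∣product {j = zero}  (_ , irr) g P∣1 = contradiction P∣1 (Irreducible.p∤1 irr)
  prime∣product {j = suc j} pr@(l , irr) g P∣g with euclid {x = g zero} l irr P∣g
  ... | inj₁ P∣g₀ = zero , P∣g₀
  ... | inj₂ P∣gₛ with i , P∣gᵢ ← prime∣product pr (g ∘ suc) P∣gₛ = suc i , P∣gᵢ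

  -- Once `P` is divided out of `f`, Euclid's lemma keeps every other listed prime divisor of `f` a
  -- divisor of the cofactor `u`, whose degree is smaller by `d`. This takes the place of unique
  -- factorisation.
  ∑-primeDivisors≤degree : ∀ {L} → All (λ (d , P) → Prime P d) L → Distinct L →
    ∀ {f n} → Monic f n → ∑ L (λ (d , P) → d ℕ.* 𝟙 (P ∣? f)) ≤ n
  ∑-primeDivisors≤degree [] [] l = z≤n
  ∑-primeDivisors≤degree {(d , P) ∷ L} (pr@(lP , irrP) ∷ prs) (P≉L ∷ dist) {f} {n} lf with P ∣? f
  ... | no _ = ℕₚ.+-mono-≤ (ℕₚ.≤-reflexive (ℕₚ.*-zeroʳ d)) (∑-primeDivisors≤degree prs dist lf)
  ... | yes (u , uP≋f) with k , lu , n≡k+d ← Monic-cofactor u lP lf uP≋f = begin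
    d ℕ.* 1 ℕ.+ ∑ L (λ (e , Q) → e ℕ.* 𝟙 (Q ∣? f))
      ≤⟨ ℕₚ.+-mono-≤ (ℕₚ.≤-reflexive (ℕₚ.*-identityʳ d)) (∑-mono-All (All.zipWith
           (λ { {e , Q} (prQ , P≉Q) → ℕₚ.*-monoʳ-≤ e (𝟙-mono (Q ∣? f) (Q ∣? u) (cancel prQ P≉Q)) })
           (prs , P≉L))) ⟩
    d ℕ.+ ∑ L (λ (e , Q) → e ℕ.* 𝟙 (Q ∣? u))
      ≤⟨ ℕₚ.+-monoʳ-≤ d (∑-primeDivisors≤degree prs dist lu) ⟩
    d ℕ.+ k
      ≡⟨ ≡.trans (ℕₚ.+-comm d k) (≡.sym n≡k+d) ⟩
    n ∎
    where
    open ℕₚ.≤-Reasoning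
    cancel : ∀ {Q e} → Prime Q e → ¬ P ≋ Q → Q ∣ f → Q ∣ u
    cancel prQ@(lQ , irrQ) P≉Q Q∣f with euclid {x = u} lQ irrQ (∣-respʳ (≋-sym uP≋f) Q∣f)
    ... | inj₁ Q∣u = Q∣u
    ... | inj₂ Q∣P = contradiction (≋-sym (prime∣prime prQ pr Q∣P)) P≉Q

  -- Sending `g` to `g *ₚ P` is injective by cancellation, so the cofactors give as many distinct
  -- multiples. The injection appears as a double sum of indicators of `g *ₚ P ≋ f`, read by rows
  -- and then by columns.
  multiples : ∀ {P d n} → Monic P d → d ≤ n → q ^ (n ∸ d) ≤ ∑ (monics n) (λ f → 𝟙 (P ∣? f))
  multiples {P} {d} {n} lP d≤n = begin
    q ^ (n ∸ d)
      ≡⟨ ≡.trans (≡.sym (length-monics (n ∸ d)))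
           (≡.trans (≡.sym (ℕₚ.*-identityʳ _)) (≡.sym (∑-const (monics (n ∸ d)) 1))) ⟩
    ∑ (monics (n ∸ d)) (λ _ → 1)
      ≤⟨ ∑-mono-All (All.map hit (monics-Monic (n ∸ d))) ⟩
    ∑ (monics (n ∸ d)) (λ g → ∑ (monics n) (λ f → 𝟙 (g *ₚ P ≋? f)))
      ≡⟨ ∑-swap (monics (n ∸ d)) (monics n) (λ g f → 𝟙 (g *ₚ P ≋? f)) ⟩
    ∑ (monics n) (λ f → ∑ (monics (n ∸ d)) (λ g → 𝟙 (g *ₚ P ≋? f)))
      ≤⟨ ∑-mono (monics n) (λ f → once f (P ∣? f)) ⟩
    ∑ (monics n) (λ f → 𝟙 (P ∣? f)) ∎
    where
    open ℕₚ.≤-Reasoning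
    hit : ∀ {g} → Monic g (n ∸ d) → 1 ≤ ∑ (monics n) (λ f → 𝟙 (g *ₚ P ≋? f))
    hit {g} lg = ∑-Any (Any.map (λ {f} e → 𝟙-yes (g *ₚ P ≋? f) e)
      (monics-complete n (≡.subst (Monic (g *ₚ P)) (ℕₚ.m∸n+n≡m d≤n) (Monic-* lg lP))))
    once : ∀ f → (P∣f? : Dec (P ∣ f)) → ∑ (monics (n ∸ d)) (λ g → 𝟙 (g *ₚ P ≋? f)) ≤ 𝟙 P∣f?
    once f (yes _) = ∑-𝟙≤1 (λ g → g *ₚ P ≋? f)
      (λ e e′ g≉g′ → g≉g′ (*ₚ-cancelʳ lP (≋-trans e (≋-sym e′)))) (monics-unique (n ∸ d))
    once f (no P∤f) = ℕₚ.≤-reflexive (≡.trans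
      (∑-cong (monics (n ∸ d)) (λ g → 𝟙-no (g *ₚ P ≋? f) (λ e → P∤f (g , e))))
      (≡.trans (∑-const (monics (n ∸ d)) 0) (ℕₚ.*-zeroʳ (length (monics (n ∸ d))))))

  π : ℕ → ℕ
  π d = length (primes d)

  -- Pairs of a prime `P` of degree `d` and a monic multiple `f` of degree `n` are counted with
  -- weight `d`: each `P` has at least `q ^ (n ∸ d)` multiples, and each `f` receives weight at most
  -- `n`. After division by `q ^ n` this says that `d π d / q^d` is at most 1 on average.
  ∑-π≤ : ∀ n → ∑[1‥ n ] (λ d → d ℕ.* π d ℕ.* q ^ (n ∸ d)) ≤ n ℕ.* q ^ n
  ∑-π≤ n = begin
    ∑[1‥ n ] (λ d → d ℕ.* π d ℕ.* q ^ (n ∸ d))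
      ≡⟨ ∑[1‥]-cong n (λ d → ≡.trans (rearrange d (π d) _) (≡.sym (∑-const (primes d) _))) ⟩
    ∑[1‥ n ] (λ d → ∑ (primes d) (λ _ → d ℕ.* q ^ (n ∸ d)))
      ≡⟨ ∑-primesUpTo n (λ (d , P) → d ℕ.* q ^ (n ∸ d)) ⟨
    ∑ (primesUpTo n) (λ (d , P) → d ℕ.* q ^ (n ∸ d))
      ≤⟨ ∑-mono-All (All.map (λ { {d , P} (d≤n , lP , _) → ℕₚ.*-monoʳ-≤ d (multiples lP d≤n) })
           (primesUpTo-Prime n)) ⟩
    ∑ (primesUpTo n) (λ (d , P) → d ℕ.* ∑ (monics n) (λ f → 𝟙 (P ∣? f)))
      ≡⟨ ∑-cong (primesUpTo n) (λ (d , P) → ≡.sym (∑-* (monics n) d (λ f → 𝟙 (P ∣? f)))) ⟩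
    ∑ (primesUpTo n) (λ (d , P) → ∑ (monics n) (λ f → d ℕ.* 𝟙 (P ∣? f)))
      ≡⟨ ∑-swap (primesUpTo n) (monics n) (λ (d , P) f → d ℕ.* 𝟙 (P ∣? f)) ⟩
    ∑ (monics n) (λ f → ∑ (primesUpTo n) (λ (d , P) → d ℕ.* 𝟙 (P ∣? f)))
      ≤⟨ ∑-mono-All (All.map (∑-primeDivisors≤degree (All.map proj₂ (primesUpTo-Prime n)) (primesUpTo-distinct n))
           (monics-Monic n)) ⟩
    ∑ (monics n) (λ _ → n)
      ≡⟨ ≡.trans (∑-const (monics n) n) (≡.trans (≡.cong (ℕ._* n) (length-monics n)) (ℕₚ.*-comm (q ^ n) n)) ⟩
    n ℕ.* q ^ n ∎
    where
    open ℕₚ.≤-Reasoning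
    rearrange : ∀ a b c → a ℕ.* b ℕ.* c ≡ b ℕ.* (a ℕ.* c)
    rearrange a b c = ≡.trans (≡.cong (ℕ._* c) (ℕₚ.*-comm a b)) (ℕₚ.*-assoc b a c)
    ∑[1‥]-cong : ∀ n {f g} → (∀ d → f d ≡ g d) → ∑[1‥ n ] f ≡ ∑[1‥ n ] g
    ∑[1‥]-cong zero    e = ≡.refl
    ∑[1‥]-cong (suc n) e = ≡.cong₂ ℕ._+_ (e (suc n)) (∑[1‥]-cong n e)

  -- By Euclid's lemma a prime divisor of `h` is one of its `j` factors, and each factor accounts
  -- for at most one prime of the list.
  ∑-primeDivisors≤ : ∀ {j h} d → Factorization j h → ∑ (primes d) (λ P → 𝟙 (P ∣? h)) ≤ j
  ∑-primeDivisors≤ {j} {h} d (factorization g ds pr e) = begin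
    ∑ (primes d) (λ P → 𝟙 (P ∣? h))
      ≤⟨ ∑-mono-All (All.map (λ {P} prP → hit prP (P ∣? h)) (primes-Prime d)) ⟩
    ∑ (primes d) (λ P → ∑ (allFin j) (λ i → 𝟙 (P ≋? g i)))
      ≡⟨ ∑-swap (primes d) (allFin j) (λ P i → 𝟙 (P ≋? g i)) ⟩
    ∑ (allFin j) (λ i → ∑ (primes d) (λ P → 𝟙 (P ≋? g i)))
      ≤⟨ ∑-mono (allFin j) (λ i → ∑-𝟙≤1 (λ P → P ≋? g i)
           (λ P≋ Q≋ P≉Q → P≉Q (≋-trans P≋ (≋-sym Q≋))) (primes-unique d)) ⟩
    ∑ (allFin j) (λ _ → 1)
      ≡⟨ ∑-const (allFin j) 1 ⟩
    length (allFin j) ℕ.* 1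
      ≡⟨ ≡.trans (ℕₚ.*-identityʳ _) (Listₚ.length-tabulate {n = j} id) ⟩
    j ∎
    where
    open ℕₚ.≤-Reasoning
    hit : ∀ {P} → Prime P d → (P∣h? : Dec (P ∣ h)) → 𝟙 P∣h? ≤ ∑ (allFin j) (λ i → 𝟙 (P ≋? g i))
    hit prP (no _)    = z≤n
    hit {P} prP (yes P∣h) with i , P∣gᵢ ← prime∣product prP g (∣-respʳ e P∣h) =
      ∑-Any (Anyₚ.tabulate⁺ i (𝟙-yes (P ≋? g i) (prime∣prime prP (pr i) P∣gᵢ)))

  -- The left side is the multiplicity of `P` in the given factorisation. The right side no longer
  -- mentions that factorisation, so it can be summed over `f` afterwards.
  multiplicity≤ : ∀ {j n d P f} → Monic f n → Prime P d → (φ : Factorization (suc j) f) →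
    ∑ (allFin (suc j)) (λ i → 𝟙 (factor φ i ≋? P)) ≤
    ∑ (products j (n ∸ d)) (λ h → 𝟙 (P *ₚ h ≋? f) ℕ.* (1 ℕ.+ j ℕ.* 𝟙 (P ∣? h)))
  multiplicity≤ {j} {n} {d} {P} {f} lf prP@(lP , irrP) φ@(factorization g ds pr e)
    with Finₚ.any? (λ i → g i ≋? P)
  ... | no none = ℕₚ.≤-trans (ℕₚ.≤-reflexive (≡.trans
      (∑-cong (allFin (suc j)) (λ i → 𝟙-no (g i ≋? P) (λ gᵢ≋P → none (i , gᵢ≋P))))
      (≡.trans (∑-const (allFin (suc j)) 0) (ℕₚ.*-zeroʳ (length (allFin (suc j))))))) z≤n
  -- One summand suffices: the listed product equal to `h₀`, which is `f` with one copy of `P`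
  -- removed.
  ... | yes (i₀ , g₀≋P) = ∑-Any (Any.map (λ {h} h₀≋h → ℕₚ.≤-trans
      (bound h (P ∣? h) h₀≋h)
      (ℕₚ.m≤n*m _ (𝟙 (P *ₚ h ≋? f)) {{ℕ.>-nonZero (𝟙-yes (P *ₚ h ≋? f)
        (≋-sym (≋-trans f≋Ph₀ (*ₚ-congˡ P h₀≋h))))}}))
      (products-complete lh₀ (factorization (removeAt g i₀) (removeAt ds i₀) (λ i → pr (Fin.punchIn i₀ i)) ≋-refl)))
    where
    h₀ : Poly
    h₀ = product (removeAt g i₀)
    f≋Ph₀ : f ≋ P *ₚ h₀
    f≋Ph₀ = ≋-trans e (≋-trans (product-remove {i = i₀} g) (*ₚ-congʳ h₀ g₀≋P))
    lh₀ : Monic h₀ (n ∸ d)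
    lh₀ with k , l , n≡k+d ← Monic-cofactor h₀ lP lf (≋-trans (*ₚ-comm h₀ P) (≋-sym f≋Ph₀)) =
      ≡.subst (Monic h₀) (≡.sym (≡.trans (≡.cong (_∸ d) n≡k+d) (ℕₚ.m+n∸n≡m k d))) l
    bound : ∀ h (P∣h? : Dec (P ∣ h)) → h₀ ≋ h →
      ∑ (allFin (suc j)) (λ i → 𝟙 (g i ≋? P)) ≤ 1 ℕ.+ j ℕ.* 𝟙 P∣h?
    bound h (yes _) _ = ℕₚ.≤-trans (∑-mono (allFin (suc j)) (λ i → 𝟙≤1 (g i ≋? P)))
      (ℕₚ.≤-reflexive (≡.trans (∑-const (allFin (suc j)) 1)
        (≡.cong (ℕ._* 1) (Listₚ.length-tabulate {n = suc j} id))))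
    bound h (no P∤h) h₀≋h = ℕₚ.≤-trans
      (∑-𝟙≤1 {_≉_ = λ i i′ → ¬ i ≡ i′} (λ i → g i ≋? P)
        (λ {i} {i′} gᵢ≋P gᵢ′≋P i≢i′ → i≢i′ (≡.trans (only gᵢ≋P) (≡.sym (only gᵢ′≋P))))
        (UniqueSetoidₚ.tabulate⁺ (≡.setoid (Fin (suc j))) id))
      (s≤s z≤n)
      where
      -- A second index carrying `P` would survive in `h₀`, and then `P` would divide `h`.
      only : ∀ {i} → g i ≋ P → i ≡ i₀
      only {i} gᵢ≋P with i₀ Finₚ.≟ i
      ... | yes i₀≡i = ≡.sym i₀≡i
      ... | no  i₀≢i = contradiction
        (∣-respˡ (≋-trans (≡.subst (λ i′ → g i′ ≋ g i) (≡.sym (Finₚ.punchIn-punchOut i₀≢i)) ≋-refl) gᵢ≋P)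
          (∣-respʳ h₀≋h (factor∣product (removeAt g i₀) (punchOut i₀≢i)))) P∤h

  a : ℕ → ℕ → ℕ
  a j n = length (products j n)

  -- The degrees of the factors add up to `n`. Each factor is matched with its entry in
  -- `primesUpTo n`, and exchanging the sums turns the matches into multiplicities.
  degree≤ : ∀ {j n f} → Monic f n → Factorization (suc j) f →
    n ≤ ∑ (primesUpTo n) (λ (d , P) → d ℕ.*
      ∑ (products j (n ∸ d)) (λ h → 𝟙 (P *ₚ h ≋? f) ℕ.* (1 ℕ.+ j ℕ.* 𝟙 (P ∣? h))))
  degree≤ {j} {n} {f} lf φ@(factorization g ds pr e) = begin
    n
      ≡⟨ Monic-unique lf (monic-degree φ) ⟩
    ∑ (allFin (suc j)) ds
      ≤⟨ ∑-mono (allFin (suc j)) (λ i → ∑-Any (Any.map (hit i)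
           (primesUpTo-complete n (pr i) (degree-factor i)))) ⟩
    ∑ (allFin (suc j)) (λ i → ∑ (primesUpTo n) (λ (d , P) → d ℕ.* 𝟙 (g i ≋? P)))
      ≡⟨ ∑-swap (allFin (suc j)) (primesUpTo n) (λ i (d , P) → d ℕ.* 𝟙 (g i ≋? P)) ⟩
    ∑ (primesUpTo n) (λ (d , P) → ∑ (allFin (suc j)) (λ i → d ℕ.* 𝟙 (g i ≋? P)))
      ≡⟨ ∑-cong (primesUpTo n) (λ (d , P) → ∑-* (allFin (suc j)) d (λ i → 𝟙 (g i ≋? P))) ⟩
    ∑ (primesUpTo n) (λ (d , P) → d ℕ.* ∑ (allFin (suc j)) (λ i → 𝟙 (g i ≋? P)))
      ≤⟨ ∑-mono-All (All.map (λ { {d , P} (_ , prP) → ℕₚ.*-monoʳ-≤ d (multiplicity≤ lf prP φ) })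
           (primesUpTo-Prime n)) ⟩
    ∑ (primesUpTo n) (λ (d , P) → d ℕ.*
      ∑ (products j (n ∸ d)) (λ h → 𝟙 (P *ₚ h ≋? f) ℕ.* (1 ℕ.+ j ℕ.* 𝟙 (P ∣? h)))) ∎
    where
    open ℕₚ.≤-Reasoning
    hit : ∀ i {x : ℕ × Poly} → ds i ≡ proj₁ x × g i ≋ proj₂ x → ds i ≤ proj₁ x ℕ.* 𝟙 (g i ≋? proj₂ x)
    hit i {d , P} (≡.refl , gᵢ≋P) = ℕₚ.m≤m*n d (𝟙 (g i ≋? P)) {{ℕ.>-nonZero (𝟙-yes (g i ≋? P) gᵢ≋P)}}
    degree-factor : ∀ i → ds i ≤ n
    degree-factor i = ℕₚ.≤-trans (∑-Any {f = ds} (Anyₚ.tabulate⁺ {f = id} i ℕₚ.≤-refl))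
      (ℕₚ.≤-reflexive (Monic-unique (monic-degree φ) lf))

  -- The bound on the degree is summed over all `f`, and the sum over `f` is moved innermost. There
  -- it disappears, because `P` and `h` determine `f`; what is left is counted by the number of
  -- primes and the number of `h`.
  recursion : ∀ j n → n ℕ.* a (suc j) n ≤ ∑[1‥ n ] (λ d → d ℕ.* ((π d ℕ.+ j ℕ.* j) ℕ.* a j (n ∸ d)))
  recursion j n = begin
    n ℕ.* a (suc j) n
      ≡⟨ ≡.trans (ℕₚ.*-comm n _) (≡.sym (∑-const Fs n)) ⟩
    ∑ Fs (λ _ → n)
      ≤⟨ ∑-mono-All (All.zipWith (λ (lf , φ) → degree≤ lf φ) (products-Monic (suc j) n , products-Factorization (suc j) n)) ⟩
    ∑ Fs (λ f → ∑ (primesUpTo n) (λ (d , P) → d ℕ.* ∑ (Hs d) (λ h → 𝟙 (P *ₚ h ≋? f) ℕ.* c P h)))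
      ≡⟨ ∑-swap Fs (primesUpTo n) (λ f (d , P) → d ℕ.* ∑ (Hs d) (λ h → 𝟙 (P *ₚ h ≋? f) ℕ.* c P h)) ⟩
    ∑ (primesUpTo n) (λ (d , P) → ∑ Fs (λ f → d ℕ.* ∑ (Hs d) (λ h → 𝟙 (P *ₚ h ≋? f) ℕ.* c P h)))
      ≤⟨ ∑-mono (primesUpTo n) (λ (d , P) → ℕₚ.≤-trans
           (ℕₚ.≤-reflexive (≡.trans (∑-* Fs d _)
             (≡.cong (d ℕ.*_) (∑-swap Fs (Hs d) (λ f h → 𝟙 (P *ₚ h ≋? f) ℕ.* c P h)))))
           (ℕₚ.*-monoʳ-≤ d (∑-mono (Hs d) (once P)))) ⟩
    ∑ (primesUpTo n) (λ (d , P) → d ℕ.* ∑ (Hs d) (c P))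
      ≡⟨ ∑-primesUpTo n (λ (d , P) → d ℕ.* ∑ (Hs d) (c P)) ⟩
    ∑[1‥ n ] (λ d → ∑ (primes d) (λ P → d ℕ.* ∑ (Hs d) (c P)))
      ≤⟨ ∑[1‥]-mono n (λ d _ _ → ℕₚ.≤-trans (ℕₚ.≤-reflexive (∑-* (primes d) d (λ P → ∑ (Hs d) (c P))))
           (ℕₚ.*-monoʳ-≤ d (inner d))) ⟩
    ∑[1‥ n ] (λ d → d ℕ.* ((π d ℕ.+ j ℕ.* j) ℕ.* a j (n ∸ d))) ∎
    where
    open ℕₚ.≤-Reasoning
    Fs = products (suc j) n
    Hs : ℕ → List Poly
    Hs d = products j (n ∸ d)
    c : Poly → Poly → ℕ
    c P h = 1 ℕ.+ j ℕ.* 𝟙 (P ∣? h)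
    -- The list has no duplicates, so at most one `f` in it equals `P *ₚ h`.
    once : ∀ P h → ∑ Fs (λ f → 𝟙 (P *ₚ h ≋? f) ℕ.* c P h) ≤ c P h
    once P h = begin
      ∑ Fs (λ f → 𝟙 (P *ₚ h ≋? f) ℕ.* c P h)  ≡⟨ ∑-cong Fs (λ f → ℕₚ.*-comm (𝟙 (P *ₚ h ≋? f)) (c P h)) ⟩
      ∑ Fs (λ f → c P h ℕ.* 𝟙 (P *ₚ h ≋? f))  ≡⟨ ∑-* Fs (c P h) (λ f → 𝟙 (P *ₚ h ≋? f)) ⟩
      c P h ℕ.* ∑ Fs (λ f → 𝟙 (P *ₚ h ≋? f))
        ≤⟨ ℕₚ.*-monoʳ-≤ (c P h) (∑-𝟙≤1 (λ f → P *ₚ h ≋? f)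
             (λ e e′ f≉f′ → f≉f′ (≋-trans (≋-sym e) e′)) (products-unique (suc j) n)) ⟩
      c P h ℕ.* 1                             ≡⟨ ℕₚ.*-identityʳ (c P h) ⟩
      c P h                                   ∎
    inner : ∀ d → ∑ (primes d) (λ P → ∑ (Hs d) (c P)) ≤ (π d ℕ.+ j ℕ.* j) ℕ.* a j (n ∸ d)
    inner d = begin
      ∑ (primes d) (λ P → ∑ (Hs d) (c P))
        ≡⟨ ∑-swap (primes d) (Hs d) c ⟩
      ∑ (Hs d) (λ h → ∑ (primes d) (λ P → c P h))
        ≤⟨ ∑-mono-All (All.map (λ {h} φ → begin
             ∑ (primes d) (λ P → 1 ℕ.+ j ℕ.* 𝟙 (P ∣? h))
               ≡⟨ ∑-+ (primes d) (λ _ → 1) (λ P → j ℕ.* 𝟙 (P ∣? h)) ⟩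
             ∑ (primes d) (λ _ → 1) ℕ.+ ∑ (primes d) (λ P → j ℕ.* 𝟙 (P ∣? h))
               ≡⟨ ≡.cong₂ ℕ._+_ (≡.trans (∑-const (primes d) 1) (ℕₚ.*-identityʳ (π d)))
                    (∑-* (primes d) j (λ P → 𝟙 (P ∣? h))) ⟩
             π d ℕ.+ j ℕ.* ∑ (primes d) (λ P → 𝟙 (P ∣? h))
               ≤⟨ ℕₚ.+-monoʳ-≤ (π d) (ℕₚ.*-monoʳ-≤ j (∑-primeDivisors≤ d φ)) ⟩
             π d ℕ.+ j ℕ.* j ∎) (products-Factorization j (n ∸ d))) ⟩
      ∑ (Hs d) (λ _ → π d ℕ.+ j ℕ.* j)
        ≡⟨ ≡.trans (∑-const (Hs d) _) (ℕₚ.*-comm (a j (n ∸ d)) _) ⟩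
      (π d ℕ.+ j ℕ.* j) ℕ.* a j (n ∸ d) ∎

-- Naturals and their reciprocals as rationals.

module RationalArithmetic where

  open import Data.Integer.Base using (+_)
  open import Data.Rational.Base using (_/_; _+_; _*_; _-_; -_; _≤_; _<_)
  open import Relation.Binary.PropositionalEquality using (refl; sym; trans; cong; cong₂; module ≡-Reasoning)
  ⟦_⟧ : ℕ → ℚ
  ⟦ n ⟧ = + n / 1

  -- Junk value: inv 0 = 0.
  inv : ℕ → ℚ
  inv zero    = 0ℚ
  inv (suc n) = + 1 / suc n

  /-toℚᵘ : ∀ i n .{{_ : NonZero n}} → ℚ.toℚᵘ (i / n) ℚᵘ.≃ (i ℚᵘ./ n)
  /-toℚᵘ i n@(suc _) = ℚₚ.toℚᵘ-fromℚᵘ (i ℚᵘ./ n)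

  ⟦⟧-+ : ∀ m n → ⟦ m ℕ.+ n ⟧ ≡ ⟦ m ⟧ + ⟦ n ⟧
  ⟦⟧-+ m n = ℚₚ.toℚᵘ-injective (begin
    ℚ.toℚᵘ ⟦ m ℕ.+ n ⟧                  ≈⟨ /-toℚᵘ (+ (m ℕ.+ n)) 1 ⟩
    (+ (m ℕ.+ n)) ℚᵘ./ 1                ≈⟨ ℚᵘ.*≡* (cong (ℤ._* (+ 1)) (sym
                                             (cong₂ ℤ._+_ (ℤₚ.*-identityʳ (+ m)) (ℤₚ.*-identityʳ (+ n))))) ⟩
    ((+ m) ℚᵘ./ 1) ℚᵘ.+ ((+ n) ℚᵘ./ 1)  ≈⟨ ℚᵘₚ.+-cong (/-toℚᵘ (+ m) 1) (/-toℚᵘ (+ n) 1) ⟨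
    ℚ.toℚᵘ ⟦ m ⟧ ℚᵘ.+ ℚ.toℚᵘ ⟦ n ⟧      ≈⟨ ℚₚ.toℚᵘ-homo-+ ⟦ m ⟧ ⟦ n ⟧ ⟨
    ℚ.toℚᵘ (⟦ m ⟧ + ⟦ n ⟧)              ∎)
    where open ℚᵘₚ.≃-Reasoning

  ⟦⟧-* : ∀ m n → ⟦ m ℕ.* n ⟧ ≡ ⟦ m ⟧ * ⟦ n ⟧
  ⟦⟧-* m n = ℚₚ.toℚᵘ-injective (begin
    ℚ.toℚᵘ ⟦ m ℕ.* n ⟧                  ≈⟨ /-toℚᵘ (+ (m ℕ.* n)) 1 ⟩
    (+ (m ℕ.* n)) ℚᵘ./ 1                ≈⟨ ℚᵘ.*≡* (cong (ℤ._* (+ 1)) (ℤₚ.pos-* m n)) ⟩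
    ((+ m) ℚᵘ./ 1) ℚᵘ.* ((+ n) ℚᵘ./ 1)  ≈⟨ ℚᵘₚ.*-cong (/-toℚᵘ (+ m) 1) (/-toℚᵘ (+ n) 1) ⟨
    ℚ.toℚᵘ ⟦ m ⟧ ℚᵘ.* ℚ.toℚᵘ ⟦ n ⟧      ≈⟨ ℚₚ.toℚᵘ-homo-* ⟦ m ⟧ ⟦ n ⟧ ⟨
    ℚ.toℚᵘ (⟦ m ⟧ * ⟦ n ⟧)              ∎)
    where open ℚᵘₚ.≃-Reasoning

  ⟦⟧-mono : ∀ {m n} → m ℕ.≤ n → ⟦ m ⟧ ≤ ⟦ n ⟧
  ⟦⟧-mono {m} {n} m≤n = ℚₚ.toℚᵘ-cancel-≤ (ℚᵘₚ.≤-respˡ-≃ (ℚᵘₚ.≃-sym (/-toℚᵘ (+ m) 1))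
    (ℚᵘₚ.≤-respʳ-≃ (ℚᵘₚ.≃-sym (/-toℚᵘ (+ n) 1)) (ℚᵘ.*≤* (ℤₚ.*-monoʳ-≤-nonNeg (+ 1) (ℤ.+≤+ m≤n)))))

  0≤⟦⟧ : ∀ n → 0ℚ ≤ ⟦ n ⟧
  0≤⟦⟧ n = ⟦⟧-mono {0} {n} z≤n

  0<inv : ∀ n → 0ℚ < inv (suc n)
  0<inv n = ℚₚ.positive⁻¹ (inv (suc n)) {{ℚₚ.normalize-pos 1 (suc n)}}

  0≤inv : ∀ n → 0ℚ ≤ inv n
  0≤inv zero    = ℚₚ.≤-refl
  0≤inv (suc n) = ℚₚ.<⇒≤ (0<inv n)

  ⟦⟧*inv : ∀ n → ⟦ suc n ⟧ * inv (suc n) ≡ 1ℚ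
  ⟦⟧*inv n = ℚₚ.toℚᵘ-injective (begin
    ℚ.toℚᵘ (⟦ suc n ⟧ * inv (suc n))           ≈⟨ ℚₚ.toℚᵘ-homo-* ⟦ suc n ⟧ (inv (suc n)) ⟩
    ℚ.toℚᵘ ⟦ suc n ⟧ ℚᵘ.* ℚ.toℚᵘ (inv (suc n)) ≈⟨ ℚᵘₚ.*-cong (/-toℚᵘ (+ suc n) 1) (/-toℚᵘ (+ 1) (suc n)) ⟩
    ((+ suc n) ℚᵘ./ 1) ℚᵘ.* ((+ 1) ℚᵘ./ suc n) ≈⟨ ℚᵘ.*≡* (cong +_ (trans (ℕₚ.*-identityʳ _)
                                                     (trans (ℕₚ.*-identityʳ (suc n)) (sym (trans (ℕₚ.*-identityˡ _) (ℕₚ.*-identityˡ (suc n))))))) ⟩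
    ℚᵘ.1ℚᵘ                                     ∎)
    where open ℚᵘₚ.≃-Reasoning

  0≤* : ∀ {p r} → 0ℚ ≤ p → 0ℚ ≤ r → 0ℚ ≤ p * r
  0≤* {p} {r} 0≤p 0≤r = ℚₚ.nonNegative⁻¹ (p * r)
    {{ℚₚ.nonNeg*nonNeg⇒nonNeg p {{ℚ.nonNegative 0≤p}} r {{ℚ.nonNegative 0≤r}}}}

  0<* : ∀ {p r} → 0ℚ < p → 0ℚ < r → 0ℚ < p * r
  0<* {p} {r} 0<p 0<r = ℚₚ.positive⁻¹ (p * r) {{ℚₚ.pos*pos⇒pos p {{ℚ.positive 0<p}} r {{ℚ.positive 0<r}}}}

  0≤+ : ∀ {p r} → 0ℚ ≤ p → 0ℚ ≤ r → 0ℚ ≤ p + r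
  0≤+ = ℚₚ.+-mono-≤

  *-monoˡ : ∀ r {p t} → 0ℚ ≤ r → p ≤ t → r * p ≤ r * t
  *-monoˡ r 0≤r = ℚₚ.*-monoˡ-≤-nonNeg r {{ℚ.nonNegative 0≤r}}

  *-monoʳ : ∀ r {p t} → 0ℚ ≤ r → p ≤ t → p * r ≤ t * r
  *-monoʳ r 0≤r = ℚₚ.*-monoʳ-≤-nonNeg r {{ℚ.nonNegative 0≤r}}

  *-mono : ∀ {p r t v} → 0ℚ ≤ t → 0ℚ ≤ r → p ≤ r → t ≤ v → p * t ≤ r * v
  *-mono {r = r} {t} 0≤t 0≤r p≤r t≤v = ℚₚ.≤-trans (*-monoʳ t 0≤t p≤r) (*-monoˡ r 0≤r t≤v)

  p≤p+r : ∀ {p r} → 0ℚ ≤ r → p ≤ p + r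
  p≤p+r {p} 0≤r = ℚₚ.≤-trans (ℚₚ.≤-reflexive (sym (ℚₚ.+-identityʳ p))) (ℚₚ.+-monoʳ-≤ p 0≤r)

  p≤r+p : ∀ {p r} → 0ℚ ≤ r → p ≤ r + p
  p≤r+p {p} 0≤r = ℚₚ.≤-trans (ℚₚ.≤-reflexive (sym (ℚₚ.+-identityˡ p))) (ℚₚ.+-monoˡ-≤ p 0≤r)

  0≤r-p : ∀ {p r} → p ≤ r → 0ℚ ≤ r - p
  0≤r-p {p} p≤r = ℚₚ.≤-trans (ℚₚ.≤-reflexive (sym (ℚₚ.+-inverseʳ p))) (ℚₚ.+-monoˡ-≤ (- p) p≤r)

  inv-unique : ∀ n {p} → ⟦ suc n ⟧ * p ≡ 1ℚ → p ≡ inv (suc n)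
  inv-unique n {p} e = begin
    p                              ≡⟨ ℚₚ.*-identityˡ p ⟨
    1ℚ * p                         ≡⟨ cong (_* p) (⟦⟧*inv n) ⟨
    (⟦ suc n ⟧ * inv (suc n)) * p  ≡⟨ solve 3 (λ a b c → (a :* b) :* c := b :* (a :* c)) refl ⟦ suc n ⟧ (inv (suc n)) p ⟩
    inv (suc n) * (⟦ suc n ⟧ * p)  ≡⟨ cong (inv (suc n) *_) e ⟩
    inv (suc n) * 1ℚ               ≡⟨ ℚₚ.*-identityʳ _ ⟩
    inv (suc n)                    ∎
    where
    open ≡-Reasoning
    open +-*-Solver using (solve; _:=_; _:+_; _:*_; con)

  inv-* : ∀ m n → inv (m ℕ.* n) ≡ inv m * inv n
  inv-* zero    n       = sym (ℚₚ.*-zeroˡ (inv n))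
  inv-* (suc m) zero    = trans (cong inv (ℕₚ.*-zeroʳ m)) (sym (ℚₚ.*-zeroʳ (inv (suc m))))
  inv-* (suc m) (suc n) = sym (inv-unique (n ℕ.+ m ℕ.* suc n) (begin
    ⟦ suc m ℕ.* suc n ⟧ * (inv (suc m) * inv (suc n))
      ≡⟨ cong (_* (inv (suc m) * inv (suc n))) (⟦⟧-* (suc m) (suc n)) ⟩
    (⟦ suc m ⟧ * ⟦ suc n ⟧) * (inv (suc m) * inv (suc n))
      ≡⟨ solve 4 (λ a b c d → (a :* b) :* (c :* d) := (a :* c) :* (b :* d)) refl
           ⟦ suc m ⟧ ⟦ suc n ⟧ (inv (suc m)) (inv (suc n)) ⟩
    (⟦ suc m ⟧ * inv (suc m)) * (⟦ suc n ⟧ * inv (suc n))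
      ≡⟨ cong₂ _*_ (⟦⟧*inv m) (⟦⟧*inv n) ⟩
    1ℚ ∎))
    where
    open ≡-Reasoning
    open +-*-Solver using (solve; _:=_; _:+_; _:*_; con)

  inv-antitone : ∀ {m n} → 1 ℕ.≤ m → m ℕ.≤ n → inv n ≤ inv m
  inv-antitone {suc m} {suc n} _ m≤n = begin
    inv (suc n)                                ≡⟨ ℚₚ.*-identityʳ _ ⟨
    inv (suc n) * 1ℚ                           ≡⟨ cong (inv (suc n) *_) (⟦⟧*inv m) ⟨
    inv (suc n) * (⟦ suc m ⟧ * inv (suc m))    ≤⟨ *-monoˡ (inv (suc n)) (0≤inv (suc n))
                                                    (*-monoʳ (inv (suc m)) (0≤inv (suc m)) (⟦⟧-mono m≤n)) ⟩
    inv (suc n) * (⟦ suc n ⟧ * inv (suc m))    ≡⟨ solve 3 (λ a b c → a :* (b :* c) := (b :* a) :* c) refl (inv (suc n)) ⟦ suc n ⟧ (inv (suc m)) ⟩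
    (⟦ suc n ⟧ * inv (suc n)) * inv (suc m)    ≡⟨ cong (_* inv (suc m)) (⟦⟧*inv n) ⟩
    1ℚ * inv (suc m)                           ≡⟨ ℚₚ.*-identityˡ _ ⟩
    inv (suc m)                                ∎
    where
    open ℚₚ.≤-Reasoning
    open +-*-Solver using (solve; _:=_; _:+_; _:*_; con)

  inv≤1 : ∀ n → inv n ≤ 1ℚ
  inv≤1 zero    = 0≤⟦⟧ 1
  inv≤1 (suc n) = inv-antitone {1} {suc n} (s≤s z≤n) (s≤s z≤n)

  -- A positive fraction has numerator at least 1, so its own denominator serves.
  inv-archimedean : ∀ ε → 0ℚ < ε → ∃ λ n → inv (suc n) ≤ ε
  inv-archimedean (mkℚ +[1+ a ] d c) _ = d ,
    ℚₚ.toℚᵘ-cancel-≤ (ℚᵘₚ.≤-respˡ-≃ (ℚᵘₚ.≃-sym (/-toℚᵘ (+ 1) (suc d)))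
      (ℚᵘ.*≤* (ℤₚ.*-monoʳ-≤-nonNeg (+ suc d) (ℤ.+≤+ (s≤s {n = a} z≤n)))))
  inv-archimedean (mkℚ (+ 0) d c) (*<* (ℤ.+<+ ()))
  inv-archimedean (mkℚ -[1+ a ] d c) (*<* ())

  -- The partial fraction identity 1/(m+1) - 1/(m+2) = 1/((m+1)(m+2)), written without subtraction.
  -- The comparisons of `φ` with its neighbour and with `inv` rest on it.
  inv-suc : ∀ m → inv (suc m) ≡ inv (suc (suc m)) + inv (suc m) * inv (suc (suc m))
  inv-suc m = begin
    x                              ≡⟨ ℚₚ.*-identityʳ x ⟨
    x * 1ℚ                         ≡⟨ cong (x *_) (⟦⟧*inv (suc m)) ⟨
    x * (⟦ suc (suc m) ⟧ * y)      ≡⟨ cong (λ k → x * (k * y)) (⟦⟧-+ 1 (suc m)) ⟩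
    x * ((1ℚ + ⟦ suc m ⟧) * y)     ≡⟨ solve 3 (λ x y k → x :* ((con 1ℚ :+ k) :* y) := (k :* x) :* y :+ x :* y) refl x y ⟦ suc m ⟧ ⟩
    (⟦ suc m ⟧ * x) * y + x * y    ≡⟨ cong (λ k → k * y + x * y) (⟦⟧*inv m) ⟩
    1ℚ * y + x * y                 ≡⟨ cong (_+ x * y) (ℚₚ.*-identityˡ y) ⟩
    y + x * y                      ∎
    where
    open ≡-Reasoning
    open +-*-Solver using (solve; _:=_; _:+_; _:*_; con)
    x = inv (suc m)
    y = inv (suc (suc m))

-- Finite sums of rationals.

module RationalSums where

  open import Data.Rational.Base using (_+_; _*_; _≤_)
  open import Relation.Binary.PropositionalEquality using (refl; sym; trans; cong; cong₂; module ≡-Reasoning)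
  open RationalArithmetic

  ∑< : ℕ → (ℕ → ℚ) → ℚ
  ∑< zero    f = 0ℚ
  ∑< (suc n) f = f n + ∑< n f

  ∑<-mono : ∀ n {f g} → (∀ i → i ℕ.< n → f i ≤ g i) → ∑< n f ≤ ∑< n g
  ∑<-mono zero    f≤g = ℚₚ.≤-refl
  ∑<-mono (suc n) f≤g = ℚₚ.+-mono-≤ (f≤g n ℕₚ.≤-refl) (∑<-mono n (λ i i<n → f≤g i (ℕₚ.m<n⇒m<1+n i<n)))

  ∑<-cong : ∀ n {f g} → (∀ i → i ℕ.< n → f i ≡ g i) → ∑< n f ≡ ∑< n g
  ∑<-cong zero    f≡g = refl
  ∑<-cong (suc n) f≡g = cong₂ _+_ (f≡g n ℕₚ.≤-refl) (∑<-cong n (λ i i<n → f≡g i (ℕₚ.m<n⇒m<1+n i<n)))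

  0≤∑< : ∀ n {f} → (∀ i → 0ℚ ≤ f i) → 0ℚ ≤ ∑< n f
  0≤∑< zero    0≤f = ℚₚ.≤-refl
  0≤∑< (suc n) 0≤f = 0≤+ (0≤f n) (0≤∑< n 0≤f)

  ∑<-+ : ∀ n f g → ∑< n (λ i → f i + g i) ≡ ∑< n f + ∑< n g
  ∑<-+ zero    f g = refl
  ∑<-+ (suc n) f g = trans (cong (λ s → f n + g n + s) (∑<-+ n f g))
    (solve 4 (λ a b c d → (a :+ b) :+ (c :+ d) := (a :+ c) :+ (b :+ d)) refl (f n) (g n) (∑< n f) (∑< n g))
    where open +-*-Solver using (solve; _:=_; _:+_)

  ∑<-*ˡ : ∀ n c f → ∑< n (λ i → c * f i) ≡ c * ∑< n f
  ∑<-*ˡ zero    c f = sym (ℚₚ.*-zeroʳ c)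
  ∑<-*ˡ (suc n) c f = trans (cong (λ s → c * f n + s) (∑<-*ˡ n c f)) (sym (ℚₚ.*-distribˡ-+ c (f n) (∑< n f)))

  ∑<-suc : ∀ n f → ∑< (suc n) f ≡ f 0 + ∑< n (λ i → f (suc i))
  ∑<-suc zero    f = refl
  ∑<-suc (suc n) f = trans (cong (λ s → f (suc n) + s) (∑<-suc n f))
    (solve 3 (λ a b c → a :+ (b :+ c) := b :+ (a :+ c)) refl (f (suc n)) (f 0) (∑< n (λ i → f (suc i))))
    where open +-*-Solver using (solve; _:=_; _:+_)

  ∑<-extend : ∀ {m n f} → (∀ i → 0ℚ ≤ f i) → m ℕ.≤ n → ∑< m f ≤ ∑< n f
  ∑<-extend 0≤f m≤n = go (ℕₚ.≤⇒≤′ m≤n) 0≤f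
    where
    go : ∀ {m n f} → m ℕ.≤′ n → (∀ i → 0ℚ ≤ f i) → ∑< m f ≤ ∑< n f
    go (ℕ.≤′-reflexive refl) 0≤f = ℚₚ.≤-refl
    go {n = suc n} (ℕ.≤′-step m≤n) 0≤f = ℚₚ.≤-trans (go m≤n 0≤f) (p≤r+p (0≤f n))

  term≤∑< : ∀ {m n f} → (∀ i → 0ℚ ≤ f i) → m ℕ.< n → f m ≤ ∑< n f
  term≤∑< {m} 0≤f m<n = ℚₚ.≤-trans (p≤p+r (0≤∑< m 0≤f)) (∑<-extend 0≤f m<n)

  ∑<-reverse : ∀ n f → ∑< (suc n) f ≡ ∑< (suc n) (λ i → f (n ℕ.∸ i))
  ∑<-reverse zero    f = refl
  ∑<-reverse (suc n) f = trans (∑<-suc (suc n) f) (cong₂ _+_ (cong f (sym (ℕₚ.n∸n≡0 n)))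
    (trans (∑<-reverse n (λ i → f (suc i)))
      (∑<-cong (suc n) (λ i i<1+n → cong f (sym (ℕₚ.+-∸-assoc 1 (ℕₚ.≤-pred i<1+n)))))))

  -- Both sides run over the pairs with `i + m < N`, by antidiagonals and by rows. Raising `N` by
  -- one adds an antidiagonal, which lengthens every row by one term and starts the row `m = N`.
  ∑<-triangle : ∀ N (G : ℕ → ℕ → ℚ) →
    ∑< N (λ n → ∑< (suc n) (λ i → G i (n ℕ.∸ i))) ≡ ∑< N (λ m → ∑< (N ℕ.∸ m) (λ i → G i m))
  ∑<-triangle zero    G = refl
  ∑<-triangle (suc N) G = begin
    ∑< (suc N) (λ i → G i (N ℕ.∸ i)) + ∑< N (λ n → ∑< (suc n) (λ i → G i (n ℕ.∸ i)))
      ≡⟨ cong₂ _+_ diagonal (∑<-triangle N G) ⟩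
    (G 0 N + ∑< N (λ m → G (N ℕ.∸ m) m)) + ∑< N (λ m → ∑< (N ℕ.∸ m) (λ i → G i m))
      ≡⟨ ℚₚ.+-assoc (G 0 N) _ _ ⟩
    G 0 N + (∑< N (λ m → G (N ℕ.∸ m) m) + ∑< N (λ m → ∑< (N ℕ.∸ m) (λ i → G i m)))
      ≡⟨ cong₂ _+_ (sym (ℚₚ.+-identityʳ (G 0 N))) (sym (∑<-+ N _ _)) ⟩
    ∑< 1 (λ i → G i N) + ∑< N (λ m → ∑< (suc (N ℕ.∸ m)) (λ i → G i m))
      ≡⟨ cong₂ _+_ (cong (λ k → ∑< k (λ i → G i N)) (sym (ℕₚ.m+n∸n≡m 1 N)))
           (∑<-cong N (λ m m<N → cong (λ k → ∑< k (λ i → G i m)) (sym (ℕₚ.+-∸-assoc 1 (ℕₚ.<⇒≤ m<N))))) ⟩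
    ∑< (suc N ℕ.∸ N) (λ i → G i N) + ∑< N (λ m → ∑< (suc N ℕ.∸ m) (λ i → G i m)) ∎
    where
    open ≡-Reasoning
    diagonal : ∑< (suc N) (λ i → G i (N ℕ.∸ i)) ≡ G 0 N + ∑< N (λ m → G (N ℕ.∸ m) m)
    diagonal = trans (∑<-reverse N (λ i → G i (N ℕ.∸ i)))
      (trans (∑<-cong (suc N) (λ m m<1+N → cong (G (N ℕ.∸ m)) (ℕₚ.m∸[m∸n]≡n (ℕₚ.≤-pred m<1+N))))
        (cong (λ k → G k N + ∑< N (λ m → G (N ℕ.∸ m) m)) (ℕₚ.n∸n≡0 N)))

-- Abel summation and the tail of Σ 1/n².

module Estimates where

  open import Data.Rational.Base using (_+_; _*_; _-_; _≤_)
  open import Relation.Binary.PropositionalEquality using (refl; sym; trans; cong)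
  open RationalArithmetic
  open RationalSums
  open +-*-Solver using (solve; _:=_; _:+_; _:*_; _:-_; con)

  0≤½ : 0ℚ ≤ ½
  0≤½ = 0≤inv 2

  -- Abel summation: the bound on the partial sums of ρ is only an average one.
  abel : ∀ {ρ w : ℕ → ℚ} → (∀ n → ∑< n ρ ≤ ⟦ n ⟧) → (∀ i → w (suc i) ≤ w i) → (∀ i → 0ℚ ≤ w i) →
    ∀ D → ∑< D (λ i → ρ i * w i) ≤ ∑< D w
  abel {ρ} {w} partial≤ antitone 0≤w D = ℚₚ.≤-trans
    (p≤p+r (0≤* (0≤r-p (partial≤ D)) (0≤w D))) (strong D)
    where
    open ℚₚ.≤-Reasoning
    strong : ∀ D → ∑< D (λ i → ρ i * w i) + (⟦ D ⟧ - ∑< D ρ) * w D ≤ ∑< D w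
    strong zero    = ℚₚ.≤-reflexive (trans (ℚₚ.+-identityˡ _) (ℚₚ.*-zeroˡ (w 0)))
    strong (suc D) = begin
      ∑< (suc D) (λ i → ρ i * w i) + (⟦ suc D ⟧ - ∑< (suc D) ρ) * w (suc D)
        ≤⟨ ℚₚ.+-monoʳ-≤ (∑< (suc D) (λ i → ρ i * w i))
             (*-monoˡ (⟦ suc D ⟧ - ∑< (suc D) ρ) (0≤r-p (partial≤ (suc D))) (antitone D)) ⟩
      (ρ D * w D + S) + (⟦ suc D ⟧ - (ρ D + R)) * w D
        ≡⟨ cong (λ k → (ρ D * w D + S) + (k - (ρ D + R)) * w D) (⟦⟧-+ 1 D) ⟩
      (ρ D * w D + S) + ((1ℚ + ⟦ D ⟧) - (ρ D + R)) * w D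
        ≡⟨ solve 5 (λ r v s k t → (r :* v :+ s) :+ ((con 1ℚ :+ k) :- (r :+ t)) :* v
             := v :+ (s :+ (k :- t) :* v)) refl (ρ D) (w D) S ⟦ D ⟧ R ⟩
      w D + (S + (⟦ D ⟧ - R) * w D)
        ≤⟨ ℚₚ.+-monoʳ-≤ (w D) (strong D) ⟩
      w D + ∑< D w ∎
      where
      S = ∑< D (λ i → ρ i * w i)
      R = ∑< D ρ

  -- An upper bound for the tail Σ_{n>s} 1/n² when `s` is positive. It lies below 1/s by
  -- 1/(2s(s+1)), the room from which the error terms are paid.
  φ : ℕ → ℚ
  φ s = ½ * (inv s + inv (suc s))

  -- With `x`, `y`, `z` the reciprocals of three consecutive numbers, the decrease of `φ` is ½ (x -
  -- z) = x z, and y² ≤ x z because the square of the middle number exceeds the product of the outer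
  -- ones by 1.
  φ-step : ∀ s → inv (suc (suc s)) * inv (suc (suc s)) + φ (suc (suc s)) ≤ φ (suc s)
  φ-step s = begin
    y * y + ½ * (y + z)
      ≤⟨ ℚₚ.+-monoˡ-≤ (½ * (y + z)) y²≤xz ⟩
    x * z + ½ * (y + z)
      ≡⟨ solve 3 (λ x y z → x :* z :+ con ½ :* (y :+ z) := con ½ :* (y :+ (z :+ (x :* z :+ x :* z)))) refl x y z ⟩
    ½ * (y + (z + (x * z + x * z)))
      ≡⟨ cong (λ t → ½ * (y + t)) (sym x≡) ⟩
    ½ * (y + x)
      ≡⟨ cong (½ *_) (ℚₚ.+-comm y x) ⟩
    ½ * (x + y) ∎
    where
    open ℚₚ.≤-Reasoning
    x = inv (suc s)
    y = inv (2 ℕ.+ s)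
    z = inv (3 ℕ.+ s)
    y²≤xz : y * y ≤ x * z
    y²≤xz = begin
      y * y                                    ≡⟨ inv-* (2 ℕ.+ s) (2 ℕ.+ s) ⟨
      inv ((2 ℕ.+ s) ℕ.* (2 ℕ.+ s))            ≤⟨ inv-antitone {(1 ℕ.+ s) ℕ.* (3 ℕ.+ s)} {(2 ℕ.+ s) ℕ.* (2 ℕ.+ s)}
                                                    (s≤s z≤n) (ℕₚ.≤-trans (ℕₚ.n≤1+n _) (ℕₚ.≤-reflexive (square s))) ⟩
      inv ((1 ℕ.+ s) ℕ.* (3 ℕ.+ s))            ≡⟨ inv-* (1 ℕ.+ s) (3 ℕ.+ s) ⟩
      x * z                                    ∎
      where
      square : ∀ s → suc ((1 ℕ.+ s) ℕ.* (3 ℕ.+ s)) ≡ (2 ℕ.+ s) ℕ.* (2 ℕ.+ s)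
      square = solve-∀
    x≡ : x ≡ z + (x * z + x * z)
    x≡ = begin-equality
      x                                ≡⟨ inv-suc s ⟩
      y + x * y                        ≡⟨ cong (λ t → t + x * t) (inv-suc (suc s)) ⟩
      (z + y * z) + x * (z + y * z)    ≡⟨ solve 3 (λ x y z → (z :+ y :* z) :+ x :* (z :+ y :* z) := z :+ ((y :+ x :* y) :* z :+ x :* z)) refl x y z ⟩
      z + ((y + x * y) * z + x * z)    ≡⟨ cong (λ t → z + (t * z + x * z)) (sym (inv-suc s)) ⟩
      z + (x * z + x * z)              ∎

  0≤φ : ∀ s → 0ℚ ≤ φ s
  0≤φ s = 0≤* 0≤½ (0≤+ (0≤inv s) (0≤inv (suc s)))

  ∑-inv²≤φ : ∀ s D → ∑< D (λ i → inv (suc s ℕ.+ suc i) * inv (suc s ℕ.+ suc i)) ≤ φ (suc s)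
  ∑-inv²≤φ s D = ℚₚ.≤-trans (p≤p+r (0≤φ (suc s ℕ.+ D))) (strong D)
    where
    open ℚₚ.≤-Reasoning
    sq : ℕ → ℚ
    sq i = inv (suc s ℕ.+ i) * inv (suc s ℕ.+ i)
    strong : ∀ D → ∑< D (λ i → sq (suc i)) + φ (suc s ℕ.+ D) ≤ φ (suc s)
    strong zero = ℚₚ.≤-reflexive (trans (ℚₚ.+-identityˡ _) (cong φ (ℕₚ.+-identityʳ (suc s))))
    strong (suc D) = begin
      (sq (suc D) + ∑< D (λ i → sq (suc i))) + φ (suc s ℕ.+ suc D)
        ≡⟨ solve 3 (λ a b c → (a :+ b) :+ c := b :+ (a :+ c)) refl (sq (suc D)) (∑< D (λ i → sq (suc i))) (φ (suc s ℕ.+ suc D)) ⟩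
      ∑< D (λ i → sq (suc i)) + (sq (suc D) + φ (suc s ℕ.+ suc D))
        ≡⟨ cong (λ t → ∑< D (λ i → sq (suc i)) + (inv t * inv t + φ t)) (ℕₚ.+-suc (suc s) D) ⟩
      ∑< D (λ i → sq (suc i)) + (inv (2 ℕ.+ (s ℕ.+ D)) * inv (2 ℕ.+ (s ℕ.+ D)) + φ (2 ℕ.+ (s ℕ.+ D)))
        ≤⟨ ℚₚ.+-monoʳ-≤ (∑< D (λ i → sq (suc i))) (φ-step (s ℕ.+ D)) ⟩
      ∑< D (λ i → sq (suc i)) + φ (suc s ℕ.+ D)
        ≤⟨ strong D ⟩
      φ (suc s) ∎

  φ≤inv : ∀ s → φ (suc s) ≤ inv (suc s)
  φ≤inv s = begin
    ½ * (inv (suc s) + inv (2 ℕ.+ s))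
      ≤⟨ *-monoˡ ½ 0≤½ (ℚₚ.+-monoʳ-≤ (inv (suc s)) (inv-antitone {suc s} {2 ℕ.+ s} (s≤s z≤n) (ℕₚ.n≤1+n _))) ⟩
    ½ * (inv (suc s) + inv (suc s))
      ≡⟨ solve 1 (λ x → con ½ :* (x :+ x) := x) refl (inv (suc s)) ⟩
    inv (suc s) ∎
    where open ℚₚ.≤-Reasoning

  -- The difference of `inv (suc s)` and `φ (suc s)` is exactly ½ x y, and y ≤ x. Stating it with y²
  -- matches the weight in the error term.
  φ+½inv²≤inv : ∀ s → φ (suc s) + ½ * (inv (2 ℕ.+ s) * inv (2 ℕ.+ s)) ≤ inv (suc s)
  φ+½inv²≤inv s = begin
    ½ * (x + y) + ½ * (y * y)
      ≤⟨ ℚₚ.+-monoʳ-≤ (½ * (x + y)) (*-monoˡ ½ 0≤½ (*-monoʳ y (0≤inv (2 ℕ.+ s))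
           (inv-antitone {suc s} {2 ℕ.+ s} (s≤s z≤n) (ℕₚ.n≤1+n _)))) ⟩
    ½ * (x + y) + ½ * (x * y)
      ≡⟨ solve 2 (λ x y → con ½ :* (x :+ y) :+ con ½ :* (x :* y) := con ½ :* (x :+ (y :+ x :* y))) refl x y ⟩
    ½ * (x + (y + x * y))
      ≡⟨ cong (λ t → ½ * (x + t)) (sym (inv-suc s)) ⟩
    ½ * (x + x)
      ≡⟨ solve 1 (λ x → con ½ :* (x :+ x) := x) refl x ⟩
    x ∎
    where
    open ℚₚ.≤-Reasoning
    x = inv (suc s)
    y = inv (2 ℕ.+ s)

-- Negative powers of q.

module PowersOf (q : ℕ) (2≤q : 2 ℕ.≤ q) where

  open import Data.Rational.Base using (_+_; _*_; _≤_; _<_)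
  open import Relation.Binary.PropositionalEquality using (refl; sym; trans; cong; cong₂)
  open RationalArithmetic
  open RationalSums
  open +-*-Solver using (solve; _:=_; _:+_; _:*_)

  instance
    q-nonZero : NonZero q
    q-nonZero = ℕ.>-nonZero (ℕₚ.≤-trans (s≤s z≤n) 2≤q)

  U : ℕ → ℚ
  U n = inv (q ℕ.^ n)

  0≤U : ∀ n → 0ℚ ≤ U n
  0≤U n = 0≤inv (q ℕ.^ n)

  inv-cancel : ∀ n .{{_ : NonZero n}} → ⟦ n ⟧ * inv n ≡ 1ℚ
  inv-cancel (suc n) = ⟦⟧*inv n

  0<inv′ : ∀ n .{{_ : NonZero n}} → 0ℚ < inv n
  0<inv′ (suc n) = 0<inv n

  0<U : ∀ n → 0ℚ < U n
  0<U n = 0<inv′ (q ℕ.^ n) {{ℕₚ.m^n≢0 q n}}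

  U-+ : ∀ m n → U (m ℕ.+ n) ≡ U m * U n
  U-+ m n = trans (cong inv (ℕₚ.^-distribˡ-+-* q m n)) (inv-* (q ℕ.^ m) (q ℕ.^ n))

  U-cancel : ∀ n → ⟦ q ℕ.^ n ⟧ * U n ≡ 1ℚ
  U-cancel n = inv-cancel (q ℕ.^ n) {{ℕₚ.m^n≢0 q n}}

  U-∸ : ∀ {d n} → d ℕ.≤ n → U n ≡ U (n ℕ.∸ d) * U d
  U-∸ {d} {n} d≤n = trans (cong U (sym (ℕₚ.m∸n+n≡m d≤n))) (U-+ (n ℕ.∸ d) d)

  -- The extremal case is q = 2, where Σ d/2^d = 2. The remainder `⟦ 2 ℕ.* D ℕ.+ 4 ⟧ * U (suc D)` in
  -- the induction is the exact tail for q = 2, and for larger q the step uses 2/q ≤ 1.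
  ∑-dU≤ : ∀ D → ∑< D (λ i → ⟦ suc i ⟧ * U (suc i)) ≤ ⟦ 4 ⟧ * inv q
  ∑-dU≤ D = ℚₚ.≤-trans (p≤p+r (0≤* (0≤⟦⟧ (2 ℕ.* D ℕ.+ 4)) (0≤U (suc D)))) (strong D)
    where
    open ℚₚ.≤-Reasoning
    2u≤1 : ⟦ 2 ⟧ * inv q ≤ 1ℚ
    2u≤1 = ℚₚ.≤-trans (*-monoʳ (inv q) (0≤inv q) (⟦⟧-mono 2≤q)) (ℚₚ.≤-reflexive (inv-cancel q))
    strong : ∀ D → ∑< D (λ i → ⟦ suc i ⟧ * U (suc i)) + ⟦ 2 ℕ.* D ℕ.+ 4 ⟧ * U (suc D) ≤ ⟦ 4 ⟧ * inv q
    strong zero = ℚₚ.≤-reflexive (trans (ℚₚ.+-identityˡ _) (cong (λ n → ⟦ 4 ⟧ * inv n) (ℕₚ.*-identityʳ q)))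
    strong (suc D) = begin
      (⟦ suc D ⟧ * v + S) + ⟦ 2 ℕ.* suc D ℕ.+ 4 ⟧ * U (suc (suc D))
        ≡⟨ cong₂ (λ k t → (⟦ suc D ⟧ * v + S) + k * t)
             (trans (cong ⟦_⟧ (double D)) (⟦⟧-* (3 ℕ.+ D) 2)) (inv-* q (q ℕ.^ suc D)) ⟩
      (⟦ suc D ⟧ * v + S) + (⟦ 3 ℕ.+ D ⟧ * ⟦ 2 ⟧) * (inv q * v)
        ≡⟨ solve 6 (λ a v s b t u → (a :* v :+ s) :+ (b :* t) :* (u :* v) := s :+ (a :+ b :* (t :* u)) :* v) refl
             ⟦ suc D ⟧ v S ⟦ 3 ℕ.+ D ⟧ ⟦ 2 ⟧ (inv q) ⟩
      S + (⟦ suc D ⟧ + ⟦ 3 ℕ.+ D ⟧ * (⟦ 2 ⟧ * inv q)) * v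
        ≤⟨ ℚₚ.+-monoʳ-≤ S (*-monoʳ v (0≤U (suc D)) (ℚₚ.+-monoʳ-≤ ⟦ suc D ⟧
             (*-monoˡ ⟦ 3 ℕ.+ D ⟧ (0≤⟦⟧ (3 ℕ.+ D)) 2u≤1))) ⟩
      S + (⟦ suc D ⟧ + ⟦ 3 ℕ.+ D ⟧ * 1ℚ) * v
        ≡⟨ cong (λ t → S + t * v) (trans (cong (λ t → ⟦ suc D ⟧ + t) (ℚₚ.*-identityʳ ⟦ 3 ℕ.+ D ⟧))
             (trans (sym (⟦⟧-+ (suc D) (3 ℕ.+ D))) (cong ⟦_⟧ (total D)))) ⟩
      S + ⟦ 2 ℕ.* D ℕ.+ 4 ⟧ * v
        ≤⟨ strong D ⟩
      ⟦ 4 ⟧ * inv q ∎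
      where
      S = ∑< D (λ i → ⟦ suc i ⟧ * U (suc i))
      v = U (suc D)
      double : ∀ D → 2 ℕ.* suc D ℕ.+ 4 ≡ (3 ℕ.+ D) ℕ.* 2
      double = solve-∀
      total : ∀ D → suc D ℕ.+ (3 ℕ.+ D) ≡ 2 ℕ.* D ℕ.+ 4
      total = solve-∀

-- Comparison and convergence of the series, from the counting inequalities alone.

module Asymptotics
  (q : ℕ) (2≤q : 2 ℕ.≤ q) (π : ℕ → ℕ) (a : ℕ → ℕ → ℕ)
  (∑-π≤ : ∀ n → Counting.∑[1‥ n ] (λ d → d ℕ.* π d ℕ.* q ℕ.^ (n ℕ.∸ d)) ℕ.≤ n ℕ.* q ℕ.^ n)
  (recursion : ∀ j n → n ℕ.* a (suc j) n ℕ.≤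
    Counting.∑[1‥ n ] (λ d → d ℕ.* ((π d ℕ.+ j ℕ.* j) ℕ.* a j (n ℕ.∸ d))))
  (a-0-suc : ∀ n → a 0 (suc n) ≡ 0)
  (a-suc-0 : ∀ j → a (suc j) 0 ≡ 0)
  where

  open import Data.Rational.Base using (_+_; _*_; _-_; -_; _≤_; _<_)
  open import Relation.Binary.PropositionalEquality using (refl; sym; trans; cong; cong₂)
  open Counting using (∑[1‥_])
  open RationalArithmetic
  open RationalSums
  open Estimates
  open PowersOf q 2≤q
  open +-*-Solver using (solve; _:=_; _:+_; _:*_; _:-_; :-_; con)

  ⟦∑⟧ : ∀ n f → ⟦ ∑[1‥ n ] f ⟧ ≡ ∑< n (λ i → ⟦ f (suc i) ⟧)
  ⟦∑⟧ zero    f = refl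
  ⟦∑⟧ (suc n) f = trans (⟦⟧-+ (f (suc n)) (∑[1‥ n ] f)) (cong (λ s → ⟦ f (suc n) ⟧ + s) (⟦∑⟧ n f))

  b : ℕ → ℕ → ℚ
  b j n = ⟦ a j n ⟧ * U n

  0≤b : ∀ j n → 0ℚ ≤ b j n
  0≤b j n = 0≤* (0≤⟦⟧ (a j n)) (0≤U n)

  b≡0 : ∀ {j n} → a j n ≡ 0 → b j n ≡ 0ℚ
  b≡0 {j} {n} e = trans (cong (λ k → ⟦ k ⟧ * U n) e) (ℚₚ.*-zeroˡ (U n))

  ρ : ℕ → ℚ
  ρ d = ⟦ d ℕ.* π d ⟧ * U d

  ∑-ρ≤ : ∀ n → ∑< n (λ i → ρ (suc i)) ≤ ⟦ n ⟧
  ∑-ρ≤ n = begin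
    ∑< n (λ i → ρ (suc i))
      ≡⟨ ∑<-cong n (λ i i<n → term (suc i) i<n) ⟩
    ∑< n (λ i → U n * ⟦ suc i ℕ.* π (suc i) ℕ.* q ℕ.^ (n ℕ.∸ suc i) ⟧)
      ≡⟨ ∑<-*ˡ n (U n) _ ⟩
    U n * ∑< n (λ i → ⟦ suc i ℕ.* π (suc i) ℕ.* q ℕ.^ (n ℕ.∸ suc i) ⟧)
      ≡⟨ cong (U n *_) (sym (⟦∑⟧ n (λ d → d ℕ.* π d ℕ.* q ℕ.^ (n ℕ.∸ d)))) ⟩
    U n * ⟦ ∑[1‥ n ] (λ d → d ℕ.* π d ℕ.* q ℕ.^ (n ℕ.∸ d)) ⟧
      ≤⟨ *-monoˡ (U n) (0≤U n) (⟦⟧-mono (∑-π≤ n)) ⟩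
    U n * ⟦ n ℕ.* q ℕ.^ n ⟧
      ≡⟨ cong (U n *_) (⟦⟧-* n (q ℕ.^ n)) ⟩
    U n * (⟦ n ⟧ * ⟦ q ℕ.^ n ⟧)
      ≡⟨ solve 3 (λ u n k → u :* (n :* k) := n :* (k :* u)) refl (U n) ⟦ n ⟧ ⟦ q ℕ.^ n ⟧ ⟩
    ⟦ n ⟧ * (⟦ q ℕ.^ n ⟧ * U n)
      ≡⟨ trans (cong (⟦ n ⟧ *_) (U-cancel n)) (ℚₚ.*-identityʳ ⟦ n ⟧) ⟩
    ⟦ n ⟧ ∎
    where
    open ℚₚ.≤-Reasoning
    term : ∀ d → d ℕ.≤ n → ρ d ≡ U n * ⟦ d ℕ.* π d ℕ.* q ℕ.^ (n ℕ.∸ d) ⟧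
    term d d≤n = sym (trans
      (cong₂ _*_ (U-∸ d≤n) (⟦⟧-* (d ℕ.* π d) (q ℕ.^ (n ℕ.∸ d))))
      (trans (solve 4 (λ x y p k → (x :* y) :* (p :* k) := (k :* x) :* (p :* y)) refl
               (U (n ℕ.∸ d)) (U d) ⟦ d ℕ.* π d ⟧ ⟦ q ℕ.^ (n ℕ.∸ d) ⟧)
        (trans (cong (_* ρ d) (U-cancel (n ℕ.∸ d))) (ℚₚ.*-identityˡ (ρ d)))))

  J : ℕ → ℚ
  J j = ⟦ j ℕ.* j ⟧

  -- The kernel of the recursion after division by powers of q: primes of degree `d`, plus the
  -- allowance for repeated primes.
  κ : ℕ → ℕ → ℚ
  κ j d = ρ d + J j * (⟦ d ⟧ * U d)

  -- Since `U n = U (n ∸ d) * U d`, the counting recursion becomes a convolution inequality for the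
  -- densities `b`.
  b-recursion : ∀ j n → ⟦ n ⟧ * b (suc j) n ≤ ∑< n (λ i → κ j (suc i) * b j (n ℕ.∸ suc i))
  b-recursion j n = begin
    ⟦ n ⟧ * (⟦ a (suc j) n ⟧ * U n)
      ≡⟨ solve 3 (λ n a u → n :* (a :* u) := u :* (n :* a)) refl ⟦ n ⟧ ⟦ a (suc j) n ⟧ (U n) ⟩
    U n * (⟦ n ⟧ * ⟦ a (suc j) n ⟧)
      ≡⟨ cong (U n *_) (sym (⟦⟧-* n (a (suc j) n))) ⟩
    U n * ⟦ n ℕ.* a (suc j) n ⟧
      ≤⟨ *-monoˡ (U n) (0≤U n) (⟦⟧-mono (recursion j n)) ⟩
    U n * ⟦ ∑[1‥ n ] f ⟧
      ≡⟨ cong (U n *_) (⟦∑⟧ n f) ⟩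
    U n * ∑< n (λ i → ⟦ f (suc i) ⟧)
      ≡⟨ ∑<-*ˡ n (U n) (λ i → ⟦ f (suc i) ⟧) ⟨
    ∑< n (λ i → U n * ⟦ f (suc i) ⟧)
      ≡⟨ ∑<-cong n (λ i i<n → term (suc i) i<n) ⟩
    ∑< n (λ i → κ j (suc i) * b j (n ℕ.∸ suc i)) ∎
    where
    open ℚₚ.≤-Reasoning
    f : ℕ → ℕ
    f d = d ℕ.* ((π d ℕ.+ j ℕ.* j) ℕ.* a j (n ℕ.∸ d))
    ⟦f⟧ : ∀ d → ⟦ f d ⟧ ≡ (⟦ d ℕ.* π d ⟧ + J j * ⟦ d ⟧) * ⟦ a j (n ℕ.∸ d) ⟧
    ⟦f⟧ d = trans (cong ⟦_⟧ (rearrange d (π d) (j ℕ.* j) (a j (n ℕ.∸ d))))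
      (trans (⟦⟧-* (d ℕ.* π d ℕ.+ j ℕ.* j ℕ.* d) (a j (n ℕ.∸ d)))
        (cong (_* ⟦ a j (n ℕ.∸ d) ⟧) (trans (⟦⟧-+ (d ℕ.* π d) (j ℕ.* j ℕ.* d))
          (cong (λ t → ⟦ d ℕ.* π d ⟧ + t) (⟦⟧-* (j ℕ.* j) d)))))
      where
      rearrange : ∀ d p k x → d ℕ.* ((p ℕ.+ k) ℕ.* x) ≡ (d ℕ.* p ℕ.+ k ℕ.* d) ℕ.* x
      rearrange = solve-∀
    term : ∀ d → d ℕ.≤ n → U n * ⟦ f d ⟧ ≡ κ j d * b j (n ℕ.∸ d)
    term d d≤n = trans (cong₂ _*_ (U-∸ d≤n) (⟦f⟧ d))
      (solve 6 (λ x y p k d a → (x :* y) :* ((p :+ k :* d) :* a) := (p :* y :+ k :* (d :* y)) :* (a :* x)) refl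
        (U (n ℕ.∸ d)) (U d) ⟦ d ℕ.* π d ⟧ (J j) ⟦ d ⟧ ⟦ a j (n ℕ.∸ d) ⟧)

  -- The shift `c = 0` serves the comparison of consecutive series; large `c` damps the low degrees
  -- and serves convergence.
  W : ℕ → ℕ → ℚ
  W c n = inv (n ℕ.+ c) * inv (n ℕ.+ c)

  0≤W : ∀ c n → 0ℚ ≤ W c n
  0≤W c n = 0≤* (0≤inv (n ℕ.+ c)) (0≤inv (n ℕ.+ c))

  W-antitone : ∀ c {m n} → 1 ℕ.≤ m → m ℕ.≤ n → W c n ≤ W c m
  W-antitone c {m} {n} 1≤m m≤n = *-mono (0≤inv (n ℕ.+ c)) (0≤inv (m ℕ.+ c)) inv≤ inv≤
    where
    inv≤ : inv (n ℕ.+ c) ≤ inv (m ℕ.+ c)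
    inv≤ = inv-antitone (ℕₚ.≤-trans 1≤m (ℕₚ.m≤m+n m c)) (ℕₚ.+-monoˡ-≤ c m≤n)

  ε : ℕ → ℚ
  ε j = J j * (⟦ 4 ⟧ * inv q)

  -- The prime part is only bounded on average, so Abel summation compares it with a constant 1. The
  -- repeated-prime part decays geometrically, so the weight is replaced by its largest value
  -- `W c (suc m)`. The case `m + c = 0` is excluded because the default `inv 0 = 0` makes `φ 0`
  -- equal to ½, less than Σ 1/n².
  kernel≤ : ∀ j c m D → 1 ℕ.≤ m ℕ.+ c →
    ∑< D (λ i → κ j (suc i) * W c (m ℕ.+ suc i)) ≤ φ (m ℕ.+ c) + ε j * W c (suc m)
  kernel≤ j c m D 1≤m+c = begin
    ∑< D (λ i → κ j (suc i) * W c (m ℕ.+ suc i))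
      ≡⟨ trans (∑<-cong D (λ i _ → solve 4 (λ r k d w → (r :+ k :* d) :* w := r :* w :+ k :* (d :* w)) refl
             (ρ (suc i)) (J j) (⟦ suc i ⟧ * U (suc i)) (W c (m ℕ.+ suc i))))
           (trans (∑<-+ D _ _) (cong (λ t → ∑< D (λ i → ρ (suc i) * W c (m ℕ.+ suc i)) + t) (∑<-*ˡ D (J j) _))) ⟩
    ∑< D (λ i → ρ (suc i) * W c (m ℕ.+ suc i)) + J j * ∑< D (λ i → (⟦ suc i ⟧ * U (suc i)) * W c (m ℕ.+ suc i))
      ≤⟨ ℚₚ.+-mono-≤ main (*-monoˡ (J j) (0≤⟦⟧ (j ℕ.* j)) error) ⟩
    φ (m ℕ.+ c) + J j * ((⟦ 4 ⟧ * inv q) * W c (suc m))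
      ≡⟨ cong (λ t → φ (m ℕ.+ c) + t) (sym (ℚₚ.*-assoc (J j) (⟦ 4 ⟧ * inv q) (W c (suc m)))) ⟩
    φ (m ℕ.+ c) + ε j * W c (suc m) ∎
    where
    open ℚₚ.≤-Reasoning
    1≤m+suc : ∀ i → 1 ℕ.≤ m ℕ.+ suc i
    1≤m+suc i = ℕₚ.≤-trans (s≤s z≤n) (ℕₚ.m≤n+m (suc i) m)
    ∑W≤φ : ∀ {s} → 1 ℕ.≤ s → s ≡ m ℕ.+ c → ∑< D (λ i → W c (m ℕ.+ suc i)) ≤ φ s
    ∑W≤φ {suc s} _ e = ℚₚ.≤-trans
      (ℚₚ.≤-reflexive (∑<-cong D (λ i _ → cong (λ t → inv t * inv t) (index i)))) (∑-inv²≤φ s D)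
      where
      swap : ∀ m i c → m ℕ.+ i ℕ.+ c ≡ (m ℕ.+ c) ℕ.+ i
      swap = solve-∀
      index : ∀ i → m ℕ.+ suc i ℕ.+ c ≡ suc s ℕ.+ suc i
      index i = trans (swap m (suc i) c) (cong (ℕ._+ suc i) (sym e))
    main : ∑< D (λ i → ρ (suc i) * W c (m ℕ.+ suc i)) ≤ φ (m ℕ.+ c)
    main = ℚₚ.≤-trans
      (abel ∑-ρ≤ (λ i → W-antitone c (1≤m+suc i) (ℕₚ.+-monoʳ-≤ m (ℕₚ.n≤1+n (suc i)))) (λ i → 0≤W c (m ℕ.+ suc i)) D)
      (∑W≤φ 1≤m+c refl)
    error : ∑< D (λ i → (⟦ suc i ⟧ * U (suc i)) * W c (m ℕ.+ suc i)) ≤ (⟦ 4 ⟧ * inv q) * W c (suc m)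
    error = begin
      ∑< D (λ i → (⟦ suc i ⟧ * U (suc i)) * W c (m ℕ.+ suc i))
        ≤⟨ ∑<-mono D (λ i _ → *-monoˡ (⟦ suc i ⟧ * U (suc i)) (0≤* (0≤⟦⟧ (suc i)) (0≤U (suc i)))
             (W-antitone c {suc m} (s≤s z≤n) (ℕₚ.≤-trans (s≤s (ℕₚ.m≤m+n m i)) (ℕₚ.≤-reflexive (sym (ℕₚ.+-suc m i)))))) ⟩
      ∑< D (λ i → (⟦ suc i ⟧ * U (suc i)) * W c (suc m))
        ≡⟨ trans (∑<-cong D (λ i _ → ℚₚ.*-comm (⟦ suc i ⟧ * U (suc i)) (W c (suc m))))
             (trans (∑<-*ˡ D (W c (suc m)) (λ i → ⟦ suc i ⟧ * U (suc i)))
               (ℚₚ.*-comm (W c (suc m)) (∑< D (λ i → ⟦ suc i ⟧ * U (suc i))))) ⟩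
      ∑< D (λ i → ⟦ suc i ⟧ * U (suc i)) * W c (suc m)
        ≤⟨ *-monoʳ (W c (suc m)) (0≤W c (suc m)) (∑-dU≤ D) ⟩
      (⟦ 4 ⟧ * inv q) * W c (suc m) ∎

  transfer : ∀ j c → (∀ m → b j m ≡ 0ℚ ⊎ 1 ℕ.≤ m ℕ.+ c) → ∀ N →
    ∑< N (λ n → (⟦ suc n ⟧ * b (suc j) (suc n)) * W c (suc n)) ≤
    ∑< N (λ m → b j m * (φ (m ℕ.+ c) + ε j * W c (suc m)))
  transfer j c support N = begin
    ∑< N (λ n → (⟦ suc n ⟧ * b (suc j) (suc n)) * W c (suc n))
      ≤⟨ ∑<-mono N (λ n _ → *-monoʳ (W c (suc n)) (0≤W c (suc n)) (b-recursion j (suc n))) ⟩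
    ∑< N (λ n → ∑< (suc n) (λ i → κ j (suc i) * b j (n ℕ.∸ i)) * W c (suc n))
      ≡⟨ ∑<-cong N (λ n _ → trans (ℚₚ.*-comm _ (W c (suc n)))
           (trans (sym (∑<-*ˡ (suc n) (W c (suc n)) _)) (∑<-cong (suc n) (λ i i<1+n → reindex n i (ℕₚ.≤-pred i<1+n))))) ⟩
    ∑< N (λ n → ∑< (suc n) (λ i → G i (n ℕ.∸ i)))
      ≡⟨ ∑<-triangle N G ⟩
    ∑< N (λ m → ∑< (N ℕ.∸ m) (λ i → G i m))
      ≤⟨ ∑<-mono N (λ m _ → ℚₚ.≤-trans
           (ℚₚ.≤-reflexive (∑<-*ˡ (N ℕ.∸ m) (b j m) (λ i → κ j (suc i) * W c (m ℕ.+ suc i))))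
           (bound m (N ℕ.∸ m) (support m))) ⟩
    ∑< N (λ m → b j m * (φ (m ℕ.+ c) + ε j * W c (suc m))) ∎
    where
    open ℚₚ.≤-Reasoning
    G : ℕ → ℕ → ℚ
    G i m = b j m * (κ j (suc i) * W c (m ℕ.+ suc i))
    reindex : ∀ n i → i ℕ.≤ n → W c (suc n) * (κ j (suc i) * b j (n ℕ.∸ i)) ≡ G i (n ℕ.∸ i)
    reindex n i i≤n = trans
      (cong (λ t → W c t * (κ j (suc i) * b j (n ℕ.∸ i)))
        (sym (trans (ℕₚ.+-suc (n ℕ.∸ i) i) (cong suc (ℕₚ.m∸n+n≡m i≤n)))))
      (solve 3 (λ w k x → w :* (k :* x) := x :* (k :* w)) refl (W c (n ℕ.∸ i ℕ.+ suc i)) (κ j (suc i)) (b j (n ℕ.∸ i)))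
    bound : ∀ m D → b j m ≡ 0ℚ ⊎ 1 ℕ.≤ m ℕ.+ c →
      b j m * ∑< D (λ i → κ j (suc i) * W c (m ℕ.+ suc i)) ≤ b j m * (φ (m ℕ.+ c) + ε j * W c (suc m))
    bound m D (inj₁ bm≡0) = ℚₚ.≤-reflexive (trans (zero* _) (sym (zero* _)))
      where
      zero* : ∀ t → b j m * t ≡ 0ℚ
      zero* t = trans (cong (_* t) bm≡0) (ℚₚ.*-zeroˡ t)
    bound m D (inj₂ 1≤m+c) = *-monoˡ (b j m) (0≤b j m) (kernel≤ j c m D 1≤m+c)

  -- Partial sums of the series defining `𝓕`. The term `n = 0` is zero by the default `inv 0 = 0`,
  -- in accordance with the restriction to nonconstant polynomials.
  x : ℕ → ℕ → ℚ
  x j N = ∑< N (λ n → b j n * inv n)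

  0≤x-term : ∀ j n → 0ℚ ≤ b j n * inv n
  0≤x-term j n = 0≤* (0≤b j n) (0≤inv n)

  x-mono : ∀ j {M N} → M ℕ.≤ N → x j M ≤ x j N
  x-mono j = ∑<-extend (0≤x-term j)

  x-suc : ∀ j N → x j (suc N) ≡ ∑< N (λ n → b j (suc n) * inv (suc n))
  x-suc j N = trans (∑<-suc N (λ n → b j n * inv n))
    (trans (cong (_+ ∑< N (λ n → b j (suc n) * inv (suc n))) (ℚₚ.*-zeroʳ (b j 0))) (ℚₚ.+-identityˡ _))

  -- For `c = 0` the factor `n` turns the weight 1/n² into 1/n, so `transfer` compares the series
  -- themselves. Of the room ½ W, one half absorbs `ε j` and the other is kept on the left. The
  -- upper limits differ by one because a prime factor has degree at least 1.
  gap : ∀ j → 1 ℕ.≤ j → ε j ≤ ½ * ½ → ∀ N →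
    x (suc j) (suc N) + ∑< N (λ m → b j m * ((½ * ½) * W 0 (suc m))) ≤ x j N
  gap j@(suc j-1) _ ε≤¼ N = begin
    x (suc j) (suc N) + ∑< N (λ m → b j m * ((½ * ½) * W 0 (suc m)))
      ≡⟨ cong (_+ ∑< N (λ m → b j m * ((½ * ½) * W 0 (suc m)))) (trans (x-suc (suc j) N) (∑<-cong N (λ n _ → sym (weighted n)))) ⟩
    ∑< N (λ n → (⟦ suc n ⟧ * b (suc j) (suc n)) * W 0 (suc n)) + ∑< N (λ m → b j m * ((½ * ½) * W 0 (suc m)))
      ≤⟨ ℚₚ.+-monoˡ-≤ _ (transfer j 0 support N) ⟩
    ∑< N (λ m → b j m * (φ (m ℕ.+ 0) + ε j * W 0 (suc m))) + ∑< N (λ m → b j m * ((½ * ½) * W 0 (suc m)))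
      ≡⟨ ∑<-+ N _ _ ⟨
    ∑< N (λ m → b j m * (φ (m ℕ.+ 0) + ε j * W 0 (suc m)) + b j m * ((½ * ½) * W 0 (suc m)))
      ≤⟨ ∑<-mono N (λ m _ → termwise m) ⟩
    x j N ∎
    where
    open ℚₚ.≤-Reasoning
    -- A product of `j ≥ 1` primes is not constant, so the excluded case `m = 0` contributes
    -- nothing.
    support : ∀ m → b j m ≡ 0ℚ ⊎ 1 ℕ.≤ m ℕ.+ 0
    support zero    = inj₁ (b≡0 {j} {0} (a-suc-0 j-1))
    support (suc m) = inj₂ (s≤s z≤n)
    weighted : ∀ n → (⟦ suc n ⟧ * b (suc j) (suc n)) * W 0 (suc n) ≡ b (suc j) (suc n) * inv (suc n)
    weighted n = trans (cong (λ t → (⟦ suc n ⟧ * b (suc j) (suc n)) * (inv t * inv t)) (ℕₚ.+-identityʳ (suc n)))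
      (trans (solve 3 (λ k b i → (k :* b) :* (i :* i) := (k :* i) :* (b :* i)) refl ⟦ suc n ⟧ (b (suc j) (suc n)) (inv (suc n)))
        (trans (cong (_* (b (suc j) (suc n) * inv (suc n))) (⟦⟧*inv n)) (ℚₚ.*-identityˡ _)))
    termwise : ∀ m → b j m * (φ (m ℕ.+ 0) + ε j * W 0 (suc m)) + b j m * ((½ * ½) * W 0 (suc m)) ≤ b j m * inv m
    termwise zero = ℚₚ.≤-reflexive (trans
      (cong₂ _+_ (zero* (φ 0 + ε j * W 0 1)) (zero* ((½ * ½) * W 0 1))) (sym (zero* 0ℚ)))
      where
      zero* : ∀ t → b j 0 * t ≡ 0ℚ
      zero* t = trans (cong (_* t) (b≡0 {j} {0} (a-suc-0 j-1))) (ℚₚ.*-zeroˡ t)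
    termwise (suc s) = begin
      b j (suc s) * (φ (suc s ℕ.+ 0) + ε j * W 0 (2 ℕ.+ s)) + b j (suc s) * ((½ * ½) * W 0 (2 ℕ.+ s))
        ≤⟨ ℚₚ.+-monoˡ-≤ _ (*-monoˡ (b j (suc s)) (0≤b j (suc s)) (ℚₚ.+-monoʳ-≤ (φ (suc s ℕ.+ 0))
             (*-monoʳ (W 0 (2 ℕ.+ s)) (0≤W 0 (2 ℕ.+ s)) ε≤¼))) ⟩
      b j (suc s) * (φ (suc s ℕ.+ 0) + (½ * ½) * W 0 (2 ℕ.+ s)) + b j (suc s) * ((½ * ½) * W 0 (2 ℕ.+ s))
        ≡⟨ solve 3 (λ b p w → b :* (p :+ (con ½ :* con ½) :* w) :+ b :* ((con ½ :* con ½) :* w) := b :* (p :+ con ½ :* w))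
             refl (b j (suc s)) (φ (suc s ℕ.+ 0)) (W 0 (2 ℕ.+ s)) ⟩
      b j (suc s) * (φ (suc s ℕ.+ 0) + ½ * W 0 (2 ℕ.+ s))
        ≡⟨ cong (b j (suc s) *_) (cong₂ (λ t v → φ t + ½ * (inv v * inv v)) (ℕₚ.+-identityʳ (suc s)) (ℕₚ.+-identityʳ (2 ℕ.+ s))) ⟩
      b j (suc s) * (φ (suc s) + ½ * (inv (2 ℕ.+ s) * inv (2 ℕ.+ s)))
        ≤⟨ *-monoˡ (b j (suc s)) (0≤b j (suc s)) (φ+½inv²≤inv s) ⟩
      b j (suc s) * inv (suc s) ∎

  strictly-decreasing : ∀ j → 1 ℕ.≤ j → 16 ℕ.* (j ℕ.* j) ℕ.≤ q → 1 ℕ.≤ a j j →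
    ∃ λ δ → 0ℚ < δ × ∃ λ M → ∀ N → M ℕ.≤ N → x (suc j) N + δ ≤ x j N
  strictly-decreasing j 1≤j 16j²≤q 1≤ajj = δ , 0<δ , suc j , λ N j<N → begin
    x (suc j) N + δ
      ≤⟨ ℚₚ.+-mono-≤ (x-mono (suc j) (ℕₚ.n≤1+n N))
           (term≤∑< {j} {N} {λ m → b j m * ((½ * ½) * W 0 (suc m))}
             (λ m → 0≤* (0≤b j m) (0≤* (0≤* 0≤½ 0≤½) (0≤W 0 (suc m)))) j<N) ⟩
    x (suc j) (suc N) + ∑< N (λ m → b j m * ((½ * ½) * W 0 (suc m)))
      ≤⟨ gap j 1≤j ε≤¼ N ⟩
    x j N ∎
    where
    open ℚₚ.≤-Reasoning
    δ : ℚ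
    -- The summand `m = j` of the kept room. It does not depend on `N`, as the order on reals
    -- requires, and is positive since `a j j` is.
    δ = b j j * ((½ * ½) * W 0 (suc j))
    0<½ : 0ℚ < ½
    0<½ = 0<inv 1
    0<δ : 0ℚ < δ
    0<δ = 0<* (0<* (ℚₚ.<-≤-trans (ℚₚ.positive⁻¹ 1ℚ) (⟦⟧-mono 1≤ajj)) (0<U j))
      (0<* (0<* 0<½ 0<½) (0<* (0<inv (j ℕ.+ 0)) (0<inv (j ℕ.+ 0))))
    ε≤¼ : ε j ≤ ½ * ½
    ε≤¼ = begin
      J j * (⟦ 4 ⟧ * inv q)
        ≡⟨ solve 2 (λ k u → k :* (con ⟦ 4 ⟧ :* u) := (con ½ :* con ½) :* ((con ⟦ 16 ⟧ :* k) :* u)) refl (J j) (inv q) ⟩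
      (½ * ½) * ((⟦ 16 ⟧ * J j) * inv q)
        ≡⟨ cong (λ t → (½ * ½) * (t * inv q)) (sym (⟦⟧-* 16 (j ℕ.* j))) ⟩
      (½ * ½) * (⟦ 16 ℕ.* (j ℕ.* j) ⟧ * inv q)
        ≤⟨ *-monoˡ (½ * ½) (0≤* 0≤½ 0≤½) (*-monoʳ (inv q) (0≤inv q) (⟦⟧-mono 16j²≤q)) ⟩
      (½ * ½) * (⟦ q ⟧ * inv q)
        ≡⟨ cong ((½ * ½) *_) (inv-cancel q) ⟩
      (½ * ½) * 1ℚ
        ≡⟨ ℚₚ.*-identityʳ (½ * ½) ⟩
      ½ * ½ ∎

  -- Convergence, by induction on the number of factors.

  TailVanishes : ℕ → Set
  TailVanishes j = ∀ η → 0ℚ < η → ∃ λ M → ∀ N → x j N ≤ x j M + η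

  -- The bound is a positive natural number so that it can become a factor of the shift `c`.
  ∑<-b≤ : ∀ j M → ∃ λ C → ∑< M (b j) ≤ ⟦ suc C ⟧
  ∑<-b≤ j zero    = 0 , 0≤⟦⟧ 1
  ∑<-b≤ j (suc M) with C , ∑≤ ← ∑<-b≤ j M = a j M ℕ.+ C , (begin
    ⟦ a j M ⟧ * U M + ∑< M (b j)  ≤⟨ ℚₚ.+-mono-≤ (*-monoˡ ⟦ a j M ⟧ (0≤⟦⟧ (a j M)) (inv≤1 (q ℕ.^ M))) ∑≤ ⟩
    ⟦ a j M ⟧ * 1ℚ + ⟦ suc C ⟧    ≡⟨ cong (_+ ⟦ suc C ⟧) (ℚₚ.*-identityʳ ⟦ a j M ⟧) ⟩
    ⟦ a j M ⟧ + ⟦ suc C ⟧         ≡⟨ ⟦⟧-+ (a j M) (suc C) ⟨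
    ⟦ a j M ℕ.+ suc C ⟧           ≡⟨ cong ⟦_⟧ (ℕₚ.+-suc (a j M) C) ⟩
    ⟦ suc (a j M ℕ.+ C) ⟧         ∎)
    where open ℚₚ.≤-Reasoning

  -- Below `M` the reciprocal is at most 1/c, from `M` on at most 1/m. Adding `x j M` on the left
  -- expresses the tail of the series without subtraction.
  shifted-sum≤ : ∀ j c M k → 1 ℕ.≤ c → 1 ℕ.≤ M →
    ∑< (k ℕ.+ M) (λ m → b j m * inv (m ℕ.+ c)) + x j M ≤ ∑< M (b j) * inv c + x j (k ℕ.+ M)
  shifted-sum≤ j c M zero 1≤c 1≤M = ℚₚ.+-monoˡ-≤ (x j M) (begin
    ∑< M (λ m → b j m * inv (m ℕ.+ c))
      ≤⟨ ∑<-mono M (λ m _ → ℚₚ.≤-trans (*-monoˡ (b j m) (0≤b j m) (inv-antitone 1≤c (ℕₚ.m≤n+m c m)))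
           (ℚₚ.≤-reflexive (ℚₚ.*-comm (b j m) (inv c)))) ⟩
    ∑< M (λ m → inv c * b j m)
      ≡⟨ trans (∑<-*ˡ M (inv c) (b j)) (ℚₚ.*-comm (inv c) (∑< M (b j))) ⟩
    ∑< M (b j) * inv c ∎)
    where open ℚₚ.≤-Reasoning
  shifted-sum≤ j c M (suc k) 1≤c 1≤M = begin
    (b j m * inv (m ℕ.+ c) + S) + x j M
      ≡⟨ ℚₚ.+-assoc (b j m * inv (m ℕ.+ c)) S (x j M) ⟩
    b j m * inv (m ℕ.+ c) + (S + x j M)
      ≤⟨ ℚₚ.+-mono-≤ (*-monoˡ (b j m) (0≤b j m)
           (inv-antitone (ℕₚ.≤-trans 1≤M (ℕₚ.m≤n+m M k)) (ℕₚ.m≤m+n m c))) (shifted-sum≤ j c M k 1≤c 1≤M) ⟩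
    b j m * inv m + (∑< M (b j) * inv c + x j m)
      ≡⟨ solve 3 (λ a b c → a :+ (b :+ c) := b :+ (a :+ c)) refl (b j m * inv m) (∑< M (b j) * inv c) (x j m) ⟩
    ∑< M (b j) * inv c + (b j m * inv m + x j m) ∎
    where
    open ℚₚ.≤-Reasoning
    m = k ℕ.+ M
    S = ∑< m (λ m → b j m * inv (m ℕ.+ c))

  -- For n ≥ c one has 1/n ≤ 2/(n+c), hence 1/n = n · 1/n² ≤ 4n/(n+c)². The degrees below `c` are
  -- the head.
  x≤head+smoothed : ∀ j c N → 1 ℕ.≤ c →
    x j N ≤ x j c + ⟦ 4 ⟧ * ∑< N (λ n → (⟦ n ⟧ * b j n) * W c n)
  x≤head+smoothed j c N 1≤c = go N
    where
    open ℚₚ.≤-Reasoning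
    0≤term : ∀ n → 0ℚ ≤ (⟦ n ⟧ * b j n) * W c n
    0≤term n = 0≤* (0≤* (0≤⟦⟧ n) (0≤b j n)) (0≤W c n)
    inv≤2inv : ∀ n → c ℕ.≤ suc n → inv (suc n) ≤ ⟦ 2 ⟧ * inv (suc n ℕ.+ c)
    inv≤2inv n c≤n = begin
      inv (suc n)                    ≡⟨ solve 1 (λ i → i := con ⟦ 2 ⟧ :* (i :* con ½)) refl (inv (suc n)) ⟩
      ⟦ 2 ⟧ * (inv (suc n) * inv 2)  ≡⟨ cong (⟦ 2 ⟧ *_) (inv-* (suc n) 2) ⟨
      ⟦ 2 ⟧ * inv (suc n ℕ.* 2)      ≤⟨ *-monoˡ ⟦ 2 ⟧ (0≤⟦⟧ 2) (inv-antitone {suc n ℕ.+ c} {suc n ℕ.* 2} (s≤s z≤n)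
                                          (ℕₚ.≤-trans (ℕₚ.+-monoʳ-≤ (suc n) c≤n) (ℕₚ.≤-reflexive (double (suc n))))) ⟩
      ⟦ 2 ⟧ * inv (suc n ℕ.+ c)      ∎
      where
      double : ∀ n → n ℕ.+ n ≡ n ℕ.* 2
      double = solve-∀
    term≤ : ∀ n → c ℕ.≤ n → b j n * inv n ≤ ⟦ 4 ⟧ * ((⟦ n ⟧ * b j n) * W c n)
    term≤ zero c≤0 with () ← ℕₚ.≤-trans 1≤c c≤0
    term≤ n@(suc n-1) c≤n = begin
      b j n * i
        ≡⟨ ℚₚ.*-identityˡ (b j n * i) ⟨
      1ℚ * (b j n * i)
        ≡⟨ cong (_* (b j n * i)) (sym (⟦⟧*inv n-1)) ⟩
      (⟦ n ⟧ * i) * (b j n * i)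
        ≡⟨ solve 3 (λ k b i → (k :* i) :* (b :* i) := (k :* b) :* (i :* i)) refl ⟦ n ⟧ (b j n) i ⟩
      (⟦ n ⟧ * b j n) * (i * i)
        ≤⟨ *-monoˡ (⟦ n ⟧ * b j n) (0≤* (0≤⟦⟧ n) (0≤b j n))
             (*-mono (0≤inv n) (0≤* (0≤⟦⟧ 2) (0≤inv (n ℕ.+ c))) (inv≤2inv n-1 c≤n) (inv≤2inv n-1 c≤n)) ⟩
      (⟦ n ⟧ * b j n) * ((⟦ 2 ⟧ * y) * (⟦ 2 ⟧ * y))
        ≡⟨ solve 2 (λ b y → b :* ((con ⟦ 2 ⟧ :* y) :* (con ⟦ 2 ⟧ :* y)) := con ⟦ 4 ⟧ :* (b :* (y :* y))) refl (⟦ n ⟧ * b j n) y ⟩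
      ⟦ 4 ⟧ * ((⟦ n ⟧ * b j n) * (y * y)) ∎
      where
      i = inv n
      y = inv (n ℕ.+ c)
    go : ∀ N → x j N ≤ x j c + ⟦ 4 ⟧ * ∑< N (λ n → (⟦ n ⟧ * b j n) * W c n)
    go zero = 0≤+ (0≤∑< c (0≤x-term j)) ℚₚ.≤-refl
    go (suc N) with N ℕₚ.<? c
    ... | yes N<c = ℚₚ.≤-trans (x-mono j N<c) (p≤p+r (0≤* (0≤⟦⟧ 4) (0≤∑< (suc N) 0≤term)))
    ... | no  N≮c = begin
      b j N * inv N + x j N
        ≤⟨ ℚₚ.+-mono-≤ (term≤ N (ℕₚ.≮⇒≥ N≮c)) (go N) ⟩
      ⟦ 4 ⟧ * t + (x j c + ⟦ 4 ⟧ * S)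
        ≡⟨ solve 4 (λ f t x s → f :* t :+ (x :+ f :* s) := x :+ f :* (t :+ s)) refl ⟦ 4 ⟧ t (x j c) S ⟩
      x j c + ⟦ 4 ⟧ * (t + S) ∎
      where
      t = (⟦ N ⟧ * b j N) * W c N
      S = ∑< N (λ n → (⟦ n ⟧ * b j n) * W c n)

  -- The 4 is lost in passing to smoothed weights; 1 + 4j² bounds `φ + ε j * W` relative to
  -- `inv (m + c)`, with 1/q estimated by 1.
  K : ℕ → ℕ
  K j = 4 ℕ.* (1 ℕ.+ j ℕ.* j ℕ.* 4)

  -- Here `c ≥ 1` makes the kernel bound available at every `m`, and crude estimates suffice because
  -- the smallness will come from `c`.
  smoothed≤ : ∀ j c N → 1 ℕ.≤ c →
    ⟦ 4 ⟧ * ∑< N (λ n → (⟦ n ⟧ * b (suc j) n) * W c n) ≤ ⟦ K j ⟧ * ∑< N (λ m → b j m * inv (m ℕ.+ c))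
  smoothed≤ j c N 1≤c = begin
    ⟦ 4 ⟧ * ∑< N (λ n → (⟦ n ⟧ * b (suc j) n) * W c n)
      ≤⟨ *-monoˡ ⟦ 4 ⟧ (0≤⟦⟧ 4) (begin
        ∑< N (λ n → (⟦ n ⟧ * b (suc j) n) * W c n)
          ≤⟨ ∑<-extend {N} {suc N} {λ n → (⟦ n ⟧ * b (suc j) n) * W c n}
               (λ n → 0≤* (0≤* (0≤⟦⟧ n) (0≤b (suc j) n)) (0≤W c n)) (ℕₚ.n≤1+n N) ⟩
        ∑< (suc N) (λ n → (⟦ n ⟧ * b (suc j) n) * W c n)
          ≡⟨ trans (∑<-suc N (λ n → (⟦ n ⟧ * b (suc j) n) * W c n))
               (trans (cong (_+ ∑< N (λ n → (⟦ suc n ⟧ * b (suc j) (suc n)) * W c (suc n)))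
                 (trans (cong (_* W c 0) (ℚₚ.*-zeroˡ (b (suc j) 0))) (ℚₚ.*-zeroˡ (W c 0)))) (ℚₚ.+-identityˡ _)) ⟩
        ∑< N (λ n → (⟦ suc n ⟧ * b (suc j) (suc n)) * W c (suc n))
          ≤⟨ transfer j c (λ m → inj₂ (1≤m+c m)) N ⟩
        ∑< N (λ m → b j m * (φ (m ℕ.+ c) + ε j * W c (suc m)))
          ≤⟨ ∑<-mono N (λ m _ → ℚₚ.≤-trans (*-monoˡ (b j m) (0≤b j m) (factor m))
               (ℚₚ.≤-reflexive (solve 3 (λ b e i → b :* (e :* i) := e :* (b :* i)) refl
                 (b j m) (1ℚ + J j * ⟦ 4 ⟧) (inv (m ℕ.+ c))))) ⟩
        ∑< N (λ m → (1ℚ + J j * ⟦ 4 ⟧) * (b j m * inv (m ℕ.+ c)))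
          ≡⟨ ∑<-*ˡ N (1ℚ + J j * ⟦ 4 ⟧) (λ m → b j m * inv (m ℕ.+ c)) ⟩
        (1ℚ + J j * ⟦ 4 ⟧) * S ∎) ⟩
    ⟦ 4 ⟧ * ((1ℚ + J j * ⟦ 4 ⟧) * S)
      ≡⟨ ℚₚ.*-assoc ⟦ 4 ⟧ (1ℚ + J j * ⟦ 4 ⟧) S ⟨
    (⟦ 4 ⟧ * (1ℚ + J j * ⟦ 4 ⟧)) * S
      ≡⟨ cong (_* S) (sym (trans (⟦⟧-* 4 (1 ℕ.+ j ℕ.* j ℕ.* 4))
           (cong (⟦ 4 ⟧ *_) (trans (⟦⟧-+ 1 (j ℕ.* j ℕ.* 4)) (cong (λ t → 1ℚ + t) (⟦⟧-* (j ℕ.* j) 4)))))) ⟩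
    ⟦ K j ⟧ * S ∎
    where
    open ℚₚ.≤-Reasoning
    S = ∑< N (λ m → b j m * inv (m ℕ.+ c))
    1≤m+c : ∀ m → 1 ℕ.≤ m ℕ.+ c
    1≤m+c m = ℕₚ.≤-trans 1≤c (ℕₚ.m≤n+m c m)
    ε≤ : ε j ≤ J j * ⟦ 4 ⟧
    ε≤ = *-monoˡ (J j) (0≤⟦⟧ (j ℕ.* j))
      (ℚₚ.≤-trans (*-monoˡ ⟦ 4 ⟧ (0≤⟦⟧ 4) (inv≤1 q)) (ℚₚ.≤-reflexive (ℚₚ.*-identityʳ ⟦ 4 ⟧)))
    φ≤inv′ : ∀ {s} → 1 ℕ.≤ s → φ s ≤ inv s
    φ≤inv′ {suc s} _ = φ≤inv s
    W≤inv : ∀ m → W c (suc m) ≤ inv (m ℕ.+ c)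
    W≤inv m = ℚₚ.≤-trans (*-mono (0≤inv (suc m ℕ.+ c)) (0≤inv (m ℕ.+ c))
        (inv-antitone (1≤m+c m) (ℕₚ.n≤1+n (m ℕ.+ c))) (inv≤1 (suc m ℕ.+ c)))
      (ℚₚ.≤-reflexive (ℚₚ.*-identityʳ (inv (m ℕ.+ c))))
    factor : ∀ m → φ (m ℕ.+ c) + ε j * W c (suc m) ≤ (1ℚ + J j * ⟦ 4 ⟧) * inv (m ℕ.+ c)
    factor m = ℚₚ.≤-trans
      (ℚₚ.+-mono-≤ (φ≤inv′ (1≤m+c m))
        (*-mono (0≤W c (suc m)) (0≤* (0≤⟦⟧ (j ℕ.* j)) (0≤⟦⟧ 4)) ε≤ (W≤inv m)))
      (ℚₚ.≤-reflexive (solve 2 (λ i e → i :+ e :* i := (con 1ℚ :+ e) :* i) refl (inv (m ℕ.+ c)) (J j * ⟦ 4 ⟧)))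

  -- A small tail for `j` gives one for `suc j`: the shifted sum is split at `suc M`, the low part
  -- being small by the size of `c` and the high part by hypothesis.
  tail-step : ∀ j d M C → (∀ N → x j N ≤ x j M + inv (2 ℕ.* (K j ℕ.* suc d))) → ∑< (suc M) (b j) ≤ ⟦ suc C ⟧ →
    ∀ N → x (suc j) N ≤ x (suc j) (suc C ℕ.* (2 ℕ.* (K j ℕ.* suc d))) + inv (suc d)
  tail-step j d M C x≤x+η′ ∑b≤ N = begin
    x (suc j) N
      ≤⟨ x≤head+smoothed (suc j) c N 1≤c ⟩
    x (suc j) c + ⟦ 4 ⟧ * ∑< N (λ n → (⟦ n ⟧ * b (suc j) n) * W c n)
      ≤⟨ ℚₚ.+-monoʳ-≤ (x (suc j) c) (ℚₚ.≤-trans (smoothed≤ j c N 1≤c) (*-monoˡ ⟦ K j ⟧ (0≤⟦⟧ (K j)) shifted≤)) ⟩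
    x (suc j) c + ⟦ K j ⟧ * (η′ + η′)
      ≡⟨ cong (λ t → x (suc j) c + t) total ⟩
    x (suc j) c + inv (suc d) ∎
    where
    open ℚₚ.≤-Reasoning
    -- Each of the two parts is to be at most 1/E, and K · 2/E = 1/(d+1) fixes `E`. The factor
    -- `suc C` in `c` cancels the bound on the sum of the low densities.
    E c : ℕ
    E = 2 ℕ.* (K j ℕ.* suc d)
    c = suc C ℕ.* E
    η′ : ℚ
    η′ = inv E
    1≤c : 1 ℕ.≤ c
    1≤c = s≤s z≤n
    total : ⟦ K j ⟧ * (η′ + η′) ≡ inv (suc d)
    total = trans (cong (λ t → ⟦ K j ⟧ * (t + t)) (trans (inv-* 2 (K j ℕ.* suc d)) (cong (½ *_) (inv-* (K j) (suc d)))))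
      (trans (solve 3 (λ k i d → k :* (con ½ :* (i :* d) :+ con ½ :* (i :* d)) := (k :* i) :* d) refl ⟦ K j ⟧ (inv (K j)) (inv (suc d)))
        (trans (cong (_* inv (suc d)) (inv-cancel (K j))) (ℚₚ.*-identityˡ (inv (suc d)))))
    shifted≤ : ∑< N (λ m → b j m * inv (m ℕ.+ c)) ≤ η′ + η′
    shifted≤ = begin
      ∑< N (λ m → b j m * inv (m ℕ.+ c))
        ≤⟨ ∑<-extend {N} {N ℕ.+ suc M} (λ m → 0≤* (0≤b j m) (0≤inv (m ℕ.+ c))) (ℕₚ.m≤m+n N (suc M)) ⟩
      S
        ≡⟨ solve 2 (λ s x → s := (s :+ x) :- x) refl S (x j (suc M)) ⟩
      (S + x j (suc M)) - x j (suc M)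
        ≤⟨ ℚₚ.+-monoˡ-≤ (- x j (suc M)) (shifted-sum≤ j c (suc M) N 1≤c (s≤s z≤n)) ⟩
      (∑< (suc M) (b j) * inv c + x j (N ℕ.+ suc M)) - x j (suc M)
        ≤⟨ ℚₚ.+-monoˡ-≤ (- x j (suc M)) (ℚₚ.+-mono-≤ (*-monoʳ (inv c) (0≤inv c) ∑b≤)
             (ℚₚ.≤-trans (x≤x+η′ (N ℕ.+ suc M)) (ℚₚ.+-monoˡ-≤ η′ (x-mono j (ℕₚ.n≤1+n M))))) ⟩
      (⟦ suc C ⟧ * inv c + (x j (suc M) + η′)) - x j (suc M)
        ≡⟨ solve 3 (λ p x e → (p :+ (x :+ e)) :- x := p :+ e) refl (⟦ suc C ⟧ * inv c) (x j (suc M)) η′ ⟩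
      ⟦ suc C ⟧ * inv c + η′
        ≡⟨ cong (_+ η′) (trans (cong (⟦ suc C ⟧ *_) (inv-* (suc C) E))
             (trans (sym (ℚₚ.*-assoc ⟦ suc C ⟧ (inv (suc C)) η′))
               (trans (cong (_* η′) (⟦⟧*inv C)) (ℚₚ.*-identityˡ η′)))) ⟩
      η′ + η′ ∎
      where
      S = ∑< (N ℕ.+ suc M) (λ m → b j m * inv (m ℕ.+ c))

  tailVanishes : ∀ j → TailVanishes j
  tailVanishes zero η 0<η = 0 , λ N → ℚₚ.≤-trans
    (ℚₚ.≤-reflexive (x-0 N)) (ℚₚ.≤-trans (ℚₚ.<⇒≤ 0<η) (ℚₚ.≤-reflexive (sym (ℚₚ.+-identityˡ η))))
    where
    -- Only the constant 1 is a product of no primes, and its degree 0 has weight `inv 0 = 0`.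
    x-0 : ∀ N → x 0 N ≡ 0ℚ
    x-0 zero          = refl
    x-0 (suc zero)    = trans (ℚₚ.+-identityʳ (b 0 0 * 0ℚ)) (ℚₚ.*-zeroʳ (b 0 0))
    x-0 (suc (suc N)) = trans (cong₂ _+_ (trans (cong (_* inv (suc N)) (b≡0 {0} {suc N} (a-0-suc N))) (ℚₚ.*-zeroˡ (inv (suc N)))) (x-0 (suc N)))
      (ℚₚ.+-identityˡ 0ℚ)
  tailVanishes (suc j) η 0<η =
    let d , inv≤η = inv-archimedean η 0<η
        M , x≤x+η′ = tailVanishes j (inv (2 ℕ.* (K j ℕ.* suc d))) (0<inv′ (2 ℕ.* (K j ℕ.* suc d)))
        C , ∑b≤ = ∑<-b≤ j (suc M)
    in suc C ℕ.* (2 ℕ.* (K j ℕ.* suc d)) , λ N → ℚₚ.≤-trans (tail-step j d M C x≤x+η′ ∑b≤ N)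
         (ℚₚ.+-monoʳ-≤ (x (suc j) (suc C ℕ.* (2 ℕ.* (K j ℕ.* suc d)))) inv≤η)

  x-cauchy : ∀ j → IsCauchy (x j)
  x-cauchy j η 0<η = M , close
    where
    M = proj₁ (tailVanishes j η 0<η)
    x≤x+η = proj₂ (tailVanishes j η 0<η)
    difference≤ : ∀ m n → M ℕ.≤ n → x j m - x j n ≤ η
    difference≤ m n M≤n = ℚₚ.≤-trans
      (ℚₚ.+-mono-≤ (x≤x+η m) (ℚₚ.neg-antimono-≤ (x-mono j M≤n)))
      (ℚₚ.≤-reflexive (solve 2 (λ a e → (a :+ e) :- a := e) refl (x j M) η))
    close : ∀ m n → M ℕ.≤ m → M ℕ.≤ n → ℚ.∣ x j m - x j n ∣ ≤ η
    close m n M≤m M≤n with ℚₚ.∣p∣≡p∨∣p∣≡-p (x j m - x j n)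
    ... | inj₁ e = ℚₚ.≤-trans (ℚₚ.≤-reflexive e) (difference≤ m n M≤n)
    ... | inj₂ e = ℚₚ.≤-trans (ℚₚ.≤-reflexive (trans e
      (solve 2 (λ a b → :- (a :- b) := b :- a) refl (x j m) (x j n)))) (difference≤ n m M≤m)

-- The series as the sum over the set of polynomials.

module Summation {q : ℕ} (F : FiniteField q) (2≤q : 2 ℕ.≤ q) where

  open import Data.Fin.Base using (zero; suc)
  open import Data.Integer.Base using (+_)
  open import Data.Rational.Base using (_/_)
  open import Data.Vec.Base using ([]; _∷_)
  open FiniteField F using (Carrier; commutativeRing; 1≉0; 0#; 1#; refl; sym)
  open Polynomial commutativeRing hiding (Irreducible; product)
  open PolynomialsOverField F
  open IrreducibleFactors F
  open FactorCounting F
  open Counting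
  open RationalArithmetic
  open RationalSums
  open PowersOf q 2≤q

  private
    module 𝓟 = CommutativeRing polyRing

  open MonoidSum 𝓟.*-commutativeMonoid using () renaming (sum-cong-≋ to product-cong)

  length-empty : ∀ {a p} {A : Set a} {P : A → Set p} {xs : List A} → (∀ {x} → ¬ P x) → All P xs → length xs ≡ 0
  length-empty ¬P []       = ≡.refl
  length-empty ¬P (px ∷ _) = contradiction px ¬P

  a-0-suc : ∀ n → a 0 (suc n) ≡ 0
  a-0-suc n = length-empty (λ (l , φ) → ℕₚ.1+n≢0 (Monic-unique l (Factorization.monic-degree φ)))
    (All.zip (products-Monic 0 (suc n) , products-Factorization 0 (suc n)))

  a-suc-0 : ∀ j → a (suc j) 0 ≡ 0
  a-suc-0 j = length-empty (λ (l , φ) → ℕₚ.n>0⇒n≢0 (positive φ) (Monic-unique (Factorization.monic-degree φ) l))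
    (All.zip (products-Monic (suc j) 0 , products-Factorization (suc j) 0))
    where
    positive : ∀ {f} (φ : Factorization (suc j) f) → 1 ℕ.≤ ∑ (allFin (suc j)) (Factorization.degrees φ)
    positive φ = ℕₚ.≤-trans
      (ℕₚ.≤-trans (Irreducible-degree (proj₁ (Factorization.prime φ zero)) (proj₂ (Factorization.prime φ zero)))
        (ℕₚ.m≤m+n _ _))
      (ℕₚ.≤-reflexive (≡.sym (∑-allFin-suc (Factorization.degrees φ))))

  X : Poly
  X = 0# ∷ 1# ∷ []

  X-prime : Prime X 1
  X-prime = Lead-∷ Monic-1 , noProperDivisor⇒irreducible (Lead-∷ Monic-1) (s≤s z≤n)
    λ (d , d<1 , 1≤d , _) → ℕₚ.<-irrefl ≡.refl (ℕₚ.<-≤-trans d<1 1≤d)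

  -- The power x^j witnesses this, and through it every strict inequality of the chain gets its
  -- margin.
  1≤a-diagonal : ∀ j → 1 ℕ.≤ a j j
  1≤a-diagonal j = nonempty (products-complete
    (≡.subst (Monic (product {j} (λ _ → X))) degree≡j (Factorization.monic-degree φ)) φ)
    where
    φ : Factorization j (product {j} (λ _ → X))
    φ = factorization (λ _ → X) (λ _ → 1) (λ _ → X-prime) ≋-refl
    degree≡j : ∑ (allFin j) (λ _ → 1) ≡ j
    degree≡j = ≡.trans (∑-const (allFin j) 1) (≡.trans (ℕₚ.*-identityʳ _) (Listₚ.length-tabulate {n = j} id))
    nonempty : ∀ {xs : List Poly} {P : Poly → Set} → Any P xs → 1 ℕ.≤ length xs
    nonempty (here _)  = s≤s z≤n
    nonempty (there _) = s≤s z≤n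

  open Asymptotics q 2≤q π a ∑-π≤ recursion a-0-suc a-suc-0 public
    using (b; x; x-cauchy; strictly-decreasing)

  coefficients : ∀ n → Poly → Vec Carrier n
  coefficients n p = Vec.tabulate (λ i → coeff p (toℕ i))

  coefficients-poly : ∀ {p} n → Monic p n → Vec.toList (coefficients n p) ∷ʳ 1# ≋ p
  coefficients-poly zero l = ≋-sym (Lead-const l)
  coefficients-poly {[]}    (suc n) (lead l _) = contradiction (sym l) 1≉0
  coefficients-poly {c ∷ p} (suc n) l = ∷-cong refl (coefficients-poly n (Lead-tail l))

  toMonic : ∀ n .{{_ : NonZero n}} → Poly → NonconstantMonic
  toMonic n@(suc _) p = monic n (coefficients n p)

  poly-toMonic : ∀ {p} n .{{_ : NonZero n}} → Monic p n → poly (toMonic n p) ≋ p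
  poly-toMonic n@(suc _) l = coefficients-poly n l

  poly-Monic : ∀ f → Monic (poly f) (degree f)
  poly-Monic (monic n lower) = go lower
    where
    go : ∀ {n} (v : Vec Carrier n) → Monic (Vec.toList v ∷ʳ 1#) n
    go []      = Monic-1
    go (c ∷ v) = Lead-∷ (go v)

  degree-cong : ∀ {f g} → poly f ≋ poly g → degree f ≡ degree g
  degree-cong {f} {g} e = Monic-unique (Lead-resp e (poly-Monic f)) (poly-Monic g)

  -- The two notions of irreducibility differ only in the wrapper `_≋_` around `_≈ₚ_`.
  irreducible⁺ : ∀ {p} → Polynomial.Irreducible commutativeRing p → Irreducible p
  irreducible⁺ irr = mkIrred
    (λ (u , e) → Polynomial.Irreducible.p∤1 irr record { quotient = u ; equality = at e })
    (λ e → Sum.map (λ d → _∣ʳ_.quotient d , ⟪ _∣ʳ_.equality d ⟫) (λ d → _∣ʳ_.quotient d , ⟪ _∣ʳ_.equality d ⟫)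
      (Polynomial.Irreducible.split-∣1 irr (at e)))
    where open import Algebra.Definitions.RawMagma using (_∣ʳ_)

  irreducible⁻ : ∀ {p} → Irreducible p → Polynomial.Irreducible commutativeRing p
  irreducible⁻ irr = record
    { p∤1 = λ d → Irreducible.p∤1 irr (_∣ʳ_.quotient d , ⟪ _∣ʳ_.equality d ⟫)
    ; split-∣1 = λ e → Sum.map (λ (u , e) → record { quotient = u ; equality = at e })
        (λ (u , e) → record { quotient = u ; equality = at e }) (Irreducible.split-∣1 irr ⟪ e ⟫) }
    where open import Algebra.Definitions.RawMagma using (_∣ʳ_)

  𝓘⇒Factorization : ∀ {j} f → 𝓘 F j f → Factorization j (poly f)
  𝓘⇒Factorization f (g , irr , e) = factorization (poly ∘ g) (degree ∘ g)
    (λ i → poly-Monic (g i) , irreducible⁺ (irr i)) ⟪ e ⟫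

  Factorization⇒𝓘 : ∀ {j} f → Factorization j (poly f) → 𝓘 F j f
  Factorization⇒𝓘 {j} f (factorization g d pr e) = g′ ,
    (λ i → irreducible⁻ (Irreducible-resp (≋-sym (g′≋g i)) (proj₂ (pr i)))) ,
    at (≋-trans e (≋-sym (product-cong g′≋g)))
    where
    d-nonZero : ∀ i → NonZero (d i)
    d-nonZero i = ℕ.>-nonZero (Irreducible-degree (proj₁ (pr i)) (proj₂ (pr i)))
    g′ : Fin j → NonconstantMonic
    g′ i = toMonic (d i) {{d-nonZero i}} (g i)
    g′≋g : ∀ i → poly (g′ i) ≋ g i
    g′≋g i = poly-toMonic (d i) {{d-nonZero i}} (proj₁ (pr i))

  -- Two empty base cases, because degree 0 is excluded; the bound is strict to match the range of
  -- `x j N`.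
  members : ℕ → ℕ → List NonconstantMonic
  members j zero          = []
  members j (suc zero)    = []
  members j (suc (suc n)) = List.map (toMonic (suc n)) (products j (suc n)) ++ members j (suc n)

  members-𝓘 : ∀ j N → All (λ f → degree f ℕ.< N × 𝓘 F j f) (members j N)
  members-𝓘 j zero          = []
  members-𝓘 j (suc zero)    = []
  members-𝓘 j (suc (suc n)) = Allₚ.++⁺
    (Allₚ.map⁺ (All.zipWith
      (λ {p} (l , φ) → ℕₚ.≤-refl , Factorization⇒𝓘 (toMonic (suc n) p) (Factorization-resp (≋-sym (poly-toMonic (suc n) l)) φ))
      (products-Monic j (suc n) , products-Factorization j (suc n))))
    (All.map (λ (d<n , i) → ℕₚ.m<n⇒m<1+n d<n , i) (members-𝓘 j (suc n)))

  members-unique : ∀ j N → Unique (members j N)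
  members-unique j zero          = []
  members-unique j (suc zero)    = []
  members-unique j (suc (suc n)) = AllPairsₚ.++⁺
    (AllPairsₚ.map⁺ (distinct (products-Monic j (suc n)) (products-unique j (suc n))))
    (members-unique j (suc n))
    (Allₚ.map⁺ (All.universal (λ p → All.map (λ { {f} (d<1+n , _) e →
      ℕₚ.<-irrefl (≡.sym (degree-cong {toMonic (suc n) p} {f} ⟪ e ⟫)) d<1+n }) (members-𝓘 j (suc n))) (products j (suc n))))
    where
    distinct : ∀ {ps} → All (λ p → Monic p (suc n)) ps → AllPairs (λ p r → ¬ p ≋ r) ps →
      AllPairs (λ p r → ¬ poly (toMonic (suc n) p) ≈ₚ poly (toMonic (suc n) r)) ps
    distinct []       []       = []
    distinct (l ∷ ls) (u ∷ us) = All.zipWith (λ (l′ , p≉r) e →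
      p≉r (≋-trans (≋-sym (poly-toMonic (suc n) l)) (≋-trans ⟪ e ⟫ (poly-toMonic (suc n) l′)))) (ls , u) ∷ distinct ls us

  infix 4 _∈ₘ_
  _∈ₘ_ : NonconstantMonic → List NonconstantMonic → Set
  f ∈ₘ L = Any (λ g → poly f ≋ poly g) L

  members-complete : ∀ {j} f N → 𝓘 F j f → degree f ℕ.< N → f ∈ₘ members j N
  members-complete (monic (suc d) lower) (suc zero) _ (s≤s ())
  members-complete {j} f (suc N@(suc n)) i d<1+N = Sum.[
    (λ d<N → Anyₚ.++⁺ʳ (List.map (toMonic N) (products j N)) (members-complete f N i d<N)) ,
    (λ d≡N → Anyₚ.++⁺ˡ (Anyₚ.map⁺ (transport (products-Monic j N)
      (products-complete (≡.subst (Monic (poly f)) d≡N (poly-Monic f)) (𝓘⇒Factorization f i))))) ]′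
    (ℕₚ.m≤n⇒m<n∨m≡n (ℕₚ.≤-pred d<1+N))
    where
    transport : ∀ {ps} → All (λ p → Monic p (suc n)) ps → Any (poly f ≋_) ps →
      Any (λ p → poly f ≋ poly (toMonic (suc n) p)) ps
    transport (l ∷ _)  (here e)  = here (≋-trans e (≋-sym (poly-toMonic (suc n) l)))
    transport (_ ∷ ls) (there p) = there (transport ls p)

  weight≡ : ∀ f → weight F f ≡ inv (q ℕ.^ degree f ℕ.* degree f)
  weight≡ f = 1/≡inv (q ℕ.^ degree f ℕ.* degree f)
    {{ℕₚ.m*n≢0 (q ℕ.^ degree f) (degree f) {{ℕₚ.m^n≢0 q (degree f)}} {{NonconstantMonic.degree-nonZero f}}}}
    where
    1/≡inv : ∀ n .{{_ : NonZero n}} → + 1 / n ≡ inv n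
    1/≡inv (suc n) = ≡.refl

  0≤weight : ∀ f → 0ℚ ℚ.≤ weight F f
  0≤weight f = ℚₚ.≤-trans (0≤inv (q ℕ.^ degree f ℕ.* degree f)) (ℚₚ.≤-reflexive (≡.sym (weight≡ f)))

  weight-cong : ∀ {f g} → poly f ≋ poly g → weight F f ≡ weight F g
  weight-cong {f} {g} e = ≡.trans (weight≡ f)
    (≡.trans (≡.cong (λ n → inv (q ℕ.^ n ℕ.* n)) (degree-cong {f} {g} e)) (≡.sym (weight≡ g)))

  finiteSum-++ : ∀ S T → finiteSum F (S ++ T) ≡ finiteSum F S ℚ.+ finiteSum F T
  finiteSum-++ []      T = ≡.sym (ℚₚ.+-identityˡ _)
  finiteSum-++ (f ∷ S) T = ≡.trans (≡.cong (weight F f ℚ.+_) (finiteSum-++ S T))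
    (≡.sym (ℚₚ.+-assoc (weight F f) (finiteSum F S) (finiteSum F T)))

  finiteSum-map : ∀ n ps → finiteSum F (List.map (toMonic (suc n)) ps) ≡ ⟦ length ps ⟧ ℚ.* (U (suc n) ℚ.* inv (suc n))
  finiteSum-map n []       = ≡.sym (ℚₚ.*-zeroˡ (U (suc n) ℚ.* inv (suc n)))
  finiteSum-map n (p ∷ ps) = ≡.trans
    (≡.cong₂ ℚ._+_ (≡.trans (weight≡ (toMonic (suc n) p)) (inv-* (q ℕ.^ suc n) (suc n))) (finiteSum-map n ps))
    (≡.trans (solve 2 (λ w k → w :+ k :* w := (con 1ℚ :+ k) :* w) ≡.refl (U (suc n) ℚ.* inv (suc n)) ⟦ length ps ⟧)
      (≡.cong (ℚ._* (U (suc n) ℚ.* inv (suc n))) (≡.sym (⟦⟧-+ 1 (length ps)))))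
    where open +-*-Solver using (solve; _:=_; _:+_; _:*_; con)

  finiteSum-members : ∀ j N → finiteSum F (members j N) ≡ x j N
  finiteSum-members j zero          = ≡.refl
  finiteSum-members j (suc zero)    = ≡.sym (≡.trans (ℚₚ.+-identityʳ _) (ℚₚ.*-zeroʳ (b j 0)))
  finiteSum-members j (suc (suc n)) = ≡.trans
    (finiteSum-++ (List.map (toMonic (suc n)) (products j (suc n))) (members j (suc n)))
    (≡.cong₂ ℚ._+_ (≡.trans (finiteSum-map n (products j (suc n))) (≡.sym (ℚₚ.*-assoc ⟦ a j (suc n) ⟧ (U (suc n)) (inv (suc n)))))
      (finiteSum-members j (suc n)))

  0≤finiteSum : ∀ T → 0ℚ ℚ.≤ finiteSum F T
  0≤finiteSum []      = ℚₚ.≤-refl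
  0≤finiteSum (f ∷ T) = 0≤+ (0≤weight f) (0≤finiteSum T)

  finiteSum-remove : ∀ f {L} (f∈L : f ∈ₘ L) → finiteSum F L ≡ weight F f ℚ.+ finiteSum F (L Any.─ f∈L)
  finiteSum-remove f {g ∷ L} (here e)  = ≡.cong (ℚ._+ finiteSum F L) (≡.sym (weight-cong {f} {g} e))
  finiteSum-remove f {g ∷ L} (there p) = ≡.trans (≡.cong (weight F g ℚ.+_) (finiteSum-remove f p))
    (solve 3 (λ a b c → a :+ (b :+ c) := b :+ (a :+ c)) ≡.refl (weight F g) (weight F f) (finiteSum F (L Any.─ p)))
    where open +-*-Solver using (solve; _:=_; _:+_)

  ∈ₘ-remove : ∀ f g {L} (f∈L : f ∈ₘ L) → ¬ poly f ≈ₚ poly g → g ∈ₘ L → g ∈ₘ (L Any.─ f∈L)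
  ∈ₘ-remove f g (here f≋h) f≉g (here g≋h) = contradiction (at (≋-trans f≋h (≋-sym g≋h))) f≉g
  ∈ₘ-remove f g (here f≋h) f≉g (there p)  = p
  ∈ₘ-remove f g (there p) f≉g (here g≋h)  = here g≋h
  ∈ₘ-remove f g (there p) f≉g (there r)   = there (∈ₘ-remove f g p f≉g r)

  -- Each `f` of `T` is cancelled against an equal entry of `L`. As `T` has no duplicates, its later
  -- elements are still found among the remaining entries.
  finiteSum-⊆ : ∀ T {L} → Unique T → All (_∈ₘ L) T → finiteSum F T ℚ.≤ finiteSum F L
  finiteSum-⊆ []      {L} _ _ = 0≤finiteSum L
  finiteSum-⊆ (f ∷ T) {L} (f≉T ∷ unique) (f∈L ∷ T⊆L) = ℚₚ.≤-trans
    (ℚₚ.+-monoʳ-≤ (weight F f) (finiteSum-⊆ T unique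
      (All.zipWith (λ {g} (f≉g , g∈L) → ∈ₘ-remove f g f∈L f≉g g∈L) (f≉T , T⊆L))))
    (ℚₚ.≤-reflexive (≡.sym (finiteSum-remove f f∈L)))

  degree-bound : ∀ T → ∃ λ D → All (λ f → degree f ℕ.< D) T
  degree-bound []      = 0 , []
  degree-bound (f ∷ T) with D , bound ← degree-bound T = suc (degree f) ℕ.⊔ D ,
    ℕₚ.m≤m⊔n (suc (degree f)) D ∷ All.map (λ d<D → ℕₚ.≤-trans d<D (ℕₚ.m≤n⊔m (suc (degree f)) D)) bound

  sumℝ : ℕ → ℝ
  sumℝ j = mkℝ (x j) (x-cauchy j)

  -- A finite subset has bounded degree and so lies within some `members j n`; conversely these
  -- lists are themselves finite subsets whose sums are the terms of the sequence.
  sumℝ-is𝓕 : ∀ j → Is𝓕 F (𝓘 F j) (sumℝ j)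
  sumℝ-is𝓕 j = record { upper = upper ; least = least }
    where
    upper : ∀ T → FiniteSubset F (𝓘 F j) T → fromℚ (finiteSum F T) ≤ℝ sumℝ j
    upper T (unique , all𝓘) η 0<η with D , bound ← degree-bound T = D , λ n D≤n → begin
      finiteSum F T              ≤⟨ finiteSum-⊆ T unique (All.zipWith
                                      (λ {f} (i , d<D) → members-complete f n i (ℕₚ.≤-trans d<D D≤n)) (all𝓘 , bound)) ⟩
      finiteSum F (members j n)  ≡⟨ finiteSum-members j n ⟩
      x j n                      ≤⟨ p≤p+r (ℚₚ.<⇒≤ 0<η) ⟩
      x j n ℚ.+ η                ∎
      where open ℚₚ.≤-Reasoning
    least : ∀ y → y <ℝ sumℝ j → ∃ λ T → FiniteSubset F (𝓘 F j) T × y <ℝ fromℚ (finiteSum F T)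
    -- The sum of the chosen list is a fixed rational while `y` still moves with `n`. Beyond its
    -- modulus for η/2 it moves by at most η/2, and the other half of the margin remains.
    least y (η , 0<η , N , y+η≤x) = members j M , (members-unique j M , All.map proj₂ (members-𝓘 j M)) ,
      ½ ℚ.* η , 0<½η , M , λ n M≤n → begin
        seq y n ℚ.+ ½ ℚ.* η
          ≡⟨ solve 3 (λ a b e → a :+ con ½ :* e := ((a :- b) :+ b) :+ con ½ :* e) ≡.refl (seq y n) (seq y M) η ⟩
        ((seq y n ℚ.- seq y M) ℚ.+ seq y M) ℚ.+ ½ ℚ.* η
          ≤⟨ ℚₚ.+-monoˡ-≤ (½ ℚ.* η) (ℚₚ.+-monoˡ-≤ (seq y M) (ℚₚ.≤-trans (p≤∣p∣ (seq y n ℚ.- seq y M))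
               (proj₂ (cauchy y (½ ℚ.* η) 0<½η) n M (ℕₚ.≤-trans (ℕₚ.m≤n⊔m N N′) M≤n) (ℕₚ.m≤n⊔m N N′)))) ⟩
        (½ ℚ.* η ℚ.+ seq y M) ℚ.+ ½ ℚ.* η
          ≡⟨ solve 2 (λ b e → (con ½ :* e :+ b) :+ con ½ :* e := b :+ e) ≡.refl (seq y M) η ⟩
        seq y M ℚ.+ η
          ≤⟨ y+η≤x M (ℕₚ.m≤m⊔n N N′) ⟩
        x j M
          ≡⟨ finiteSum-members j M ⟨
        finiteSum F (members j M) ∎
      where
      open ℚₚ.≤-Reasoning
      open +-*-Solver using (solve; _:=_; _:+_; _:*_; _:-_; con)
      0<½η : 0ℚ ℚ.< ½ ℚ.* η
      0<½η = 0<* (0<inv 1) 0<η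
      N′ M : ℕ
      N′ = proj₁ (cauchy y (½ ℚ.* η) 0<½η)
      M = N ℕ.⊔ N′
      p≤∣p∣ : ∀ p → p ℚ.≤ ℚ.∣ p ∣
      p≤∣p∣ p with ℚₚ.≤-total 0ℚ p
      ... | inj₁ 0≤p = ℚₚ.≤-reflexive (≡.sym (ℚₚ.0≤p⇒∣p∣≡p 0≤p))
      ... | inj₂ p≤0 = ℚₚ.≤-trans p≤0 (ℚₚ.0≤∣p∣ p)

-- The threshold and its bounds.

open import Data.Nat using (ℕ; suc; _+_; _*_; _∸_; _^_; _≤_; _<_)
open import Data.Integer as ℤ using (ℤ; +_; ∣_∣)
open import Data.Rational using (_/_)
open import Data.Product using (Σ; ∃; _×_)

primePower≥2 : ∀ {q} → IsPrimePower q → 2 ≤ q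
primePower≥2 (p , e , p-prime , 1≤e , ≡.refl) = ℕₚ.≤-trans
  (ℕ.nonTrivial⇒n>1 p {{prime⇒nonTrivial p-prime}})
  (ℕₚ.≤-trans (ℕₚ.≤-reflexive (≡.sym (ℕₚ.*-identityʳ p))) (ℕₚ.^-monoʳ-≤ p {{prime⇒nonZero p-prime}} 1≤e))

-- The first term 1/1^s is already 1, so the factor ζ(k)² can only raise the required bound.
ζ-partial≥1 : ∀ s n → 1ℚ ℚ.≤ ζ-partial s (suc n)
ζ-partial≥1 s zero = ℚₚ.≤-reflexive (≡.sym (≡.trans (ℚₚ.+-identityˡ _) (1/1 (1 ^ s) {{ℕₚ.m^n≢0 1 s}} (ℕₚ.^-zeroˡ s))))
  where
  1/1 : ∀ m .{{_ : NonZero m}} → m ≡ 1 → + 1 / m ≡ 1ℚ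
  1/1 m ≡.refl = ≡.refl
ζ-partial≥1 s (suc n) = ℚₚ.≤-trans (ζ-partial≥1 s n)
  (RationalArithmetic.p≤p+r (1/-nonNeg (suc (suc n) ^ s) {{ℕₚ.m^n≢0 (suc (suc n)) s}}))
  where
  1/-nonNeg : ∀ m .{{_ : NonZero m}} → 0ℚ ℚ.≤ + 1 / m
  1/-nonNeg m = ℚₚ.nonNegative⁻¹ (+ 1 / m) {{ℚₚ.normalize-nonNeg 1 m}}

base : ℕ → ℕ
base k = (k ∸ 1) ^ 2 * 4 ^ k

-- The estimates need only 16 (k ∸ 1)².
threshold : ℕ → ℤ
threshold k = + (4 * base k)

-- From `j ≤ k ∸ 1`, together with one factor 4 taken out of the power of 4.
threshold-sufficient : ∀ {j k q} → j < k → threshold k ℤ.≤ + q → 16 * (j * j) ≤ q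
threshold-sufficient {j} {suc k} {q} (s≤s j≤k) (ℤ.+≤+ 4b≤q) = ℕₚ.≤-trans (begin
  16 * (j * j)            ≡⟨ rearrange (j * j) ⟩
  4 * (j * j * 4)         ≤⟨ ℕₚ.*-monoʳ-≤ 4 (ℕₚ.*-mono-≤ (ℕₚ.*-mono-≤ j≤k (ℕₚ.≤-trans j≤k (ℕₚ.≤-reflexive (≡.sym (ℕₚ.*-identityʳ k)))))
                               (ℕₚ.m≤m*n 4 (4 ^ k) {{ℕₚ.m^n≢0 4 k}})) ⟩
  4 * base (suc k)        ∎) 4b≤q
  where
  open ℕₚ.≤-Reasoning
  rearrange : ∀ n → 16 * n ≡ 4 * (n * 4)
  rearrange = solve-∀

threshold-order : ∀ k → ∣ threshold k ∣ ≤ 4 * (k ^ 2 * 4 ^ k)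
threshold-order k = ℕₚ.*-monoʳ-≤ 4 (ℕₚ.*-monoˡ-≤ (4 ^ k) (ℕₚ.^-monoˡ-≤ 2 (ℕₚ.m∸n≤m k 1)))

threshold-bound : ∀ k (2≤k : 2 ≤ k) → fromℤ (threshold k)
  <ℝ fromℚ (+ 403 / 100) *ℝ fromℤ (+ base k) *ℝ (ζ k 2≤k *ℝ ζ k 2≤k)
threshold-bound 1 (s≤s ())
-- The margin is the excess of 4.03 over 4 times `base k`, positive because k ≥ 2 makes `base k`
-- nonzero. The comparison starts at index 1, since `ζ-partial k 0` is 0.
threshold-bound k@(suc (suc k-2)) 2≤k = margin , 0<margin , 1 , λ { (suc n) _ → begin
  ⟦ 4 * base k ⟧ ℚ.+ margin
    ≡⟨ ≡.cong (ℚ._+ margin) (⟦⟧-* 4 (base k)) ⟩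
  ⟦ 4 ⟧ ℚ.* ⟦ base k ⟧ ℚ.+ ⟦ base k ⟧ ℚ.* (+ 3 / 100)
    ≡⟨ solve 1 (λ b → con ⟦ 4 ⟧ :* b :+ b :* con (+ 3 / 100) := (con (+ 403 / 100) :* b) :* (con 1ℚ :* con 1ℚ))
         ≡.refl ⟦ base k ⟧ ⟩
  (+ 403 / 100 ℚ.* ⟦ base k ⟧) ℚ.* (1ℚ ℚ.* 1ℚ)
    ≤⟨ *-monoˡ (+ 403 / 100 ℚ.* ⟦ base k ⟧) (0≤* (ℚₚ.nonNegative⁻¹ (+ 403 / 100)) (0≤⟦⟧ (base k)))
         (*-mono (0≤⟦⟧ 1) (ℚₚ.≤-trans (0≤⟦⟧ 1) (ζ-partial≥1 k n)) (ζ-partial≥1 k n) (ζ-partial≥1 k n)) ⟩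
  (+ 403 / 100 ℚ.* ⟦ base k ⟧) ℚ.* (ζ-partial k (suc n) ℚ.* ζ-partial k (suc n)) ∎ }
  where
  open RationalArithmetic
  open ℚₚ.≤-Reasoning
  open +-*-Solver using (solve; _:=_; _:+_; _:*_; con)
  margin : ℚ
  margin = ⟦ base k ⟧ ℚ.* (+ 3 / 100)
  1≤base : 1 ≤ base k
  1≤base = ℕ.>-nonZero⁻¹ (base k) {{ℕₚ.m*n≢0 (suc k-2 ^ 2) (4 ^ k) {{ℕₚ.m^n≢0 (suc k-2) 2}} {{ℕₚ.m^n≢0 4 k}}}}
  0<margin : 0ℚ ℚ.< margin
  0<margin = 0<* (ℚₚ.<-≤-trans (ℚₚ.positive⁻¹ 1ℚ) (⟦⟧-mono 1≤base)) (ℚₚ.positive⁻¹ (+ 3 / 100))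

theorem5p9 : Σ (ℕ → ℤ) λ qₖ →
    (∀ k → 1 ≤ k →
    ∀ q → IsPrimePower q → qₖ k ℤ.≤ + q →
    (F : FiniteField q) →
    Σ (ℕ → ℝ) λ 𝓕𝓘 →
    (∀ j → 1 ≤ j → j ≤ k → Is𝓕 F (𝓘 F j) (𝓕𝓘 j))
    × (∀ j → 1 ≤ j → j < k → 𝓕𝓘 j >ℝ 𝓕𝓘 (suc j)))
    × (∃ λ C → ∃ λ K → ∀ k → K ≤ k → ∣ qₖ k ∣ ≤ C * (k ^ 2 * 4 ^ k))
    × (∀ k → (2≤k : 2 ≤ k) →
    fromℤ (qₖ k)
    <ℝ fromℚ (+ 403 / 100) *ℝ fromℤ (+ ((k ∸ 1) ^ 2 * 4 ^ k)) *ℝ (ζ k 2≤k *ℝ ζ k 2≤k))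
theorem5p9 = threshold ,
  (λ k _ q q-primePower qₖ≤q F →
    let open Summation F (primePower≥2 q-primePower) in
    sumℝ , (λ j _ _ → sumℝ-is𝓕 j) ,
    (λ j 1≤j j<k → strictly-decreasing j 1≤j (threshold-sufficient {j} {k} j<k qₖ≤q) (1≤a-diagonal j))) ,
  (4 , 0 , λ k _ → threshold-order k) ,
  threshold-bound
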